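{- For pairs of communicating SR-machines the following problems are algorithmically undecidable: (a) given such a pair in which neither machine has a send cycle, is it deadlock-free? (b) given such a deadlock-free pair in which neither machine has a send cycle, does it have the bounded channel property? (c) given an affine such pair, is it deadlock-free? (d) given an affine such pair, does it have the bounded channel property?
   Context: A pair of communicating SR-machines is a CFSM protocol with communication graph having nodes $\{0,1\}$ and two edges $\alpha$ (from $0$ to $1$) and $\beta$ (from $1$ to $0$), disjoint finite message alphabets $M_\alpha,M_\beta$, and two finite state machines $F_j=(K_j,\Sigma_j,T_j,h_j)$, $j=0,1$, with $\Sigma_0=\{ -b:b\in M_\alpha\}\cup\{+b:b\in M_\beta\}$, $\Sigma_1=\{ -b:b\in M_\beta\}\cup\{+b:b\in M_\alpha\}$, $K_j$ finite, $h_j\in K_j$ initial, $T_j\subseteq K_j\times\Sigma_j\times K_j$ (transitions $p\xrightarrow{e}q$; $+b$ = receive, $-b$ = send; $p\xrightarrow{w}q$ means a directed path labelled $w$). A send state has no outgoing $+b$ transition, a receive state no outgoing $-b$ transition. $F_j$ is an SR-machine if every state is a send or a receive state, its transition diagram is strongly connected, and it is deterministic ($p\xrightarrow{e}q_1$, $p\xrightarrow{e}q_2$ imply $q_1=q_2$). Global states are $((p_0,p_1),(x_\alpha,x_\beta))$; initially $((h_0,h_1),(\lambda,\lambda))$. A step is a send (a machine performs $p\xrightarrow{ -b}q$ and $b$ is appended to its output channel: $\alpha$ for $F_0$, $\beta$ for $F_1$) or a receive (a machine performs $p\xrightarrow{+b}q$ and $b$ is removed from the front of its input channel, which must begin with $b$);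 the other machine is unchanged. A global state is deadlocked if both components are receive states and both channels are empty; deadlock-free means no reachable deadlocked global state. Bounded channel property: $|x_\alpha|+|x_\beta|$ bounded over all reachable global states. $\pi_\alpha(w)$ (resp. $\pi_\beta(w)$) is the string of $M_\alpha$- (resp. $M_\beta$-) symbols in $w$, in order, signs removed; $\mathbf Z_j=\{(\pi_\alpha(w),\pi_\beta(w)): h_j\xrightarrow{w}h_j\}$; the pair is affine if $\mathbf Z_0=\mathbf Z_1$. A send cycle of $F_j$ is a directed cycle in its transition diagram all of whose labels are of the form $-b$. -}

module Defs where

open import Data.Bool.Base using (Bool; true; false)
open import Data.Fin.Base using (Fin; toℕ)
open import Data.List.Base using (List; []; _∷_; _∷ʳ_; map; length)
open import Data.List.Membership.Propositional using (_∈_)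
open import Data.List.Relation.Unary.All using (All)
open import Data.Nat.Base using (ℕ; zero; suc; _+_; _≤_; _<_)
open import Data.Product.Base using (_×_; _,_; ∃; ∃₂)
open import Data.Sum.Base using (_⊎_)
open import Data.Vec.Base as Vec using (Vec; []; _∷_)
open import Function.Bundles using (_⇔_)
open import Level using (0ℓ)
open import Relation.Binary.Construct.Closure.ReflexiveTransitive using (Star)
open import Relation.Binary.PropositionalEquality.Core using (_≡_; _≢_)
open import Relation.Nullary using (¬_; Reflects)
open import Relation.Unary using (Pred)

-- The output and input alphabets are Fin o and Fin i.  They are kept apart by
-- the constructors, which is how disjointness of M_α and M_β is represented.

data Action (o i : ℕ) : Set where
  send : Fin o → Action o i
  recv : Fin i → Action o i

record FSM (o i : ℕ) : Set where
  field
    size  : ℕ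
    init  : Fin size
    trans : List (Fin size × Action o i × Fin size)

  State : Set
  State = Fin size

  infix 4 _—[_]→_ _—[_]↠_

  _—[_]→_ : State → Action o i → State → Set
  p —[ e ]→ q = (p , e , q) ∈ trans

  data _—[_]↠_ : State → List (Action o i) → State → Set where
    []  : ∀ {p} → p —[ [] ]↠ p
    _∷_ : ∀ {p q r e w} → p —[ e ]→ q → q —[ w ]↠ r → p —[ e ∷ w ]↠ r

  SendState ReceiveState : Pred State 0ℓ
  SendState    p = ∀ b q → ¬ (p —[ recv b ]→ q)
  ReceiveState p = ∀ b q → ¬ (p —[ send b ]→ q)

  StronglyConnected : Set
  StronglyConnected = ∀ p q → ∃ λ w → p —[ w ]↠ q

  Deterministic : Set
  Deterministic = ∀ {p e q₁ q₂} → p —[ e ]→ q₁ → p —[ e ]→ q₂ → q₁ ≡ q₂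

  data IsSend : Pred (Action o i) 0ℓ where
    send : ∀ b → IsSend (send b)

  HasSendCycle : Set
  HasSendCycle = ∃₂ λ p w → w ≢ [] × All IsSend w × p —[ w ]↠ p

record IsSRMachine {o i} (F : FSM o i) : Set where
  open FSM F
  field
    sendOrReceive     : ∀ p → SendState p ⊎ ReceiveState p
    stronglyConnected : StronglyConnected
    deterministic     : Deterministic

sent : ∀ {o i} → List (Action o i) → List (Fin o)
sent []           = []
sent (send b ∷ w) = b ∷ sent w
sent (recv _ ∷ w) = sent w

received : ∀ {o i} → List (Action o i) → List (Fin i)
received []           = []
received (send _ ∷ w) = received w
received (recv b ∷ w) = b ∷ received w

record Pair : Set where
  field
    mα mβ : ℕ
    F₀    : FSM mα mβ
    F₁    : FSM mβ mα

  module F₀ = FSM F₀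
  module F₁ = FSM F₁

  record Global : Set where
    constructor ⟨_,_∣_,_⟩
    field
      p₀ : F₀.State
      p₁ : F₁.State
      xα : List (Fin mα)
      xβ : List (Fin mβ)

  initial : Global
  initial = ⟨ F₀.init , F₁.init ∣ [] , [] ⟩

  infix 4 _⟶_

  data _⟶_ : Global → Global → Set where
    send₀ : ∀ {p q p₁ xα xβ b} → p F₀.—[ send b ]→ q →
            ⟨ p , p₁ ∣ xα , xβ ⟩ ⟶ ⟨ q , p₁ ∣ xα ∷ʳ b , xβ ⟩
    send₁ : ∀ {p q p₀ xα xβ b} → p F₁.—[ send b ]→ q →
            ⟨ p₀ , p ∣ xα , xβ ⟩ ⟶ ⟨ p₀ , q ∣ xα , xβ ∷ʳ b ⟩
    recv₀ : ∀ {p q p₁ xα xβ b} → p F₀.—[ recv b ]→ q →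
            ⟨ p , p₁ ∣ xα , b ∷ xβ ⟩ ⟶ ⟨ q , p₁ ∣ xα , xβ ⟩
    recv₁ : ∀ {p q p₀ xα xβ b} → p F₁.—[ recv b ]→ q →
            ⟨ p₀ , p ∣ b ∷ xα , xβ ⟩ ⟶ ⟨ p₀ , q ∣ xα , xβ ⟩

  Reachable : Pred Global 0ℓ
  Reachable s = Star _⟶_ initial s

  record Deadlocked (s : Global) : Set where
    open Global s
    field
      receive₀ : F₀.ReceiveState p₀
      receive₁ : F₁.ReceiveState p₁
      emptyα   : xα ≡ []
      emptyβ   : xβ ≡ []

  -- π_α is sent on words of F₀ and received on words of F₁; π_β the reverse.

  Z₀ Z₁ : Pred (List (Fin mα) × List (Fin mβ)) 0ℓ
  Z₀ (x , y) = ∃ λ w → F₀.init F₀.—[ w ]↠ F₀.init × sent w ≡ x × received w ≡ y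
  Z₁ (x , y) = ∃ λ w → F₁.init F₁.—[ w ]↠ F₁.init × received w ≡ x × sent w ≡ y

module _ (P : Pair) where
  open Pair P

  SRPair : Set
  SRPair = IsSRMachine F₀ × IsSRMachine F₁

  NoSendCycles : Set
  NoSendCycles = ¬ F₀.HasSendCycle × ¬ F₁.HasSendCycle

  DeadlockFree : Set
  DeadlockFree = ∀ s → Reachable s → ¬ Deadlocked s

  BoundedChannels : Set
  BoundedChannels = ∃ λ B → ∀ s → Reachable s →
                    length (Global.xα s) + length (Global.xβ s) ≤ B

  Affine : Set
  Affine = ∀ z → Z₀ z ⇔ Z₁ z

data Rec : ℕ → Set where
  zero : ∀ {n} → Rec n
  succ : Rec 1
  proj : ∀ {n} → Fin n → Rec n
  comp : ∀ {m n} → Rec m → Vec (Rec n) m → Rec n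
  prec : ∀ {n} → Rec n → Rec (2 + n) → Rec (1 + n)
  mu   : ∀ {n} → Rec (1 + n) → Rec n

infix 4 _[_]⇓_ _[_]⇓*_

-- Kleene's partial recursive functions; Undecidable below refers to them.
-- f [ xs ]⇓ y : f is defined at xs with value y.

data _[_]⇓_ : ∀ {n} → Rec n → Vec ℕ n → ℕ → Set
data _[_]⇓*_ {n} : ∀ {m} → Vec (Rec n) m → Vec ℕ n → Vec ℕ m → Set

data _[_]⇓_ where
  zero  : ∀ {n} {xs : Vec ℕ n} → zero [ xs ]⇓ 0
  succ  : ∀ {x} → succ [ x ∷ [] ]⇓ suc x
  proj  : ∀ {n} {xs : Vec ℕ n} i → proj i [ xs ]⇓ Vec.lookup xs i
  comp  : ∀ {m n} {f : Rec m} {gs : Vec (Rec n) m} {xs ys z} →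
          gs [ xs ]⇓* ys → f [ ys ]⇓ z → comp f gs [ xs ]⇓ z
  prec0 : ∀ {n} {f : Rec n} {g xs y} →
          f [ xs ]⇓ y → prec f g [ 0 ∷ xs ]⇓ y
  precS : ∀ {n} {f : Rec n} {g xs k y z} →
          prec f g [ k ∷ xs ]⇓ y → g [ k ∷ y ∷ xs ]⇓ z →
          prec f g [ suc k ∷ xs ]⇓ z
  mu    : ∀ {n} {f : Rec (1 + n)} {xs y} →
          (∀ k → k < y → ∃ λ v → f [ k ∷ xs ]⇓ suc v) →
          f [ y ∷ xs ]⇓ 0 → mu f [ xs ]⇓ y

data _[_]⇓*_ {n} where
  []  : ∀ {xs} → [] [ xs ]⇓* []
  _∷_ : ∀ {m} {g : Rec n} {gs : Vec (Rec n) m} {xs y ys} →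
        g [ xs ]⇓ y → gs [ xs ]⇓* ys → g ∷ gs [ xs ]⇓* y ∷ ys

triangle : ℕ → ℕ
triangle zero    = 0
triangle (suc n) = suc n + triangle n

-- Cantor's pairing bijection ℕ × ℕ → ℕ.

⟪_,_⟫ : ℕ → ℕ → ℕ
⟪ x , y ⟫ = triangle (x + y) + y

codeList : List ℕ → ℕ
codeList []       = 0
codeList (x ∷ xs) = suc ⟪ x , codeList xs ⟫

codeAction : ∀ {o i} → Action o i → ℕ
codeAction (send b) = ⟪ 0 , toℕ b ⟫
codeAction (recv b) = ⟪ 1 , toℕ b ⟫

codeFSM : ∀ {o i} → FSM o i → ℕ
codeFSM F = ⟪ size , ⟪ toℕ init , codeList (map codeTransition trans) ⟫ ⟫
  where
  open FSM F
  codeTransition : State × Action _ _ × State → ℕ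
  codeTransition (p , e , q) = ⟪ toℕ p , ⟪ codeAction e , toℕ q ⟫ ⟫

codePair : Pair → ℕ
codePair P = ⟪ mα , ⟪ mβ , ⟪ codeFSM F₀ , codeFSM F₁ ⟫ ⟫ ⟫
  where open Pair P

answer : Bool → ℕ
answer false = 0
answer true  = 1

-- "Given a pair satisfying Q, does it satisfy R?"  Nothing is required of f,
-- not even termination, on inputs that do not code a pair satisfying Q.

Decides : Rec 1 → (Q R : Pred Pair 0ℓ) → Set
Decides f Q R = ∀ P → Q P →
  ∃ λ b → f [ codePair P ∷ [] ]⇓ answer b × Reflects (R P) b

Undecidable : (Q R : Pred Pair 0ℓ) → Set
Undecidable Q R = ¬ (∃ λ f → Decides f Q R)

{-# OPTIONS --safe #-}
module Submission where

-- From a decision procedure f we build a pair that computes f at its own code and then refutes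
-- the answer.
--
-- F₁ echoes every letter, so the pair is a queue machine: F₀ is its control, and both channels
-- together hold its queue.  The queue simulates a counter program, the registers being the numbers
-- of occurrences of letters, and counter programs compute all partial recursive functions.  The
-- input is the length w of a chain of initial states of F₀.  The code of the pair is a primitive
-- recursive function of w and of numbers describing the rest of the pair; taking for w a code of
-- these numbers hands the pair its own code.  If the result is 0, the queue is copied forever: no
-- deadlock, bounded channels.  If it is 1, the queue is emptied, a deadlock, or grows forever.
--
-- For affine pairs each send state also accepts all wrong letters, and a machine returns home once
-- both tapes have reached an end marker; so Z₀ and Z₁ contain all words cut into equally many
-- phases.  After a wrong letter a machine either first completes its own phase (no new deadlock),
-- or first waits for the end of the other's, which comes only under the same condition; then it
-- sends nothing more, and the channels stay bounded.

open import Data.Bool.Base using (Bool; true; false; T)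
open import Data.Empty using (⊥)
open import Data.Fin.Base as Fin using (Fin; zero; suc; toℕ; _↑ˡ_; _↑ʳ_; splitAt)
open import Data.Fin.Induction using (>-weakInduction)
import Data.Fin.Properties as Fin
open import Data.List.Base as List using (List; []; _∷_; _++_; _∷ʳ_; length; foldl; foldr; concatMap; allFin; downFrom; tabulate)
open import Data.List.Membership.Propositional using (_∈_; find; lose)
open import Data.List.Membership.Propositional.Properties using (∈-concatMap⁺; ∈-concatMap⁻; ∈-allFin; ∈-map⁺; ∈-map⁻; ∈-++⁺ˡ; ∈-++⁺ʳ; ∈-++⁻; ∈-tabulate⁺)
open import Data.List.Properties using (++-assoc; ++-identityʳ; ++-identityʳ-unique; ++-cancelˡ; ∷-injective; ∷ʳ-++; length-++; length-map; map-++; map-∘; map-id; map-cong; map-concatMap; map-tabulate; concatMap-cong; concatMap-map; foldl-∷ʳ; foldr-++; tabulate-cong)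
open import Data.List.Relation.Unary.All as All using (All; []; _∷_)
open import Data.List.Relation.Unary.All.Properties using (++⁺; ++⁻; ++⁻ˡ; ++⁻ʳ)
open import Data.List.Relation.Unary.Any using (here; there)
open import Data.Maybe.Base as Maybe using (Maybe; just; nothing; maybe′)
open import Data.Maybe.Properties using (just-injective)
open import Data.Nat.Base
open import Data.Nat.Induction using (<-wellFounded)
open import Data.Nat.Properties
open import Data.Product.Base
open import Data.Product.Function.NonDependent.Propositional using (_×-↔_)
open import Data.Sum.Base
open import Data.Sum.Function.Propositional using (_⊎-↔_)
open import Data.Unit.Base using (⊤; tt)
open import Data.Vec.Base as Vec using (Vec; []; _∷_)
open import Function.Base using (_∘_; case_of_)
open import Function.Bundles using (_↔_; _⇔_; mk⇔; mk↔ₛ′; Inverse; Equivalence)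
open import Function.Properties.Inverse using (↔-sym; ↔-trans; ↔-refl)
open import Induction.WellFounded using (Acc; acc)
open import Level using (0ℓ)
open import Relation.Binary.Construct.Closure.ReflexiveTransitive using (Star; ε; _◅_; _◅◅_; gmap)
open import Relation.Binary.PropositionalEquality
open import Relation.Nullary using (¬_; Dec; yes; no; ofʸ; ofⁿ; contradiction)
open import Relation.Unary using (Pred; _∩_)
open import Defs

-- Diagonalising directly avoids the usual detour through an undecidable halting problem, and with
-- it a universal function: codes are computed from pairs, never interpreted. The price is
-- self-reference. Were the input written into the counter program, the code of the pair would
-- depend on it in an intricate way; a chain of states that differ only in their numbers keeps this
-- dependence a short primitive recursion.
--
-- Nothing is known of `f` outside its promise, so the promise must be proved before anything is
-- known of the run. Connectivity, absence of send cycles and affinity are therefore read off from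
-- the diagrams, and in (b) deadlock-freeness comes from a queue invariant that holds for every
-- program. Strong connectivity conflicts with a run that is meant to stop or grow; it is obtained
-- from edges labelled by end markers, which the intended run never takes. Affinity is harder, as it
-- admits deviating runs, and needs two completions: a machine that goes on sending adds no deadlock
-- but may fill its channel without bound.

opaque
  -- The codes below are astronomically large. Hidden behind `pair`, they are compared by congruence
  -- and never evaluated.
  pair : ℕ → ℕ → ℕ
  pair x y = ⟪ x , y ⟫

  ⟪⟫≡pair : ∀ {x x' y y'} → x ≡ x' → y ≡ y' → ⟪ x , y ⟫ ≡ pair x' y'
  ⟪⟫≡pair refl refl = refl

-- Primitive recursive functions, and the code of a pair as one of them.

record Fn (n : ℕ) : Set where
  constructor fn
  field
    fun     : Vec ℕ n → ℕ
    code    : Rec n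
    correct : ∀ xs → code [ xs ]⇓ fun xs
open Fn

var : ∀ {n} → Fin n → Fn n
var i = fn (λ xs → Vec.lookup xs i) (proj i) (λ _ → proj i)

zeroFn : ∀ {n} → Fn n
zeroFn = fn (λ _ → 0) zero (λ _ → zero)

succFn : Fn 1
succFn = fn (λ xs → suc (Vec.head xs)) succ (λ { (_ ∷ []) → succ })

compFn : ∀ {m n} → Fn m → Vec (Fn n) m → Fn n
compFn {m} {n} f gs = fn (λ xs → fun f (values gs xs)) (comp (code f) (Vec.map code gs))
                 (λ xs → comp (evaluates gs xs) (correct f _))
  where
  values : ∀ {k} → Vec (Fn n) k → Vec ℕ n → Vec ℕ k
  values gs xs = Vec.map (λ g → fun g xs) gs
  evaluates : ∀ {k} (gs : Vec (Fn n) k) xs → Vec.map code gs [ xs ]⇓* values gs xs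
  evaluates []       xs = []
  evaluates (g ∷ gs) xs = correct g xs ∷ evaluates gs xs

primrec : ∀ {n} → Fn n → Fn (2 + n) → Fn (1 + n)
primrec {n} f g = fn (λ { (k ∷ xs) → value k xs }) (prec (code f) (code g)) (λ { (k ∷ xs) → evaluates k xs })
  where
  value : ℕ → Vec ℕ n → ℕ
  value zero    xs = fun f xs
  value (suc k) xs = fun g (k ∷ value k xs ∷ xs)
  evaluates : ∀ k xs → prec (code f) (code g) [ k ∷ xs ]⇓ value k xs
  evaluates zero    xs = prec0 (correct f xs)
  evaluates (suc k) xs = precS (evaluates k xs) (correct g _)

-- Keeps the program but trades the function for a readable one, so that later equations speak of
-- `triangle` or `diagonal` instead of the recursion that computes them.
respecify : ∀ {n} (f : Fn n) (F : Vec ℕ n → ℕ) → (∀ xs → fun f xs ≡ F xs) → Fn n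
respecify f F eq = fn F (code f) (λ xs → subst (code f [ xs ]⇓_) (eq xs) (correct f xs))

pattern v0 = zero
pattern v1 = suc v0
pattern v2 = suc v1
pattern v3 = suc v2
pattern v4 = suc v3

sucᶠ : ∀ {n} → Fn n → Fn n
sucᶠ f = compFn succFn (f ∷ [])

infixl 6 _+ᶠ_ _∸ᶠ_

_+ᶠ_ _∸ᶠ_ ⟪_,_⟫ᶠ : ∀ {n} → Fn n → Fn n → Fn n
f +ᶠ g = compFn plus (f ∷ g ∷ [])
  where
  plus : Fn 2
  plus = respecify (primrec (var v0) (sucᶠ (var v1))) (λ { (x ∷ y ∷ []) → x + y }) (λ { (x ∷ y ∷ []) → eq x y })
    where
    eq : ∀ x y → fun (primrec (var v0) (sucᶠ (var v1))) (x ∷ y ∷ []) ≡ x + y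
    eq zero    y = refl
    eq (suc x) y = cong suc (eq x y)
f ∸ᶠ g = compFn monus (g ∷ f ∷ [])
  where
  predecessor : Fn 1
  predecessor = respecify (primrec zeroFn (var v0)) (λ { (x ∷ []) → pred x }) (λ { (zero ∷ []) → refl ; (suc x ∷ []) → refl })
  monus : Fn 2
  monus = respecify (primrec (var v0) (compFn predecessor (var v1 ∷ []))) (λ { (y ∷ x ∷ []) → x ∸ y }) (λ { (y ∷ x ∷ []) → eq y x })
    where
    eq : ∀ y x → fun (primrec (var v0) (compFn predecessor (var v1 ∷ []))) (y ∷ x ∷ []) ≡ x ∸ y
    eq zero    x = refl
    eq (suc y) x = trans (cong pred (eq y x)) (pred[m∸n]≡m∸[1+n] x y)

triangleᶠ : ∀ {n} → Fn n → Fn n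
triangleᶠ f = compFn tri (f ∷ [])
  where
  step : Fn 2
  step = sucᶠ (var v0) +ᶠ var v1
  tri : Fn 1
  tri = respecify (primrec zeroFn step) (λ { (x ∷ []) → triangle x }) (λ { (x ∷ []) → eq x })
    where
    eq : ∀ x → fun (primrec zeroFn step) (x ∷ []) ≡ triangle x
    eq zero    = refl
    eq (suc x) = cong (suc x +_) (eq x)

⟪ f , g ⟫ᶠ = compFn cantor (f ∷ g ∷ [])
  where
  cantor : Fn 2
  cantor = respecify (triangleᶠ (var v0 +ᶠ var v1) +ᶠ var v1) (λ { (x ∷ y ∷ []) → pair x y })
                     (λ { (x ∷ y ∷ []) → ⟪⟫≡pair {x} refl refl })

-- The largest s with triangle s ≤ x.
root : ℕ → ℕ
root zero    = 0
root (suc x) = root x + (1 ∸ (triangle (suc (root x)) ∸ suc x))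

unpair₁ unpair₂ : ℕ → ℕ
unpair₂ z = z ∸ triangle (root z)
unpair₁ z = root z ∸ unpair₂ z

-- The numbers with root `s` form a block of `suc s` numbers that starts at `triangle s`. The
-- truncated subtractions in `root` are a test that yields 1 exactly when the next number opens a
-- new block; the inductive cases are such a step and a step inside a block.
root-triangle : ∀ s y → y ≤ s → root (triangle s + y) ≡ s
root-triangle zero    zero    _ = refl
root-triangle (suc s) zero    _
  rewrite +-identityʳ (s + triangle s) | +-comm s (triangle s) | root-triangle s s ≤-refl
        | +-comm (triangle s) s | n∸n≡0 (s + triangle s) = +-comm s 1
root-triangle s (suc y) y<s
  rewrite +-suc (triangle s) y | root-triangle s y (<⇒≤ y<s) | +-comm s (triangle s)
        | [m+n]∸[m+o]≡n∸o (triangle s) s y | m≤n⇒m∸n≡0 (m<n⇒0<n∸m y<s) = +-identityʳ s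

unpair₂-pair : ∀ x y → unpair₂ (pair x y) ≡ y
unpair₂-pair x y rewrite sym (⟪⟫≡pair {x} {x} {y} refl refl) | root-triangle (x + y) y (m≤n+m y x) = m+n∸m≡n (triangle (x + y)) y

unpair₁-pair : ∀ x y → unpair₁ (pair x y) ≡ x
unpair₁-pair x y rewrite unpair₂-pair x y | sym (⟪⟫≡pair {x} {x} {y} refl refl) | root-triangle (x + y) y (m≤n+m y x) = m+n∸n≡m x y

rootᶠ unpair₁ᶠ unpair₂ᶠ : ∀ {n} → Fn n → Fn n
rootᶠ f = compFn r (f ∷ [])
  where
  step : Fn 2
  step = var v1 +ᶠ (sucᶠ zeroFn ∸ᶠ (triangleᶠ (sucᶠ (var v1)) ∸ᶠ sucᶠ (var v0)))
  r : Fn 1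
  r = respecify (primrec zeroFn step) (λ { (x ∷ []) → root x }) (λ { (x ∷ []) → eq x })
    where
    eq : ∀ x → fun (primrec zeroFn step) (x ∷ []) ≡ root x
    eq zero    = refl
    eq (suc x) = cong (λ r → r + (1 ∸ (triangle (suc r) ∸ suc x))) (eq x)
unpair₂ᶠ f = f ∸ᶠ triangleᶠ (rootᶠ f)
unpair₁ᶠ f = rootᶠ f ∸ᶠ unpair₂ᶠ f

codeEdge : ℕ → ℕ → ℕ → ℕ
codeEdge p b q = (pair p (pair (pair 0 b) q))

wrongCode : ℕ → ℕ → ℕ → ℕ
wrongCode zero    p t = t
wrongCode (suc j) p t = suc (pair (codeEdge p (suc j) (2 + j)) (wrongCode j p t))

-- Links are numbered upwards from `bottom`, which has number `n`. The successor of link `k`, number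
-- `suc (n + k)`, is then `n + k` whether it is another link or `bottom`, and one formula covers the
-- whole chain.
chainCode : ℕ → ℕ → ℕ → ℕ → ℕ
chainCode zero    n l t = t
chainCode (suc k) n l t = suc (pair (codeEdge (suc (n + k)) 0 (n + k)) (wrongCode l (suc (n + k)) (chainCode k n l t)))

-- Here `m` is the size of both alphabets, `c` the code of `F₁`, `n` the number of `bottom`, `l` the
-- number of wrong letters at a link, and `t` the code of the list of transitions outside the chain.
-- These five do not depend on `w`, so `w` can be chosen as their code without circularity.
hardwiredCode : ℕ → ℕ → ℕ → ℕ → ℕ → ℕ → ℕ
hardwiredCode w m c n l t =
  (pair m (pair m (pair (pair (suc (n + w)) (pair 0 (suc (pair (codeEdge 0 0 (n + w)) (chainCode w n l t))))) c)))

diagonal : ℕ → ℕ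
diagonal w = hardwiredCode w (unpair₁ w) (unpair₁ w₁) (unpair₁ w₂) (unpair₁ w₃) (unpair₂ w₃)
  where
  w₁ w₂ w₃ : ℕ
  w₁ = unpair₂ w
  w₂ = unpair₂ w₁
  w₃ = unpair₂ w₂

diagonal-pairs : ∀ m c n l t → let w = (pair m (pair c (pair n (pair l t)))) in
                 diagonal w ≡ hardwiredCode w m c n l t
diagonal-pairs m c n l t = cong₅ (hardwiredCode w)
  (unpair₁-pair m _)
  (trans (cong unpair₁ eq₁) (unpair₁-pair c _))
  (trans (cong unpair₁ eq₂) (unpair₁-pair n _))
  (trans (cong unpair₁ eq₃) (unpair₁-pair l t))
  (trans (cong unpair₂ eq₃) (unpair₂-pair l t))
  where
  w : ℕ
  w = (pair m (pair c (pair n (pair l t))))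
  eq₁ : unpair₂ w ≡ (pair c (pair n (pair l t)))
  eq₁ = unpair₂-pair m _
  eq₂ : unpair₂ (unpair₂ w) ≡ (pair n (pair l t))
  eq₂ = trans (cong unpair₂ eq₁) (unpair₂-pair c _)
  eq₃ : unpair₂ (unpair₂ (unpair₂ w)) ≡ (pair l t)
  eq₃ = trans (cong unpair₂ eq₂) (unpair₂-pair n _)
  cong₅ : ∀ (g : ℕ → ℕ → ℕ → ℕ → ℕ → ℕ) {a a' b b' c c' d d' e e'} →
          a ≡ a' → b ≡ b' → c ≡ c' → d ≡ d' → e ≡ e' → g a b c d e ≡ g a' b' c' d' e'
  cong₅ g refl refl refl refl refl = refl

diagonalᶠ : Fn 1
diagonalᶠ = respecify body (λ { (w ∷ []) → diagonal w }) (λ { (w ∷ []) → refl })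
  where
  edge : ∀ {n} → Fn n → Fn n → Fn n → Fn n
  edge p b q = ⟪ p , ⟪ ⟪ zeroFn , b ⟫ᶠ , q ⟫ᶠ ⟫ᶠ

  wrongStep : Fn 4
  wrongStep = sucᶠ ⟪ edge (var v2) (sucᶠ (var v0)) (sucᶠ (sucᶠ (var v0))) , var v1 ⟫ᶠ

  wrong : Fn 3
  wrong = respecify (primrec (var v1) wrongStep) (λ { (l ∷ p ∷ t ∷ []) → wrongCode l p t }) (λ { (l ∷ p ∷ t ∷ []) → eq l p t })
    where
    eq : ∀ l p t → fun (primrec (var v1) wrongStep) (l ∷ p ∷ t ∷ []) ≡ wrongCode l p t
    eq zero    p t = refl
    eq (suc l) p t = cong (λ c → suc (pair (codeEdge p (suc l) (2 + l)) c)) (eq l p t)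

  chainStep : Fn 5
  chainStep = sucᶠ ⟪ edge (sucᶠ (var v2 +ᶠ var v0)) zeroFn (var v2 +ᶠ var v0)
                   , compFn wrong (var v3 ∷ sucᶠ (var v2 +ᶠ var v0) ∷ var v1 ∷ []) ⟫ᶠ

  chain : Fn 4
  chain = respecify (primrec (var v2) chainStep) (λ { (k ∷ n ∷ l ∷ t ∷ []) → chainCode k n l t }) (λ { (k ∷ n ∷ l ∷ t ∷ []) → eq k n l t })
    where
    eq : ∀ k n l t → fun (primrec (var v2) chainStep) (k ∷ n ∷ l ∷ t ∷ []) ≡ chainCode k n l t
    eq zero    n l t = refl
    eq (suc k) n l t = cong (λ c → suc (pair (codeEdge (suc (n + k)) 0 (n + k)) (wrongCode l (suc (n + k)) c))) (eq k n l t)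

  w w₁ w₂ w₃ m c n l t : Fn 1
  w  = var v0
  w₁ = unpair₂ᶠ w
  w₂ = unpair₂ᶠ w₁
  w₃ = unpair₂ᶠ w₂
  m  = unpair₁ᶠ w
  c  = unpair₁ᶠ w₁
  n  = unpair₁ᶠ w₂
  l  = unpair₁ᶠ w₃
  t  = unpair₂ᶠ w₃

  body : Fn 1
  body = ⟪ m , ⟪ m , ⟪ ⟪ sucᶠ (n +ᶠ w) , ⟪ zeroFn , sucᶠ ⟪ edge zeroFn zeroFn (n +ᶠ w)
         , compFn chain (w ∷ n ∷ l ∷ t ∷ []) ⟫ᶠ ⟫ᶠ ⟫ᶠ , c ⟫ᶠ ⟫ᶠ ⟫ᶠ

-- Opaque: the compiled program must not be unfolded.
opaque
  shiftedDiagonal : Rec 1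
  shiftedDiagonal = code (compFn diagonalᶠ ((var v0 ∸ᶠ sucᶠ zeroFn) ∷ []))

  -- The initial state and each of the `w` links send one letter, so the input register starts at
  -- `suc w`.
  shiftedDiagonal-correct : ∀ w → shiftedDiagonal [ suc w ∷ [] ]⇓ diagonal w
  shiftedDiagonal-correct w = correct (compFn diagonalᶠ ((var v0 ∸ᶠ sucᶠ zeroFn) ∷ [])) (suc w ∷ [])

-- Counter programs for the partial recursive functions.

infixr 5 _⨟_

-- loop i P is "while register i is nonzero, decrement it and run P".
data Prog : Set where
  skip : Prog
  inc  : ℕ → Prog
  _⨟_  : Prog → Prog → Prog
  loop : ℕ → Prog → Prog

Memory : Set
Memory = ℕ → ℕ

infixl 8 _[_≔_]

_[_≔_] : Memory → ℕ → ℕ → Memory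
(ρ [ i ≔ n ]) j with j ≟ i
... | yes _ = n
... | no _  = ρ j

≔-same : ∀ ρ i n → (ρ [ i ≔ n ]) i ≡ n
≔-same ρ i n with i ≟ i
... | yes _ = refl
... | no ¬p = contradiction refl ¬p

≔-other : ∀ ρ {i n j} → j ≢ i → (ρ [ i ≔ n ]) j ≡ ρ j
≔-other ρ {i} {n} {j} j≢i with j ≟ i
... | yes p = contradiction p j≢i
... | no _  = refl

data Run : Prog → Memory → Memory → Set where
  skip  : ∀ {ρ} → Run skip ρ ρ
  inc   : ∀ {i ρ} → Run (inc i) ρ (ρ [ i ≔ suc (ρ i) ])
  _⨟_   : ∀ {P Q ρ σ τ} → Run P ρ σ → Run Q σ τ → Run (P ⨟ Q) ρ τ
  stop  : ∀ {i P ρ} → ρ i ≡ 0 → Run (loop i P) ρ ρ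
  again : ∀ {i P n ρ σ τ} → ρ i ≡ suc n → Run P (ρ [ i ≔ n ]) σ →
          Run (loop i P) σ τ → Run (loop i P) ρ τ

clear : ℕ → Prog
clear i = loop i skip

move : ℕ → ℕ → Prog
move x o = loop x (inc o)

-- t is a scratch register holding 0.
copy : ℕ → ℕ → ℕ → Prog
copy x o t = loop x (inc o ⨟ inc t) ⨟ move t x

clears : ℕ → ℕ → Prog
clears b zero    = skip
clears b (suc m) = clear b ⨟ clears (suc b) m

range : ℕ → (m : ℕ) → Vec ℕ m
range b zero    = []
range b (suc m) = b ∷ range (suc b) m

-- Registers from b on are scratch.
compile : ∀ {n} → Rec n → Vec ℕ n → (o b : ℕ) → Prog
compiles : ∀ {m n} → Vec (Rec n) m → Vec ℕ n → (o b : ℕ) → Prog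

compile zero           xs       o b = skip
compile succ           (x ∷ []) o b = copy x o b ⨟ inc o
compile (proj i)       xs       o b = copy (Vec.lookup xs i) o b
compile (comp {m} f gs) xs      o b = compiles gs xs b (b + m) ⨟ compile f (range b m) o (b + m) ⨟ clears b m
compile (prec f g)     (x ∷ xs) o b =
  copy x b (suc b) ⨟ compile f xs (2 + b) (4 + b) ⨟
  loop b (compile g (1 + b ∷ 2 + b ∷ xs) (3 + b) (4 + b) ⨟ clear (2 + b) ⨟ move (3 + b) (2 + b) ⨟ inc (1 + b)) ⨟
  clear (1 + b) ⨟ move (2 + b) o
compile (mu f)         xs       o b =
  compile f (b ∷ xs) (1 + b) (2 + b) ⨟
  loop (1 + b) (clear (1 + b) ⨟ inc b ⨟ compile f (b ∷ xs) (1 + b) (2 + b)) ⨟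
  move b o

compiles []       xs o b = skip
compiles (g ∷ gs) xs o b = compile g xs o b ⨟ compiles gs xs (suc o) b

Zero≥ : ℕ → Memory → Set
Zero≥ b ρ = ∀ j → b ≤ j → ρ j ≡ 0

-- All registers but `o` end as they began. In particular scratch that was 0 is 0 again for the next
-- piece of program.
Sets : Prog → Memory → ℕ → ℕ → Set
Sets P ρ o v = ∃ λ σ → Run P ρ σ × σ o ≡ v × (∀ j → j ≢ o → σ j ≡ ρ j)

clear-correct : ∀ i ρ → Sets (clear i) ρ i 0
clear-correct i ρ = go (ρ i) ρ refl
  where
  go : ∀ n ρ → ρ i ≡ n → Sets (clear i) ρ i 0
  go zero    ρ eq = ρ , stop eq , eq , λ _ _ → refl
  go (suc n) ρ eq with go n (ρ [ i ≔ n ]) (≔-same ρ i n)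
  ... | σ , run , z , frame = σ , again eq skip run , z , λ j j≢ → trans (frame j j≢) (≔-other ρ j≢)

move-correct : ∀ {x o} ρ → x ≢ o → ∃ λ σ → Run (move x o) ρ σ × σ x ≡ 0 × σ o ≡ ρ x + ρ o ×
               (∀ j → j ≢ x → j ≢ o → σ j ≡ ρ j)
move-correct {x} {o} ρ x≢o = go (ρ x) ρ refl
  where
  go : ∀ n ρ → ρ x ≡ n → ∃ λ σ → Run (move x o) ρ σ × σ x ≡ 0 × σ o ≡ n + ρ o × (∀ j → j ≢ x → j ≢ o → σ j ≡ ρ j)
  go zero    ρ eq = ρ , stop eq , eq , refl , λ _ _ _ → refl
  go (suc n) ρ eq with go n (ρ [ x ≔ n ] [ o ≔ suc ((ρ [ x ≔ n ]) o) ]) (trans (≔-other (ρ [ x ≔ n ]) x≢o) (≔-same ρ x n))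
  ... | σ , run , z , s , frame = σ , again eq inc run , z
      , trans s (trans (cong (n +_) (trans (≔-same (ρ [ x ≔ n ]) o _) (cong suc (≔-other ρ (≢-sym x≢o))))) (+-suc n (ρ o)))
      , λ j j≢x j≢o → trans (frame j j≢x j≢o) (trans (≔-other (ρ [ x ≔ n ]) j≢o) (≔-other ρ j≢x))

copy-correct : ∀ {x o t} ρ → x ≢ o → x ≢ t → o ≢ t → ρ o ≡ 0 → ρ t ≡ 0 → Sets (copy x o t) ρ o (ρ x)
copy-correct {x} {o} {t} ρ x≢o x≢t o≢t o0 t0 = done
  where
  split : ∀ n ρ → ρ x ≡ n → ∃ λ σ → Run (loop x (inc o ⨟ inc t)) ρ σ × σ x ≡ 0 × σ o ≡ n + ρ o × σ t ≡ n + ρ t ×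
          (∀ j → j ≢ x → j ≢ o → j ≢ t → σ j ≡ ρ j)
  split zero    ρ eq = ρ , stop eq , eq , refl , refl , λ _ _ _ _ → refl
  split (suc n) ρ eq = let σ , run , z , s , s' , frame = split n ρ₃ x₃ in
    σ , again eq (inc ⨟ inc) run , z
      , trans s (trans (cong (n +_) o₃) (+-suc n (ρ o)))
      , trans s' (trans (cong (n +_) t₃) (+-suc n (ρ t)))
      , λ j j≢x j≢o j≢t → trans (frame j j≢x j≢o j≢t) (trans (≔-other ρ₂ j≢t) (trans (≔-other ρ₁ j≢o) (≔-other ρ j≢x)))
    where
    ρ₁ ρ₂ ρ₃ : Memory
    ρ₁ = ρ [ x ≔ n ]
    ρ₂ = ρ₁ [ o ≔ suc (ρ₁ o) ]
    ρ₃ = ρ₂ [ t ≔ suc (ρ₂ t) ]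
    x₃ : ρ₃ x ≡ n
    x₃ = trans (≔-other ρ₂ x≢t) (trans (≔-other ρ₁ x≢o) (≔-same ρ x n))
    o₃ : ρ₃ o ≡ suc (ρ o)
    o₃ = trans (≔-other ρ₂ o≢t) (trans (≔-same ρ₁ o _) (cong suc (≔-other ρ (≢-sym x≢o))))
    t₃ : ρ₃ t ≡ suc (ρ t)
    t₃ = trans (≔-same ρ₂ t _) (cong suc (trans (≔-other ρ₁ (≢-sym o≢t)) (≔-other ρ (≢-sym x≢t))))
  done : Sets (copy x o t) ρ o (ρ x)
  done with split (ρ x) ρ refl
  ... | σ , run , sx , so , st , frame with move-correct {t} {x} σ (≢-sym x≢t)
  ... | τ , run' , τt , τx , frame' = τ , run ⨟ run'
      , trans (frame' o o≢t (≢-sym x≢o)) (trans so (trans (cong (ρ x +_) o0) (+-identityʳ _)))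
      , other
    where
    other : ∀ j → j ≢ o → τ j ≡ ρ j
    other j j≢o with j ≟ t | j ≟ x
    ... | yes refl | _        = trans τt (sym t0)
    ... | no _     | yes refl = trans τx (trans (cong₂ _+_ st sx) (trans (+-identityʳ _) (trans (cong (ρ x +_) t0) (+-identityʳ _))))
    ... | no j≢t   | no j≢x   = trans (frame' j j≢t j≢x) (frame j j≢x j≢o j≢t)

clears-correct : ∀ b m ρ → ∃ λ σ → Run (clears b m) ρ σ × (∀ j → j < b → σ j ≡ ρ j) ×
                 (∀ j → b ≤ j → j < b + m → σ j ≡ 0) × (∀ j → b + m ≤ j → σ j ≡ ρ j)
clears-correct b zero    ρ = ρ , skip , (λ _ _ → refl)
  , (λ j p q → contradiction (≤-<-trans p (subst (j <_) (+-identityʳ b) q)) (<-irrefl refl)) , (λ _ _ → refl)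
clears-correct b (suc m) ρ with clear-correct b ρ
... | σ , run , z , frame with clears-correct (suc b) m σ
... | τ , run' , lo , mid , hi = τ , run ⨟ run'
    , (λ j p → trans (lo j (m<n⇒m<1+n p)) (frame j (<⇒≢ p)))
    , middle
    , λ j p → trans (hi j (subst (_≤ j) (+-suc b m) p)) (frame j (>⇒≢ (<-≤-trans (m<m+n b z<s) p)))
  where
  middle : ∀ j → b ≤ j → j < b + suc m → τ j ≡ 0
  middle j p q with m≤n⇒m<n∨m≡n p
  ... | inj₁ b<j  = mid j b<j (subst (j <_) (+-suc b m) q)
  ... | inj₂ refl = trans (lo b (n<1+n b)) z

Holds : ∀ {n} → Memory → Vec ℕ n → Vec ℕ n → Set
Holds ρ xs vs = ∀ i → ρ (Vec.lookup xs i) ≡ Vec.lookup vs i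

Below : ∀ {n} → ℕ → Vec ℕ n → Set
Below b xs = ∀ i → Vec.lookup xs i < b

Avoids : ∀ {n} → ℕ → Vec ℕ n → Set
Avoids o xs = ∀ i → Vec.lookup xs i ≢ o

range-≥ : ∀ b m i → b ≤ Vec.lookup (range b m) i
range-≥ b (suc m) zero    = ≤-refl
range-≥ b (suc m) (suc i) = <⇒≤ (range-≥ (suc b) m i)

range-< : ∀ b m i → Vec.lookup (range b m) i < b + m
range-< b (suc m) zero    = m<m+n b z<s
range-< b (suc m) (suc i) = subst (Vec.lookup (range (suc b) m) i <_) (sym (+-suc b m)) (range-< (suc b) m i)

-- The state of the primitive recursion loop: r more rounds to go, value v at argument k.
record PrecState (b : ℕ) (ρ σ : Memory) (r k v : ℕ) : Set where
  field
    rounds   : σ b ≡ r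
    argument : σ (1 + b) ≡ k
    value    : σ (2 + b) ≡ v
    result   : σ (3 + b) ≡ 0
    scratch  : Zero≥ (4 + b) σ
    frame    : ∀ j → j < b → σ j ≡ ρ j
open PrecState

Compiled : ∀ {n} → Rec n → Vec ℕ n → ℕ → Set
Compiled f vs v = ∀ xs o b ρ → Holds ρ xs vs → Below b xs → o < b → Avoids o xs → ρ o ≡ 0 → Zero≥ b ρ →
                  Sets (compile f xs o b) ρ o v

precBody : ∀ {n} → Rec (2 + n) → Vec ℕ n → ℕ → Prog
precBody g xs b =
  compile g (1 + b ∷ 2 + b ∷ xs) (3 + b) (4 + b) ⨟ clear (2 + b) ⨟ move (3 + b) (2 + b) ⨟ inc (1 + b)

prec-round : ∀ {n} {g : Rec (2 + n)} {vs k y z} → Compiled g (k ∷ y ∷ vs) z →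
             ∀ xs b ρ σ r → Holds ρ xs vs → Below b xs → PrecState b ρ σ (suc r) k y →
             ∃ λ τ → Run (precBody g xs b) (σ [ b ≔ r ]) τ × PrecState b ρ τ r (suc k) z
prec-round {g = g} {vs} {k} {y} {z} compiled xs b ρ σ r holds below st
  with compiled (1 + b ∷ 2 + b ∷ xs) (3 + b) (4 + b) σ₁ holds₁ below₁ (n<1+n _) avoids₁
         (trans (other (3 + b) (1+b+n≢b 2)) (result st))
         (λ j p → trans (other j (>⇒≢ (<-≤-trans (m<n+m b z<s) p))) (scratch st j p))
  where
  1+b+n≢b : ∀ n → suc n + b ≢ b
  1+b+n≢b n = >⇒≢ (m<n+m b z<s)
  σ₁ : Memory
  σ₁ = σ [ b ≔ r ]
  other : ∀ j → j ≢ b → σ₁ j ≡ σ j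
  other j p = ≔-other σ p
  holds₁ : Holds σ₁ (1 + b ∷ 2 + b ∷ xs) (k ∷ y ∷ vs)
  holds₁ zero          = trans (other (1 + b) (1+b+n≢b 0)) (argument st)
  holds₁ (suc zero)    = trans (other (2 + b) (1+b+n≢b 1)) (value st)
  holds₁ (suc (suc i)) = trans (other _ (<⇒≢ (below i))) (trans (frame st _ (below i)) (holds i))
  below₁ : Below (4 + b) (1 + b ∷ 2 + b ∷ xs)
  below₁ zero          = s≤s (s≤s (m≤n+m b 2))
  below₁ (suc zero)    = s≤s (s≤s (s≤s (n≤1+n b)))
  below₁ (suc (suc i)) = <-≤-trans (below i) (m≤n+m b 4)
  avoids₁ : Avoids (3 + b) (1 + b ∷ 2 + b ∷ xs)
  avoids₁ zero          = <⇒≢ (s≤s (s≤s (n≤1+n b)))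
  avoids₁ (suc zero)    = <⇒≢ (n<1+n _)
  avoids₁ (suc (suc i)) = <⇒≢ (<-≤-trans (below i) (m≤n+m b 3))
... | σ₂ , run₂ , set₂ , frame₂ with clear-correct (2 + b) σ₂
... | σ₃ , run₃ , set₃ , frame₃ with move-correct {3 + b} {2 + b} σ₃ (>⇒≢ (n<1+n _))
... | σ₄ , run₄ , zero₄ , set₄ , frame₄ =
  σ₄ [ 1 + b ≔ suc (σ₄ (1 + b)) ] , run₂ ⨟ run₃ ⨟ run₄ ⨟ inc , record
    { rounds   = trans (≔-other σ₄ b≢1) (trans (frame₄ b b≢3 b≢2) (trans (frame₃ b b≢2) (trans (frame₂ b b≢3) (≔-same σ b r))))
    ; argument = trans (≔-same σ₄ (1 + b) _) (cong suc (trans (frame₄ (1 + b) 1≢3 1≢2) (trans (frame₃ (1 + b) 1≢2)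
                   (trans (frame₂ (1 + b) 1≢3) (trans (≔-other σ (≢-sym b≢1)) (argument st))))))
    ; value    = trans (≔-other σ₄ (≢-sym 1≢2)) (trans set₄ (trans (cong₂ _+_ (trans (frame₃ (3 + b) 3≢2) set₂) set₃) (+-identityʳ z)))
    ; result   = trans (≔-other σ₄ (≢-sym 1≢3)) zero₄
    ; scratch  = λ j p → trans (far j (≤-trans (m≤n+m _ 2) p) (≤-trans (n≤1+n _) p) p)
                 (scratch st j p)
    ; frame    = λ j p → trans (near j p) (frame st j p)
    }
  where
  b≢1 : b ≢ 1 + b
  b≢1 = <⇒≢ (n<1+n b)
  b≢2 : b ≢ 2 + b
  b≢2 = <⇒≢ (m<n+m b z<s)
  b≢3 : b ≢ 3 + b
  b≢3 = <⇒≢ (m<n+m b z<s)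
  1≢2 : 1 + b ≢ 2 + b
  1≢2 = <⇒≢ (n<1+n _)
  1≢3 : 1 + b ≢ 3 + b
  1≢3 = <⇒≢ (m<n+m (1 + b) {2} z<s)
  3≢2 : 3 + b ≢ 2 + b
  3≢2 = >⇒≢ (n<1+n _)
  unchanged : ∀ j → j ≢ b → j ≢ 1 + b → j ≢ 2 + b → j ≢ 3 + b → (σ₄ [ 1 + b ≔ suc (σ₄ (1 + b)) ]) j ≡ σ j
  unchanged j p₀ p₁ p₂ p₃ = trans (≔-other σ₄ p₁) (trans (frame₄ j p₃ p₂) (trans (frame₃ j p₂) (trans (frame₂ j p₃) (≔-other σ p₀))))
  far : ∀ j → 2 + b ≤ j → 3 + b ≤ j → 4 + b ≤ j → (σ₄ [ 1 + b ≔ suc (σ₄ (1 + b)) ]) j ≡ σ j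
  far j p₁ p₂ p₃ = unchanged j (>⇒≢ (<-≤-trans (m<n+m b z<s) p₃)) (>⇒≢ p₁) (>⇒≢ p₂) (>⇒≢ p₃)
  near : ∀ j → j < b → (σ₄ [ 1 + b ≔ suc (σ₄ (1 + b)) ]) j ≡ σ j
  near j p = unchanged j (<⇒≢ p) (<⇒≢ (m<n⇒m<1+n p)) (<⇒≢ (m≤n⇒m≤o+n 2 p)) (<⇒≢ (m≤n⇒m≤o+n 3 p))

compile-correct  : ∀ {n} {f : Rec n} {vs v} → f [ vs ]⇓ v → Compiled f vs v
compiles-correct : ∀ {m n} {gs : Vec (Rec n) m} {vs ys} → gs [ vs ]⇓* ys → ∀ xs o b ρ → Holds ρ xs vs →
                   Below o xs → o + m ≤ b → Zero≥ o ρ →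
                   ∃ λ σ → Run (compiles gs xs o b) ρ σ × Holds σ (range o m) ys ×
                           (∀ j → j < o → σ j ≡ ρ j) × Zero≥ (o + m) σ
-- A derivation of `prec f g` adds its last round outermost, whereas a run of the loop starts with
-- the first round. Hence the continuation: any run of the remaining loop, from the memory that
-- holds the value at `k`, is extended backwards to a run of all rounds.
prec-start   : ∀ {n} {f : Rec n} {g : Rec (2 + n)} {vs k y} → prec f g [ k ∷ vs ]⇓ y →
               ∀ xs b ρ σ r → Holds ρ xs vs → Below b xs → PrecState b ρ σ (k + r) 0 0 →
               ∃ λ τ → PrecState b ρ τ r k y ×
                       (∀ {υ} → Run (loop b (precBody g xs b)) τ υ →
                        ∃ λ σ' → Run (compile f xs (2 + b) (4 + b)) σ σ' × Run (loop b (precBody g xs b)) σ' υ)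
prec-correct : ∀ {n} {f : Rec n} {g : Rec (2 + n)} {vs k y} → prec f g [ k ∷ vs ]⇓ y → Compiled (prec f g) (k ∷ vs) y
-- The hypotheses are the induction hypotheses of `compile-correct` at the tested arguments, which
-- separates the search loop from the induction on derivations.
mu-correct   : ∀ {n} {f : Rec (1 + n)} {vs y} → (∀ k → k < y → ∃ λ v → Compiled f (k ∷ vs) (suc v)) →
               Compiled f (y ∷ vs) 0 → Compiled (mu f) vs y

prec-start {f = f} {g} {vs} (prec0 d) xs b ρ σ r holds below st
  with compile-correct d xs (2 + b) (4 + b) σ
         (λ i → trans (frame st _ (below i)) (holds i)) (λ i → m≤n⇒m≤o+n 4 (below i)) (m<n+m (2 + b) {2} z<s)
         (λ i → <⇒≢ (m≤n⇒m≤o+n 2 (below i))) (value st) (scratch st)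
... | τ , run , set , frame' = τ , record
    { rounds   = trans (frame' b (<⇒≢ (m<n+m b z<s))) (rounds st)
    ; argument = trans (frame' (1 + b) (<⇒≢ (n<1+n _))) (argument st)
    ; value    = set
    ; result   = trans (frame' (3 + b) (>⇒≢ (n<1+n _))) (result st)
    ; scratch  = λ j p → trans (frame' j (>⇒≢ (<-≤-trans (m<n+m (2 + b) {2} z<s) p))) (scratch st j p)
    ; frame    = λ j p → trans (frame' j (<⇒≢ (m≤n⇒m≤o+n 2 p))) (frame st j p)
    } , λ run' → τ , run , run'
prec-start {f = f} {g} {vs} (precS {k = k} d e) xs b ρ σ r holds below st
  with prec-start d xs b ρ σ (suc r) holds below (record { PrecState st ; rounds = trans (rounds st) (sym (+-suc k r)) })
... | τ , st' , continue with prec-round (compile-correct e) xs b ρ τ r holds below st'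
... | τ' , run , st″ = τ' , st″ , λ run' → continue (again (rounds st') run run')

prec-correct {f = f} {g} {vs} {k} {y} d (x ∷ xs) o b ρ holds below o<b avoids o0 scratch0
  with copy-correct {x} {b} {suc b} ρ (<⇒≢ (below zero)) (<⇒≢ (m<n⇒m<1+n (below zero))) (<⇒≢ (n<1+n b)) (scratch0 b ≤-refl) (scratch0 (suc b) (n≤1+n b))
... | σ₁ , run₁ , set₁ , frame₁ with prec-start d xs b ρ σ₁ 0 (λ i → holds (suc i)) (λ i → below (suc i)) (record
    { rounds   = trans set₁ (trans (holds zero) (sym (+-identityʳ k)))
    ; argument = above 0 ; value = above 1 ; result = above 2
    ; scratch  = λ j p → trans (frame₁ j (>⇒≢ (<-≤-trans (m<n+m b z<s) p))) (scratch0 j (≤-trans (m≤n+m b 4) p))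
    ; frame    = λ j p → frame₁ j (<⇒≢ p) })
  where
  above : ∀ i → σ₁ (suc i + b) ≡ 0
  above i = trans (frame₁ (suc i + b) (>⇒≢ (m<n+m b z<s))) (scratch0 (suc i + b) (m≤n+m b (suc i)))
... | τ , st , continue with continue (stop (rounds st)) | clear-correct (1 + b) τ
... | σ₂ , run₂ , run₃ | σ₄ , run₄ , set₄ , frame₄ with move-correct {2 + b} {o} σ₄ (>⇒≢ (m≤n⇒m≤o+n 2 o<b))
... | σ₅ , run₅ , zero₅ , set₅ , frame₅ = σ₅ , run₁ ⨟ run₂ ⨟ run₃ ⨟ run₄ ⨟ run₅
    , trans set₅ (trans (cong₂ _+_ (trans (frame₄ (2 + b) (>⇒≢ (n<1+n _))) (value st))
        (trans (frame₄ o (<⇒≢ (m<n⇒m<1+n o<b))) (trans (frame st o o<b) o0))) (+-identityʳ y))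
    , other
  where
  clean : ∀ j → b ≤ j → j ≢ 2 + b → j ≢ 1 + b → τ j ≡ 0
  clean j p p₂ p₁ with m≤n⇒m<n∨m≡n p
  ... | inj₂ refl = rounds st
  ... | inj₁ q with m≤n⇒m<n∨m≡n q
  ... | inj₂ refl = contradiction refl p₁
  ... | inj₁ q with m≤n⇒m<n∨m≡n q
  ... | inj₂ refl = contradiction refl p₂
  ... | inj₁ q with m≤n⇒m<n∨m≡n q
  ... | inj₂ refl = result st
  ... | inj₁ q = scratch st j q
  other : ∀ j → j ≢ o → σ₅ j ≡ ρ j
  other j j≢o with <-≤-connex j b
  ... | inj₁ j<b = trans (frame₅ j (<⇒≢ (m≤n⇒m≤o+n 2 j<b)) j≢o) (trans (frame₄ j (<⇒≢ (m<n⇒m<1+n j<b))) (frame st j j<b))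
  ... | inj₂ b≤j = trans (vanish (j ≟ 2 + b) (j ≟ 1 + b)) (sym (scratch0 j b≤j))
    where
    vanish : Dec (j ≡ 2 + b) → Dec (j ≡ 1 + b) → σ₅ j ≡ 0
    vanish (yes refl) _          = zero₅
    vanish (no p)     (yes refl) = trans (frame₅ j p j≢o) set₄
    vanish (no p)     (no q)     = trans (frame₅ j p j≢o) (trans (frame₄ j q) (clean j b≤j p q))

mu-correct {f = f} {vs} {y} positive vanishes xs o b ρ holds below o<b avoids o0 scratch0
  with eval 0 ρ (scratch0 b ≤-refl) (scratch0 (1 + b) (n≤1+n b)) (λ j p → scratch0 j (≤-trans (m≤n+m b 2) p)) (λ _ _ → refl)
  where
  Body : Prog
  Body = compile f (b ∷ xs) (1 + b) (2 + b)
  eval' : ∀ {v} k → Compiled f (k ∷ vs) v → ∀ σ → σ b ≡ k → σ (1 + b) ≡ 0 → Zero≥ (2 + b) σ → (∀ j → j < b → σ j ≡ ρ j) →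
          Sets Body σ (1 + b) v
  eval' k compiled σ at t0 z same = compiled (b ∷ xs) (1 + b) (2 + b) σ
    (λ { zero → at ; (suc i) → trans (same _ (below i)) (holds i) })
    (λ { zero → m<n+m b z<s ; (suc i) → m≤n⇒m≤o+n 2 (below i) }) (n<1+n _)
    (λ { zero → <⇒≢ (n<1+n b) ; (suc i) → <⇒≢ (m<n⇒m<1+n (below i)) }) t0 z
  -- `k` is the argument under test and `n` the number of tests that still yield a nonzero value:
  -- the induction is on `n` while `k` climbs to `y`.
  eval : ∀ k σ → σ b ≡ k → σ (1 + b) ≡ 0 → Zero≥ (2 + b) σ → (∀ j → j < b → σ j ≡ ρ j) → ∀ n → n + k ≡ y →
         ∃ λ τ → ∃ λ υ → Run Body σ τ × Run (loop (1 + b) (clear (1 + b) ⨟ inc b ⨟ Body)) τ υ ×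
                 υ b ≡ y × υ (1 + b) ≡ 0 × Zero≥ (2 + b) υ × (∀ j → j < b → υ j ≡ ρ j)
  eval k σ at t0 z same zero refl with eval' k vanishes σ at t0 z same
  ... | τ , run , set , fr = τ , τ , run , stop set , trans (fr b (<⇒≢ (n<1+n b))) at , set
      , (λ j p → trans (fr j (>⇒≢ p)) (z j p)) , (λ j p → trans (fr j (<⇒≢ (m<n⇒m<1+n p))) (same j p))
  eval k σ at t0 z same (suc n) refl with positive k (m<n+m k z<s)
  ... | v , compiled with eval' k compiled σ at t0 z same
  ... | τ , run , set , fr with clear-correct (1 + b) (τ [ 1 + b ≔ v ])
  ... | τ₁ , run₁ , set₁ , fr₁ with eval (suc k) (τ₁ [ b ≔ suc (τ₁ b) ])
            (trans (≔-same τ₁ b _) (cong suc (trans (keep b (<⇒≢ (n<1+n b))) at)))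
            (trans (≔-other τ₁ (>⇒≢ (n<1+n b))) set₁)
            (λ j p → trans (≔-other τ₁ (>⇒≢ (<-trans (n<1+n b) p))) (trans (keep j (>⇒≢ p)) (z j p)))
            (λ j p → trans (≔-other τ₁ (<⇒≢ p)) (trans (keep j (<⇒≢ (m<n⇒m<1+n p))) (same j p)))
            n (+-suc n k)
    where
    keep : ∀ j → j ≢ 1 + b → τ₁ j ≡ σ j
    keep j p = trans (fr₁ j p) (trans (≔-other τ p) (fr j p))
  ... | τ₂ , υ , run₂ , run₃ , done = τ , υ , run , again set (run₁ ⨟ inc ⨟ run₂) run₃ , done
... | continue with continue y (+-identityʳ y)
... | σ₁ , σ₂ , run₁ , run₂ , at , t0 , z , same with move-correct {b} {o} σ₂ (>⇒≢ o<b)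
... | σ₃ , run₃ , zero₃ , set₃ , frame₃ = σ₃ , run₁ ⨟ run₂ ⨟ run₃
    , trans set₃ (trans (cong₂ _+_ at (trans (same o o<b) o0)) (+-identityʳ y))
    , other
  where
  other : ∀ j → j ≢ o → σ₃ j ≡ ρ j
  other j j≢o with <-≤-connex j b
  ... | inj₁ j<b = trans (frame₃ j (<⇒≢ j<b) j≢o) (same j j<b)
  ... | inj₂ b≤j with m≤n⇒m<n∨m≡n b≤j
  ... | inj₂ refl = trans zero₃ (sym (scratch0 b ≤-refl))
  ... | inj₁ b<j = trans (frame₃ j (>⇒≢ b<j) j≢o) (trans (rest (m≤n⇒m<n∨m≡n b<j)) (sym (scratch0 j b≤j)))
    where
    rest : 1 + b < j ⊎ 1 + b ≡ j → σ₂ j ≡ 0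
    rest (inj₁ p)    = z j p
    rest (inj₂ refl) = t0

compile-correct zero xs o b ρ holds below o<b avoids o0 scratch0 = ρ , skip , o0 , λ _ _ → refl
compile-correct succ (x ∷ []) o b ρ holds below o<b avoids o0 scratch0
  with copy-correct {x} {o} {b} ρ (avoids zero) (<⇒≢ (below zero)) (<⇒≢ o<b) o0 (scratch0 b ≤-refl)
... | σ , run , set , frame' = σ [ o ≔ suc (σ o) ] , run ⨟ inc
    , trans (≔-same σ o _) (cong suc (trans set (holds zero))) , λ j j≢o → trans (≔-other σ j≢o) (frame' j j≢o)
compile-correct (proj i) xs o b ρ holds below o<b avoids o0 scratch0 =
  subst (Sets _ ρ o) (holds i)
    (copy-correct ρ (avoids i) (<⇒≢ (below i)) (<⇒≢ o<b) o0 (scratch0 b ≤-refl))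
compile-correct (comp {m} ds d) xs o b ρ holds below o<b avoids o0 scratch0
  with compiles-correct ds xs b (b + m) ρ holds below ≤-refl scratch0
... | σ₁ , run₁ , holds₁ , frame₁ , zero₁ with compile-correct d (range b m) o (b + m) σ₁ holds₁ (range-< b m)
        (<-≤-trans o<b (m≤m+n b m)) (λ i → >⇒≢ (<-≤-trans o<b (range-≥ b m i))) (trans (frame₁ o o<b) o0) zero₁
... | σ₂ , run₂ , set₂ , frame₂ with clears-correct b m σ₂
... | σ₃ , run₃ , lo , mid , hi = σ₃ , run₁ ⨟ run₂ ⨟ run₃ , trans (lo o o<b) set₂ , other
  where
  other : ∀ j → j ≢ o → σ₃ j ≡ ρ j
  other j j≢o with <-≤-connex j b
  ... | inj₁ j<b = trans (lo j j<b) (trans (frame₂ j j≢o) (frame₁ j j<b))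
  ... | inj₂ b≤j with <-≤-connex j (b + m)
  ... | inj₁ j<b+m = trans (mid j b≤j j<b+m) (sym (scratch0 j b≤j))
  ... | inj₂ b+m≤j = trans (hi j b+m≤j) (trans (frame₂ j j≢o) (trans (zero₁ j b+m≤j) (sym (scratch0 j b≤j))))
compile-correct d@(prec0 _)   = prec-correct d
compile-correct d@(precS _ _) = prec-correct d
compile-correct (mu ds d)     = mu-correct (λ k p → proj₁ (ds k p) , compile-correct (proj₂ (ds k p))) (compile-correct d)

compiles-correct [] xs o b ρ holds below o+m≤b scratch0 =
  ρ , skip , (λ ()) , (λ _ _ → refl) , λ j p → scratch0 j (≤-trans (m≤m+n o 0) p)
compiles-correct {suc m} (d ∷ ds) xs o b ρ holds below o+m≤b scratch0
  with compile-correct d xs o b ρ holds (λ i → <-trans (below i) o<b) o<b (λ i → <⇒≢ (below i)) (scratch0 o ≤-refl)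
         (λ j p → scratch0 j (≤-trans (<⇒≤ o<b) p))
  where
  o<b : o < b
  o<b = <-≤-trans (m<m+n o z<s) o+m≤b
... | σ₁ , run₁ , set₁ , frame₁ with compiles-correct ds xs (suc o) b σ₁ (λ i → trans (frame₁ _ (<⇒≢ (below i))) (holds i))
        (λ i → m<n⇒m<1+n (below i)) (subst (_≤ b) (+-suc o m) o+m≤b) (λ j p → trans (frame₁ j (>⇒≢ p)) (scratch0 j (<⇒≤ p)))
... | σ₂ , run₂ , holds₂ , frame₂ , zero₂ = σ₂ , run₁ ⨟ run₂
    , (λ { zero → trans (frame₂ o (n<1+n o)) set₁ ; (suc i) → holds₂ i })
    , (λ j p → trans (frame₂ j (m<n⇒m<1+n p)) (frame₁ j (<⇒≢ p)))
    , λ j p → zero₂ j (subst (_≤ j) (+-suc o m) p)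

maxRegister : Prog → ℕ
maxRegister skip       = 0
maxRegister (inc i)    = i
maxRegister (P ⨟ Q)    = maxRegister P ⊔ maxRegister Q
maxRegister (loop i P) = i ⊔ maxRegister P

-- Queue machines that simulate counter programs.

data Node (γ : ℕ) (C : Set) : Set where
  snd : Fin γ → C → Node γ C
  rcv : (Fin γ → C) → Node γ C

mapNode : ∀ {γ} {C D : Set} → (C → D) → Node γ C → Node γ D
mapNode f (snd b q) = snd b (f q)
mapNode f (rcv t)   = rcv (f ∘ t)

-- The queue machine obtained by connecting the output of a node graph to its input.
data QStep {γ : ℕ} {C : Set} (node : C → Node γ C) : C × List (Fin γ) → C × List (Fin γ) → Set where
  snd : ∀ {c b q u} → node c ≡ snd b q → QStep node (c , u) (q , u ∷ʳ b)
  rcv : ∀ {c t b u} → node c ≡ rcv t → QStep node (c , b ∷ u) (t b , u)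

QStep-deterministic : ∀ {γ C} {node : C → Node γ C} {x y z} → QStep node x y → QStep node x z → y ≡ z
QStep-deterministic (snd p) (snd q) with refl ← trans (sym p) q = refl
QStep-deterministic (snd p) (rcv q) with () ← trans (sym p) q
QStep-deterministic (rcv p) (snd q) with () ← trans (sym p) q
QStep-deterministic (rcv p) (rcv q) with refl ← trans (sym p) q = refl

clamp : ∀ K → ℕ → Fin (suc K)
clamp zero    i       = zero
clamp (suc K) zero    = zero
clamp (suc K) (suc i) = suc (clamp K i)

toℕ-clamp : ∀ {K i} → i ≤ K → toℕ (clamp K i) ≡ i
toℕ-clamp {zero}  z≤n     = refl
toℕ-clamp {suc K} z≤n     = refl
toℕ-clamp {suc K} (s≤s p) = cong suc (toℕ-clamp p)

-- The control points of a program. A loop has two of its own: the search for a letter of its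
-- register, and the rest of the turn that brings the end marker back to the end of the queue before
-- the body starts.
Lab : Prog → Set
Lab skip       = ⊤
Lab (inc i)    = ⊤
Lab (P ⨟ Q)    = Lab P ⊎ Lab Q
Lab (loop i P) = ⊤ ⊎ (⊤ ⊎ Lab P)

start : ∀ P → Lab P
start skip       = tt
start (inc i)    = tt
start (P ⨟ Q)    = inj₁ (start P)
start (loop i P) = inj₁ tt

-- Generic in the type of states, because the same chain occurs in the queue machine and in each
-- completed machine.
predLink : ∀ {X : Set} {w} → X → (Fin w → X) → Fin w → X
predLink bottom link zero    = bottom
predLink bottom link (suc k) = link (Fin.inject₁ k)

topLink : ∀ {X : Set} w → X → (Fin w → X) → X
topLink zero    bottom link = bottom
topLink (suc w) bottom link = link (Fin.fromℕ w)

predLink-natural : ∀ {X Y : Set} (f : X → Y) {w bottom} {link : Fin w → X} k →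
                   f (predLink bottom link k) ≡ predLink (f bottom) (f ∘ link) k
predLink-natural f zero    = refl
predLink-natural f (suc k) = refl

topLink-natural : ∀ {X Y : Set} (f : X → Y) w {bottom} {link : Fin w → X} →
                  f (topLink w bottom link) ≡ topLink w (f bottom) (f ∘ link)
topLink-natural f zero    = refl
topLink-natural f (suc w) = refl

module QueueMachine (K : ℕ) where

  γ : ℕ
  γ = 4 + K

  Γ : Set
  Γ = Fin γ

  pattern hash  = suc zero
  pattern blank = suc (suc zero)

  -- Letter 0 belongs to the register that the initial chain fills, letters 1 and 2 are the markers,
  -- and the other registers follow. Clamping makes the function total while keeping it injective up
  -- to `suc K`.
  reg : ℕ → Γ
  reg zero    = zero
  reg (suc i) = suc (suc (suc (clamp K i)))

  reg-injective : ∀ {i j} → i ≤ suc K → j ≤ suc K → reg i ≡ reg j → i ≡ j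
  reg-injective {zero}  {zero}  _       _       _  = refl
  reg-injective {zero}  {suc j} _       _       ()
  reg-injective {suc i} {zero}  _       _       ()
  reg-injective {suc i} {suc j} (s≤s p) (s≤s q) eq =
    cong suc (trans (sym (toℕ-clamp p)) (trans (cong (λ r → toℕ r ∸ 3) eq) (toℕ-clamp q)))

  reg≢hash : ∀ i → reg i ≢ hash
  reg≢hash zero    ()
  reg≢hash (suc i) ()

  reg≢blank : ∀ i → reg i ≢ blank
  reg≢blank zero    ()
  reg≢blank (suc i) ()

  -- One turn of the queue, ended by `hash`. The letter inserted before `hash` is the parameter `a`,
  -- so an increment is a turn that inserts a register letter there instead of a blank.
  rotate : ∀ {X : Set} → Γ → X → X → Γ → Γ × Γ × X
  rotate a self exit b with b Fin.≟ hash
  ... | yes _ = a , hash , exit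
  ... | no _  = blank , b , self

  search : ∀ {X : Set} → ℕ → X → X → X → Γ → Γ × Γ × X
  search i self found exit b with b Fin.≟ hash | b Fin.≟ reg i
  ... | yes _ | _     = blank , hash , exit
  ... | no _  | yes _ = blank , blank , found
  ... | no _  | no _  = blank , b , self

  rotate-other : ∀ {X : Set} a (self exit : X) {b} → b ≢ hash → rotate a self exit b ≡ (blank , b , self)
  rotate-other a self exit {b} b≢ with b Fin.≟ hash
  ... | yes p = contradiction p b≢
  ... | no _  = refl

  search-found : ∀ {X : Set} i (self found exit : X) → search i self found exit (reg i) ≡ (blank , blank , found)
  search-found i self found exit with reg i Fin.≟ hash | reg i Fin.≟ reg i
  ... | yes p | _     = contradiction p (reg≢hash i)
  ... | no _  | yes _ = refl
  ... | no _  | no ¬p = contradiction refl ¬p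

  search-other : ∀ {X : Set} i (self found exit : X) {b} → b ≢ hash → b ≢ reg i →
                 search i self found exit b ≡ (blank , b , self)
  search-other i self found exit {b} p q with b Fin.≟ hash | b Fin.≟ reg i
  ... | yes p' | _      = contradiction p' p
  ... | no _   | yes q' = contradiction q' q
  ... | no _   | no _   = refl

  -- Reading one letter always writes two: the queue word of a counter configuration is any word
  -- that contains each register letter as often as its register says.
  rule : ∀ P {X : Set} → (Lab P → X) → X → Lab P → Γ → Γ × Γ × X
  rule skip       ι exit ℓ               = rotate blank (ι ℓ) exit
  rule (inc i)    ι exit ℓ               = rotate (reg i) (ι ℓ) exit
  rule (P ⨟ Q)    ι exit (inj₁ ℓ)        = rule P (ι ∘ inj₁) (ι (inj₂ (start Q))) ℓ
  rule (P ⨟ Q)    ι exit (inj₂ ℓ)        = rule Q (ι ∘ inj₂) exit ℓ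
  rule (loop i P) ι exit (inj₁ tt)       = search i (ι (inj₁ tt)) (ι (inj₂ (inj₁ tt))) exit
  rule (loop i P) ι exit (inj₂ (inj₁ tt)) = rotate blank (ι (inj₂ (inj₁ tt))) (ι (inj₂ (inj₂ (start P))))
  rule (loop i P) ι exit (inj₂ (inj₂ ℓ)) = rule P (ι ∘ inj₂ ∘ inj₂) (ι (inj₁ tt)) ℓ

  count : Γ → List Γ → ℕ
  count c []      = 0
  count c (b ∷ u) with b Fin.≟ c
  ... | yes _ = suc (count c u)
  ... | no _  = count c u

  count-++ : ∀ c u v → count c (u ++ v) ≡ count c u + count c v
  count-++ c []      v = refl
  count-++ c (b ∷ u) v with b Fin.≟ c
  ... | yes _ = cong suc (count-++ c u v)
  ... | no _  = count-++ c u v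

  count-same : ∀ c u → count c (c ∷ u) ≡ suc (count c u)
  count-same c u with c Fin.≟ c
  ... | yes _ = refl
  ... | no ¬p = contradiction refl ¬p

  count-other : ∀ {b c} u → b ≢ c → count c (b ∷ u) ≡ count c u
  count-other {b} {c} u b≢c with b Fin.≟ c
  ... | yes p = contradiction p b≢c
  ... | no _  = refl

  spread : List Γ → List Γ
  spread []      = []
  spread (b ∷ u) = blank ∷ b ∷ spread u

  count-spread : ∀ {c} u → c ≢ blank → count c (spread u) ≡ count c u
  count-spread {c} []      c≢ = refl
  count-spread {c} (b ∷ u) c≢ = trans (count-other (b ∷ spread u) (≢-sym c≢)) (step (b Fin.≟ c))
    where
    step : Dec (b ≡ c) → count c (b ∷ spread u) ≡ count c (b ∷ u)
    step (yes refl) = trans (count-same c _) (trans (cong suc (count-spread u c≢)) (sym (count-same c u)))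
    step (no b≢c)   = trans (count-other _ b≢c) (trans (count-spread u c≢) (sym (count-other u b≢c)))

  NoHash : List Γ → Set
  NoHash = All (_≢ hash)

  spread-noHash : ∀ {u} → NoHash u → NoHash (spread u)
  spread-noHash []       = []
  spread-noHash (p ∷ ps) = (λ ()) ∷ p ∷ spread-noHash ps

  absent : ∀ {c} u → count c u ≡ 0 → All (_≢ c) u
  absent []          eq = []
  absent {c} (b ∷ u) eq with b Fin.≟ c
  absent {c} (b ∷ u) () | yes _
  absent {c} (b ∷ u) eq | no b≢c = b≢c ∷ absent u eq

  firstOccurrence : ∀ {c n} u → count c u ≡ suc n → ∃₂ λ v w → u ≡ v ++ c ∷ w × All (_≢ c) v
  firstOccurrence {c} (b ∷ u) eq with b Fin.≟ c
  ... | yes refl = [] , u , refl , []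
  ... | no b≢c with firstOccurrence u eq
  ... | v , w , refl , abs = b ∷ v , w , refl , b≢c ∷ abs

  record Rep (u : List Γ) (ρ : Memory) : Set where
    constructor rep
    field
      noHash : NoHash u
      counts : ∀ i → i ≤ suc K → count (reg i) u ≡ ρ i

module Machine (K : ℕ) (P : Prog) (o : ℕ) (drain : Bool) where

  open QueueMachine K

  Label : Set
  Label = Lab P ⊎ Bool

  pattern test  = inj₂ false
  pattern final = inj₂ true

  -- `drained` is inhabited only if the queue is to be emptied. Without it every state that reads is
  -- followed by one that writes, whatever the program does.
  data Core : Set where
    home bottom quiet : Core
    await              : Label → Core
    out₁ out₂         : Label → Γ → Core
    echo              : Γ → Core
    drained           : T drain → Core

  after : ∀ d → (T d → Core) → Core → Core
  after true  f c = f tt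
  after false f c = c

  -- In `test` one search for the letter of register `o` separates the results 0 and 1. In `final`
  -- nothing is computed any more: two letters are still written for each letter read, so the queue
  -- grows unless it is drained.
  action : Label → Γ → Γ × Γ × Core
  action (inj₁ ℓ) = rule P (await ∘ inj₁) (await test) ℓ
  action test     = search o (await test) (await final) quiet
  action final b  = blank , b , after drain drained (await final)

  coreNode : Core → Node γ Core
  coreNode home        = snd zero bottom
  coreNode bottom      = snd hash (await (inj₁ (start P)))
  coreNode quiet       = rcv echo
  coreNode (await ℓ)    = rcv (out₁ ℓ)
  coreNode (out₁ ℓ b)  = snd (proj₁ (action ℓ b)) (out₂ ℓ b)
  coreNode (out₂ ℓ b)  = snd (proj₁ (proj₂ (action ℓ b))) (proj₂ (proj₂ (action ℓ b)))
  coreNode (echo b)    = snd b quiet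
  coreNode (drained t) = rcv (λ _ → drained t)

module Chain (K : ℕ) (P : Prog) (o : ℕ) (drain : Bool) (w : ℕ) where

  open QueueMachine K
  open Machine K P o drain

  C : Set
  C = Core ⊎ Fin w

  pattern base c = inj₁ c
  pattern link k = inj₂ k

  node : C → Node γ C
  node (base home)   = snd zero (topLink w (base bottom) inj₂)
  node (base c)      = mapNode base (coreNode c)
  node (link k)      = snd zero (predLink (base bottom) inj₂ k)

  infix 4 _⇛_ _⇛*_
  _⇛_ _⇛*_ : C × List Γ → C × List Γ → Set
  _⇛_  = QStep node
  _⇛*_ = Star _⇛_

  node-base : ∀ {c} → c ≢ home → node (base c) ≡ mapNode base (coreNode c)
  node-base {home}      p = contradiction refl p
  node-base {bottom}    p = refl
  node-base {quiet}     p = refl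
  node-base {await x}    p = refl
  node-base {out₁ x x₁} p = refl
  node-base {out₂ x x₁} p = refl
  node-base {echo x}    p = refl
  node-base {drained x} p = refl

  castˡ : ∀ {c u v y} → u ≡ v → (c , u) ⇛* y → (c , v) ⇛* y
  castˡ refl steps = steps

  castʳ : ∀ {x c u v} → u ≡ v → x ⇛* (c , u) → x ⇛* (c , v)
  castʳ refl steps = steps

  react : ∀ {ℓ b a c t} u → action ℓ b ≡ (a , c , t) → (base (await ℓ) , b ∷ u) ⇛* (base t , u ++ a ∷ c ∷ [])
  react {ℓ} {b} {a} {c} {t} u eq = castʳ (++-assoc u (a ∷ []) (c ∷ []))
      (rcv {t = λ b → base (out₁ ℓ b)} refl ◅ snd {b = a} {q = base (out₂ ℓ b)} (cong (λ x → snd (proj₁ x) _) eq)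
       ◅ snd {b = c} {q = base t} (cong (λ x → snd (proj₁ (proj₂ x)) (base (proj₂ (proj₂ x)))) eq) ◅ ε)

  pass : ∀ {ℓ u} v → All (λ b → action ℓ b ≡ (blank , b , await ℓ)) u →
         (base (await ℓ) , u ++ v) ⇛* (base (await ℓ) , v ++ spread u)
  pass {ℓ} v []                = castʳ (sym (++-identityʳ v)) ε
  pass {ℓ} {b ∷ u} v (eq ∷ eqs) = react (u ++ v) eq ◅◅
    castˡ (sym (++-assoc u v _)) (castʳ (++-assoc v (blank ∷ b ∷ []) (spread u)) (pass (v ++ blank ∷ b ∷ []) eqs))

  turn : ∀ {ℓ a t u} v → All (λ b → action ℓ b ≡ (blank , b , await ℓ)) u → action ℓ hash ≡ (a , hash , t) →
         (base (await ℓ) , u ++ hash ∷ v) ⇛* (base t , (v ++ spread u ++ a ∷ []) ∷ʳ hash)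
  turn {ℓ} {a} {t} {u} v eqs eq = pass (hash ∷ v) eqs ◅◅
    castʳ same (react (v ++ spread u) eq)
    where
    same : (v ++ spread u) ++ a ∷ hash ∷ [] ≡ (v ++ spread u ++ a ∷ []) ∷ʳ hash
    same = trans (sym (++-assoc (v ++ spread u) (a ∷ []) (hash ∷ []))) (cong (_∷ʳ hash) (++-assoc v (spread u) (a ∷ [])))

  rotation : ∀ {ℓ a t u} → (∀ b → action ℓ b ≡ rotate a (await ℓ) t b) → NoHash u →
             (base (await ℓ) , u ∷ʳ hash) ⇛* (base t , (spread u ++ a ∷ []) ∷ʳ hash)
  rotation {ℓ} {a} {t} rules nh =
    turn [] (All.map (λ {b} b≢ → trans (rules b) (rotate-other a _ t b≢)) nh) (rules hash)

  rep-spread : ∀ {a u ρ σ} → a ≢ hash → (∀ i → i ≤ suc K → count (reg i) (a ∷ []) + ρ i ≡ σ i) → Rep u ρ → Rep (spread u ++ a ∷ []) σ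
  rep-spread {a} {u} {ρ} a≢ eq (rep nh cs) = rep (++⁺ (spread-noHash nh) (a≢ ∷ []))
    λ i p → trans (count-++ (reg i) (spread u) (a ∷ []))
      (trans (+-comm (count (reg i) (spread u)) _) (trans (cong (count (reg i) (a ∷ []) +_) (trans (count-spread u (reg≢blank i)) (cs i p))) (eq i p)))

  -- Generalised over the place `κ` of the subprogram within the whole program and over its exit, so
  -- that induction on the run applies; `rules` says that the control acts at these labels as `rule`
  -- prescribes for the subprogram.
  simulate : ∀ {Q ρ σ} → Run Q ρ σ → maxRegister Q ≤ suc K → (κ : Lab Q → Label) (exit : Core) →
             (∀ ℓ b → action (κ ℓ) b ≡ rule Q (await ∘ κ) exit ℓ b) → ∀ {u} → Rep u ρ →
             ∃ λ v → (base (await (κ (start Q))) , u ∷ʳ hash) ⇛* (base exit , v ∷ʳ hash) × Rep v σ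
  simulate skip bound κ exit rules r =
    _ , rotation (rules tt) (Rep.noHash r) , rep-spread (λ ()) (λ i p → cong (_+ _) (count-other [] (≢-sym (reg≢blank i)))) r
  simulate (inc {i} {ρ}) bound κ exit rules r =
    _ , rotation (rules tt) (Rep.noHash r) , rep-spread (reg≢hash i) adjust r
    where
    adjust : ∀ j → j ≤ suc K → count (reg j) (reg i ∷ []) + ρ j ≡ (ρ [ i ≔ suc (ρ i) ]) j
    adjust j p with j ≟ i
    ... | yes refl = cong (_+ ρ j) (count-same (reg j) [])
    ... | no j≢i   = cong (_+ ρ j) (count-other [] (λ eq → j≢i (sym (reg-injective bound p eq))))
  simulate (run₁ ⨟ run₂) bound κ exit rules r
    with simulate run₁ (m⊔n≤o⇒m≤o _ _ bound) (κ ∘ inj₁) _ (λ ℓ → rules (inj₁ ℓ)) r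
  ... | v , steps , r' with simulate run₂ (m⊔n≤o⇒n≤o _ _ bound) (κ ∘ inj₂) exit (λ ℓ → rules (inj₂ ℓ)) r'
  ... | v' , steps' , r″ = v' , steps ◅◅ steps' , r″
  simulate (stop {i} zeroᵢ) bound κ exit rules {u} r =
    _ , turn [] (All.zipWith (λ {b} (p , q) → trans (rules (inj₁ tt) b) (search-other i _ _ exit p q))
          (Rep.noHash r , absent u (trans (Rep.counts r i (m⊔n≤o⇒m≤o i _ bound)) zeroᵢ))) (rules (inj₁ tt) hash)
      , rep-spread (λ ()) (λ j p → cong (_+ _) (count-other [] (≢-sym (reg≢blank j)))) r
  simulate (again {i} {Q} {n} {ρ} posᵢ run₁ run₂) bound κ exit rules {u} r
    with firstOccurrence u (trans (Rep.counts r i (m⊔n≤o⇒m≤o i _ bound)) posᵢ)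
  ... | v , w , refl , abs
    with ++⁻ v (Rep.noHash r)
  ... | nhv , _ ∷ nhw
    with simulate run₁ (m⊔n≤o⇒n≤o i _ bound) (κ ∘ inj₂ ∘ inj₂) _ (λ ℓ → rules (inj₂ (inj₂ ℓ))) r₁
    where
    u₁ : List Γ
    -- The queue after a full turn: every letter is spread, the found one has become two blanks, and
    -- one more blank stands before the end marker.
    u₁ = (spread v ++ blank ∷ blank ∷ []) ++ spread w ++ blank ∷ []
    counts₁ : ∀ j → j ≤ suc K → count (reg j) u₁ ≡ (ρ [ i ≔ n ]) j
    counts₁ j p = trans (count-++ c (spread v ++ blank ∷ blank ∷ []) _)
        (trans (cong₂ _+_
            (trans (count-++ c (spread v) _) (trans (cong₂ _+_ (count-spread v (reg≢blank j))
              (trans (count-other (blank ∷ []) (≢-sym (reg≢blank j))) (count-other [] (≢-sym (reg≢blank j))))) (+-identityʳ _)))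
            (trans (count-++ c (spread w) _) (trans (cong₂ _+_ (count-spread w (reg≢blank j)) (count-other [] (≢-sym (reg≢blank j)))) (+-identityʳ _))))
          (finish (j ≟ i)))
      where
      c : Γ
      c = reg j
      whole : count c v + count c (reg i ∷ w) ≡ ρ j
      whole = trans (sym (count-++ c v (reg i ∷ w))) (Rep.counts r j p)
      finish : Dec (j ≡ i) → count c v + count c w ≡ (ρ [ i ≔ n ]) j
      finish (yes refl) = trans (suc-injective (trans (sym (+-suc _ _)) (trans (cong (count c v +_) (sym (count-same c w))) (trans whole posᵢ))))
                                (sym (≔-same ρ j n))
      finish (no j≢i)   = trans (trans (cong (count c v +_) (sym (count-other w λ eq → j≢i (sym (reg-injective (m⊔n≤o⇒m≤o i _ bound) p eq))))) whole)
                                (sym (≔-other ρ j≢i))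
    r₁ : Rep u₁ (ρ [ i ≔ n ])
    r₁ = rep (++⁺ (++⁺ (spread-noHash nhv) ((λ ()) ∷ (λ ()) ∷ [])) (++⁺ (spread-noHash nhw) ((λ ()) ∷ []))) counts₁
  ... | x , steps , r₂
    with simulate run₂ bound κ exit rules r₂
  ... | y , steps' , r₃ = y , seek ◅◅ found ◅◅ finish ◅◅ steps ◅◅ steps' , r₃
    where
    head body : Core
    head = await (κ (inj₁ tt))
    body = await (κ (inj₂ (inj₁ tt)))
    blanks : List Γ
    blanks = blank ∷ blank ∷ []
    seek : (base head , (v ++ reg i ∷ w) ∷ʳ hash) ⇛* (base head , reg i ∷ (w ∷ʳ hash) ++ spread v)
    seek = castˡ (sym (++-assoc v (reg i ∷ w) (hash ∷ [])))
      (pass (reg i ∷ w ∷ʳ hash) (All.zipWith (λ {b} (p , q) → trans (rules (inj₁ tt) b) (search-other i _ _ exit p q)) (nhv , abs)))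
    found : (base head , reg i ∷ (w ∷ʳ hash) ++ spread v) ⇛* (base body , w ++ hash ∷ spread v ++ blanks)
    found = castʳ
      (trans (++-assoc (w ∷ʳ hash) (spread v) blanks) (++-assoc w (hash ∷ []) (spread v ++ blanks)))
      (react ((w ∷ʳ hash) ++ spread v) (trans (rules (inj₁ tt) (reg i)) (search-found i _ _ exit)))
    finish : (base body , w ++ hash ∷ spread v ++ blanks) ⇛*
             (base (await (κ (inj₂ (inj₂ (start Q))))) , ((spread v ++ blanks) ++ spread w ++ blank ∷ []) ∷ʳ hash)
    finish = turn (spread v ++ blanks)
      (All.map (λ {b} p → trans (rules (inj₂ (inj₁ tt)) b) (rotate-other blank _ _ p)) nhw) (rules (inj₂ (inj₁ tt)) hash)

  zeros : ℕ → List Γ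
  zeros n = List.replicate n zero

  descend : ∀ n k → toℕ k ≡ n → ∀ u → (link k , u) ⇛* (base bottom , u ++ zeros (suc n))
  descend n       zero    refl u = snd refl ◅ ε
  descend (suc n) (suc k) eq   u = snd refl ◅
    castʳ (++-assoc u (zero ∷ []) (zeros (suc n)))
      (descend n (Fin.inject₁ k) (trans (Fin.toℕ-inject₁ k) (suc-injective eq)) (u ∷ʳ zero))

  load : (base home , []) ⇛* (base (await (inj₁ (start P))) , zeros (suc w) ∷ʳ hash)
  load = snd refl ◅ fall w refl ◅◅ snd refl ◅ ε
    where
    fall : ∀ w' → w' ≡ w → (topLink w (base bottom) inj₂ , zero ∷ []) ⇛* (base bottom , zeros (suc w))
    fall zero     refl = ε
    fall (suc w') refl = descend w' (Fin.fromℕ w') (Fin.toℕ-fromℕ w') (zero ∷ [])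

  input : Memory
  input = (λ _ → 0) [ 0 ≔ suc w ]

  rep-zeros : ∀ n → Rep (zeros n) ((λ _ → 0) [ 0 ≔ n ])
  rep-zeros n = rep (nh n) (cs n)
    where
    nh : ∀ n → NoHash (zeros n)
    nh zero    = []
    nh (suc n) = (λ ()) ∷ nh n
    cs : ∀ n i → i ≤ suc K → count (reg i) (zeros n) ≡ ((λ _ → 0) [ 0 ≔ n ]) i
    cs zero    zero    p = refl
    cs zero    (suc i) p = refl
    cs (suc n) zero    p = cong suc (cs n zero p)
    cs (suc n) (suc i) p = cs n (suc i) p

  -- The last letters are recorded to show that the queue is not empty, which copying, draining and
  -- growing all need in order to begin.
  Settles Finishes : Set
  Settles  = ∃ λ v → (base home , []) ⇛* (base quiet , v ∷ʳ hash)
  Finishes = ∃ λ v → (base home , []) ⇛* (base (await final) , v ∷ʳ blank)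

  module _ (bound : maxRegister P ≤ suc K) (o≤ : o ≤ suc K) {σ} (run : Run P input σ) where

    reach-test : ∃ λ v → (base home , []) ⇛* (base (await test) , v ∷ʳ hash) × Rep v σ
    reach-test with simulate run bound inj₁ (await test) (λ _ _ → refl) (rep-zeros (suc w))
    ... | v , steps , r = v , load ◅◅ steps , r

    settles : σ o ≡ 0 → Settles
    settles eq with reach-test
    ... | v , steps , r = _ , steps ◅◅ turn [] (All.zipWith (λ {b} (p , q) → search-other o _ _ quiet p q)
      (Rep.noHash r , absent v (trans (Rep.counts r o o≤) eq))) refl

    finishes : σ o ≡ 1 → Finishes
    finishes eq with reach-test
    ... | v , steps , r with firstOccurrence v (trans (Rep.counts r o o≤) eq)
    ... | x , y , refl , abs = _ , steps ◅◅
      castˡ (sym (++-assoc x (reg o ∷ y) (hash ∷ [])))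
        (pass (reg o ∷ y ∷ʳ hash) (All.zipWith (λ {b} (p , q) → search-other o _ _ quiet p q) (proj₁ (++⁻ x (Rep.noHash r)) , abs)))
      ◅◅ castʳ (sym (++-assoc ((y ∷ʳ hash) ++ spread x) (blank ∷ []) (blank ∷ [])))
        (react ((y ∷ʳ hash) ++ spread x) (search-found o _ _ quiet))

  after-drain : ∀ {d f c} (t : T d) → after d f c ≡ f t
  after-drain {true} tt = refl

  after-grow : ∀ {d f c} → ¬ T d → after d f c ≡ c
  after-grow {true}  ¬t = contradiction tt ¬t
  after-grow {false} ¬t = refl

  drains : (t : T drain) → ∀ u b → (base (await final) , u ∷ʳ b) ⇛* (base (drained t) , [])
  drains t []      b = react [] (cong (λ c → blank , b , c) (after-drain t)) ◅◅ rcv refl ◅ rcv refl ◅ ε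
  drains t (a ∷ u) b = react (u ∷ʳ b) (cong (λ c → blank , a , c) (after-drain t)) ◅◅ empty _
    where
    empty : ∀ v → (base (drained t) , v) ⇛* (base (drained t) , [])
    empty []      = ε
    empty (_ ∷ v) = rcv refl ◅ empty v

  grows : ¬ T drain → ∀ n b u → ∃ λ v → (base (await final) , b ∷ u) ⇛* (base (await final) , v) × n ≤ length v
  grows ¬t zero    b u = b ∷ u , ε , z≤n
  grows ¬t (suc n) b u = go (suc n) b u (m≤m+n (suc n) (length u))
    where
    -- `k` is the number of rounds left; a round replaces one letter by two and so lengthens the
    -- queue by one.
    go : ∀ k b u → suc n ≤ k + length u → ∃ λ v → (base (await final) , b ∷ u) ⇛* (base (await final) , v) × suc n ≤ length v
    go zero    b u       le = b ∷ u , ε , m≤n⇒m≤1+n le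
    go (suc k) b []      le = continue (go k blank (b ∷ []) (≤-trans le (≤-reflexive (trans (cong suc (+-identityʳ k)) (+-comm 1 k)))))
      where
      continue : _ → _
      continue (v , steps , le') = v , react [] (cong (λ c → blank , b , c) (after-grow ¬t)) ◅◅ steps , le'
    go (suc k) b (a ∷ u) le = continue (go k a (u ++ blank ∷ b ∷ []) (≤-trans le (≤-reflexive lengths)))
      where
      lengths : suc k + length (a ∷ u) ≡ k + length (u ++ blank ∷ b ∷ [])
      lengths = trans (sym (+-suc k _)) (cong (k +_) (trans (+-comm 2 (length u)) (sym (length-++ u))))
      continue : _ → _
      continue (v , steps , le') = v , react (a ∷ u) (cong (λ c → blank , b , c) (after-grow ¬t)) ◅◅ steps , le'

-- Completing a control graph to a strongly connected machine, and the words of its loops.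

-- bang and dollar mark the end of a phase.
data Letter (γ : ℕ) : Set where
  char        : Fin γ → Letter γ
  bang dollar : Letter γ

Word : ℕ → Set
Word γ = List (Letter γ)

-- One partial successor function per state, read as sending or as receiving: determinism and the
-- division into send and receive states hold by construction.
record Mach (γ : ℕ) : Set₁ where
  field
    State   : Set
    initial : State
    sends   : State → Bool
    next    : State → Letter γ → Maybe State

  infix 4 _⇢_
  _⇢_ : State → State → Set
  p ⇢ q = ∃ λ l → next p l ≡ just q

  -- Path p s r q: a path from p to q that sends s and receives r.
  data Path : State → Word γ → Word γ → State → Set where
    []  : ∀ {p} → Path p [] [] p
    snd : ∀ {p q t l s r} → sends p ≡ true → next p l ≡ just q → Path q s r t → Path p (l ∷ s) r t
    rcv : ∀ {p q t l s r} → sends p ≡ false → next p l ≡ just q → Path q s r t → Path p s (l ∷ r) t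

isSnd : ∀ {γ C} → Node γ C → Bool
isSnd (snd _ _) = true
isSnd (rcv _)   = false

module _ {γ : ℕ} where

  data Tail (E : Word γ) : Word γ → Word γ → Set where
    end : ∀ {s} → Tail E (E ++ s) s
    _∷_ : ∀ {s s'} b → Tail E s s' → Tail E (char b ∷ s) s'

  -- The common description of `Z₀` and `Z₁`. Only the number of phases ties the two words together,
  -- so the description is symmetric and independent of the control graph.
  data Phases (E : Word γ) : Word γ → Word γ → Set where
    []    : Phases E [] []
    phase : ∀ {s s' r r'} → Tail E s s' → Tail E r r' → Phases E s' r' → Phases E s r

  Open : Word γ → Word γ → Word γ → Set
  Open E s r = ∃₂ λ s' r' → Tail E s s' × Tail E r r' × Phases E s' r'

  sndOpen : ∀ {E s r} b → Open E s r → Open E (char b ∷ s) r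
  sndOpen b (s' , r' , t₁ , t₂ , ph) = s' , r' , b ∷ t₁ , t₂ , ph

  rcvOpen : ∀ {E s r} b → Open E s r → Open E s (char b ∷ r)
  rcvOpen b (s' , r' , t₁ , t₂ , ph) = s' , r' , t₁ , b ∷ t₂ , ph

  flip-phases : ∀ {E s r} → Phases E s r → Phases E r s
  flip-phases []               = []
  flip-phases (phase t₁ t₂ ph) = phase t₂ t₁ (flip-phases ph)

module _ {γ : ℕ} {C : Set} (node : C → Node γ C) where

  data CoreEdge : C → C → Set where
    snd : ∀ {c b q} → node c ≡ snd b q → CoreEdge c q
    rcv : ∀ {c t} b → node c ≡ rcv t → CoreEdge c (t b)

  -- By the two `fresh` conditions no edge of the graph enters `home`, so a return there always
  -- closes a phase. `rank` excludes send cycles; `wrongAt`, `writing` and `reading` make the added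
  -- states reachable.
  record IsCore (home : C) : Set where
    field
      rank      : C → ℕ
      rank-snd  : ∀ {c b q} → node c ≡ snd b q → rank q < rank c
      reach     : ∀ c → Star CoreEdge home c
      fresh-snd : ∀ {c b q} → node c ≡ snd b q → q ≢ home
      fresh-rcv : ∀ {c t} b → node c ≡ rcv t → t b ≢ home
      wrongAt   : ∀ b → ∃ λ c → ∃₂ λ b' q → node c ≡ snd b' q × b ≢ b'
      writing   : ∃ λ c → ∃₂ λ b q → node c ≡ snd b q
      reading   : ∃₂ λ c t → node c ≡ rcv t

record Extends {γ : ℕ} {C : Set} (node : C → Node γ C) (M : Mach γ) (ι : C → Mach.State M) : Set where
  open Mach M
  field
    out : ∀ {c b q} → node c ≡ snd b q → sends (ι c) ≡ true × next (ι c) (char b) ≡ just (ι q)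
    off : ∀ {c t} → node c ≡ rcv t → sends (ι c) ≡ false
    inp : ∀ {c t} b → node c ≡ rcv t → next (ι c) (char b) ≡ just (ι (t b))

  step : ∀ {c q} → CoreEdge node c q → ι c ⇢ ι q
  step (snd {b = b} eq) = char b , proj₂ (out eq)
  step (rcv b eq)       = char b , inp b eq

module Total {γ : ℕ} {C S : Set} (core : C → S) (err : Fin γ → S) (errBang onBang : S) where

  nodeNext : Node γ C → Letter γ → Maybe S
  nodeNext (snd b q) (char b') with b' Fin.≟ b
  ... | yes _ = just (core q)
  ... | no _  = just (err b')
  nodeNext (snd b q) bang     = just errBang
  nodeNext (rcv t)   (char b) = just (core (t b))
  nodeNext (rcv t)   bang     = just onBang
  nodeNext _         dollar   = nothing

  next-right : ∀ {b q} → nodeNext (snd b q) (char b) ≡ just (core q)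
  next-right {b} with b Fin.≟ b
  ... | yes _ = refl
  ... | no ¬p = contradiction refl ¬p

  next-wrong : ∀ {b b' q} → b' ≢ b → nodeNext (snd b q) (char b') ≡ just (err b')
  next-wrong {b} {b'} b'≢b with b' Fin.≟ b
  ... | yes p = contradiction p b'≢b
  ... | no _  = refl

module _ {γ : ℕ} {C C' S S' : Set} {core : C → S} {err : Fin γ → S} {errBang onBang : S}
  {core' : C' → S'} {err' : Fin γ → S'} {errBang' onBang' : S'} (f : C → C') (lift : S → S')
  (core-lift : ∀ c → core' (f c) ≡ lift (core c)) (err-lift : ∀ b → err' b ≡ lift (err b))
  (errBang-lift : errBang' ≡ lift errBang) (onBang-lift : onBang' ≡ lift onBang) where

  nodeNext-lift : ∀ n l → Total.nodeNext core' err' errBang' onBang' (mapNode f n) l ≡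
                          Maybe.map lift (Total.nodeNext core err errBang onBang n l)
  nodeNext-lift (snd b q) (char b') with b' Fin.≟ b
  ... | yes _ = cong just (core-lift q)
  ... | no _  = cong just (err-lift b')
  nodeNext-lift (snd b q) bang     = cong just errBang-lift
  nodeNext-lift (snd b q) dollar   = refl
  nodeNext-lift (rcv t)   (char b) = cong just (core-lift (t b))
  nodeNext-lift (rcv t)   bang     = cong just onBang-lift
  nodeNext-lift (rcv t)   dollar   = refl

module Completion {γ : ℕ} {C : Set} (node : C → Node γ C) (home : C) where

  -- A send state keeps its single letter, so sends still lower the rank and no send cycle arises.
  -- Strong connectivity comes from the `bang` edges that lead home from the receive states; as no
  -- state sends `bang`, they add nothing to the joint runs.
  module Partial where

    nodeNext : Node γ C → Letter γ → Maybe C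
    nodeNext (snd b q) (char b') with b' Fin.≟ b
    ... | yes _ = just q
    ... | no _  = nothing
    nodeNext (rcv t)   (char b) = just (t b)
    nodeNext (rcv t)   bang     = just home
    nodeNext _         _        = nothing

    machine : Mach γ
    machine = record { State = C ; initial = home ; sends = isSnd ∘ node ; next = nodeNext ∘ node }

    extends : Extends node machine (λ c → c)
    extends = record
      { out = λ {_} {b} eq → cong isSnd eq , trans (cong (λ n → nodeNext n (char b)) eq) (right b)
      ; off = cong isSnd
      ; inp = λ b eq → cong (λ n → nodeNext n (char b)) eq }
      where
      right : ∀ b {q} → nodeNext (snd b q) (char b) ≡ just q
      right b with b Fin.≟ b
      ... | yes _ = refl
      ... | no ¬p = contradiction refl ¬p

    nodeNext-snd : ∀ n {l q} → isSnd n ≡ true → nodeNext n l ≡ just q → ∃ λ b → n ≡ snd b q × l ≡ char b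
    nodeNext-snd (snd b q) {char b'} _ eq with b' Fin.≟ b
    nodeNext-snd (snd b q) {char b'} _ refl | yes refl = b , refl , refl

    live : ∀ c → isSnd (node c) ≡ true → ∃₂ λ l q → nodeNext (node c) l ≡ just q
    live c out with node c in eq
    live c out | snd b q = char b , q , trans (cong (λ n → nodeNext n (char b)) (sym eq)) (proj₂ (Extends.out extends eq))

  -- The only added state that waits is `errBang`, entered by sending the machine's own `bang`. A
  -- machine waiting there has sent one `bang` more than it has received. With empty channels the
  -- other one would be one behind, as happens only in `flush`, which can send.
  module SendFirst where

    data State : Set where
      core          : C → State
      err           : Fin γ → State
      errBang flush : State

    open Total core err errBang flush public

    sends : State → Bool
    sends (core c) = isSnd (node c)
    sends (err _)  = true
    sends errBang  = false
    sends flush    = true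

    next : State → Letter γ → Maybe State
    next (core c) l        = nodeNext (node c) l
    next (err _)  (char b) = just (err b)
    next (err _)  bang     = just errBang
    next errBang  (char _) = just errBang
    next errBang  bang     = just (core home)
    next flush    (char _) = just flush
    next flush    bang     = just (core home)
    next _        dollar   = nothing

    machine : Mach γ
    machine = record { State = State ; initial = core home ; sends = sends ; next = next }

    live : ∀ p → sends p ≡ true → ∃₂ λ l q → next p l ≡ just q
    live (core c) out with node c
    ... | snd b q = bang , errBang , refl
    live (err _)  out = bang , errBang , refl
    live flush    out = bang , core home , refl

  -- The end marker has two letters. `bang` may be sent at any send node of the core and commits the
  -- machine to waiting, but `dollar` is sent only in `close`, and every way from the core to
  -- `close` receives a `dollar` first. So no run ever sends the first `dollar`: a machine that
  -- deviates stays in its waiting states for good, although its diagram still has paths for all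
  -- words cut into phases.
  module RecvFirst where

    data State : Set where
      core                               : C → State
      err                                : Fin γ → State
      errBang waitClose wait flush close : State

    open Total core err errBang wait public

    sends : State → Bool
    sends (core c)  = isSnd (node c)
    sends flush     = true
    sends close     = true
    sends _         = false

    next : State → Letter γ → Maybe State
    next (core c)  l        = nodeNext (node c) l
    next (err b)   (char _) = just (err b)
    next (err _)   bang     = just wait
    next errBang   (char _) = just errBang
    next errBang   bang     = just waitClose
    next waitClose dollar   = just close
    next wait      dollar   = just flush
    next flush     (char _) = just flush
    next flush     bang     = just close
    next close     dollar   = just (core home)
    next _         _        = nothing

    machine : Mach γ
    machine = record { State = State ; initial = core home ; sends = sends ; next = next }

    live : ∀ p → sends p ≡ true → ∃₂ λ l q → next p l ≡ just q
    live (core c) out with node c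
    ... | snd b q = bang , errBang , refl
    live flush    out = bang , close , refl
    live close    out = dollar , core home , refl

module PartialConnected {γ : ℕ} {C : Set} (node : C → Node γ C) (home : C) (ok : IsCore node home) where

  open IsCore ok
  open Completion.Partial node home
  open Mach machine using (_⇢_)
  open Extends extends using (step)

  rank-next : ∀ {p l q} → isSnd (node p) ≡ true → nodeNext (node p) l ≡ just q → rank q < rank p
  rank-next {p} {l} out eq with nodeNext-snd (node p) {l} out eq
  ... | b , at , _ = rank-snd at

  return : ∀ c → Acc _<_ (rank c) → Star _⇢_ c home
  return c (acc rec) with node c in eq
  ... | snd b q = step (snd eq) ◅ return q (rec (rank-snd eq))
  ... | rcv t   = (bang , cong (λ n → nodeNext n bang) eq) ◅ ε

  connected : ∀ p q → Star _⇢_ p q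
  connected p q = return p (<-wellFounded _) ◅◅ gmap (λ c → c) step (reach q)

module TotalMachine {γ : ℕ} {C : Set} (node : C → Node γ C) (home : C) (ok : IsCore node home)
  {S : Set} (core : C → S) (err : Fin γ → S) (errBang onBang : S)
  (sends : S → Bool) (next : S → Letter γ → Maybe S) (sends-core : ∀ c → sends (core c) ≡ isSnd (node c))
  (next-core : ∀ c l → next (core c) l ≡ Total.nodeNext core err errBang onBang (node c) l) where

  open IsCore ok
  open Total core err errBang onBang

  machine : Mach γ
  machine = record { State = S ; initial = core home ; sends = sends ; next = next }

  open Mach machine using (_⇢_; Path; []; snd; rcv)

  at-node : ∀ {c n} l → node c ≡ n → next (core c) l ≡ nodeNext n l
  at-node {c} l eq = trans (next-core c l) (cong (λ n → nodeNext n l) eq)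

  extends : Extends node machine core
  extends = record
    { out = λ {c} {b} eq → trans (sends-core c) (cong isSnd eq) , trans (at-node (char b) eq) next-right
    ; off = λ {c} eq → trans (sends-core c) (cong isSnd eq)
    ; inp = λ b eq → at-node (char b) eq }

  open Extends extends using (step)

  core⇢ : ∀ c → core c ⇢ errBang ⊎ core c ⇢ onBang
  core⇢ c with node c in eq
  ... | snd b q = inj₁ (bang , at-node bang eq)
  ... | rcv t   = inj₂ (bang , at-node bang eq)

  reach-core : ∀ c → Star _⇢_ (core home) (core c)
  reach-core c = gmap core step (reach c)

  reach-err : ∀ b → Star _⇢_ (core home) (err b)
  reach-err b with wrongAt b
  ... | c , b' , q , eq , b≢b' = reach-core c ◅◅ (char b , trans (at-node (char b) eq) (next-wrong b≢b')) ◅ ε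

  reach-errBang : Star _⇢_ (core home) errBang
  reach-errBang with writing
  ... | c , b , q , eq = reach-core c ◅◅ (bang , at-node bang eq) ◅ ε

  reach-onBang : Star _⇢_ (core home) onBang
  reach-onBang with reading
  ... | c , t , eq = reach-core c ◅◅ (bang , at-node bang eq) ◅ ε

  -- `E'` is what follows `bang` in the end marker: nothing in the send-first completion, `dollar`
  -- in the receive-first one.
  module TotalPhases (E' : Word γ) where

    E : Word γ
    E = bang ∷ E'

    -- What a path from `c` back to `home` sends and receives. Either it is the empty path or, as no
    -- core edge enters `home`, the phase in progress must still be closed on both tapes.
    CoreRest : C → Word γ → Word γ → Set
    CoreRest c s r = (c ≡ home × s ≡ [] × r ≡ []) ⊎ Open E s r

    rest-home : ∀ {s r} → CoreRest home s r → Phases E s r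
    rest-home (inj₁ (_ , refl , refl))          = []
    rest-home (inj₂ (_ , _ , t₁ , t₂ , phases)) = phase t₁ t₂ phases

    rest-inside : ∀ {c s r} → c ≢ home → CoreRest c s r → Open E s r
    rest-inside c≢ (inj₁ (p , _)) = contradiction p c≢
    rest-inside c≢ (inj₂ o)       = o

    module Sound (Rest : S → Word γ → Word γ → Set)
      (rest-core    : ∀ {c s r} → Rest (core c) s r → CoreRest c s r)
      (rest-err     : ∀ {b s r} → Rest (err b) s r → Open E s r)
      (rest-errBang : ∀ {s r} → Rest errBang s r → Open E (bang ∷ s) r)
      (rest-onBang  : ∀ {s r} → Rest onBang s r → Open E s (bang ∷ r)) where

      sndNode : ∀ c {l q s r} → sends (core c) ≡ true → next (core c) l ≡ just q → Rest q s r → Open E (l ∷ s) r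
      sndNode c {l} out eq rest with node c in at | trans (sym (sends-core c)) out | trans (sym (next-core c l)) eq
      sndNode c {char b'} out eq rest | snd b q | _ | eq' with b' Fin.≟ b
      sndNode c {char b'} out eq rest | snd b q | _ | refl | yes _ = sndOpen b' (rest-inside (fresh-snd at) (rest-core rest))
      sndNode c {char b'} out eq rest | snd b q | _ | refl | no _  = sndOpen b' (rest-err rest)
      sndNode c {bang}    out eq rest | snd b q | _ | refl = rest-errBang rest

      rcvNode : ∀ c {l q s r} → sends (core c) ≡ false → next (core c) l ≡ just q → Rest q s r → Open E s (l ∷ r)
      rcvNode c {l} out eq rest with node c in at | trans (sym (sends-core c)) out | trans (sym (next-core c l)) eq
      rcvNode c {char b} out eq rest | rcv t | _ | refl = rcvOpen b (rest-inside (fresh-rcv b at) (rest-core rest))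
      rcvNode c {bang}   out eq rest | rcv t | _ | refl = rest-onBang rest

    Home : Word γ → Word γ → Set
    Home s r = Path (core home) s r (core home)

    module Complete
      (errs     : ∀ {b s s' r r'} → Tail E s s' → Tail E r r' → Home s' r' → Path (err b) s r (core home))
      (collects : ∀ {s r r'} → Tail E r r' → Home s r' → Path errBang (E' ++ s) r (core home))
      (flushes  : ∀ {s s' r} → Tail E s s' → Home s' r → Path onBang s (E' ++ r) (core home)) where

      -- The kind of the node decides which tape supplies the next letter. A send node also takes
      -- wrong letters, and both kinds take `bang`, so no pair of tapes gets stuck; the first wrong
      -- letter or marker decides which of the three continuations finishes the phase.
      opens : ∀ {s s' r r'} c → Tail E s s' → Tail E r r' → Home s' r' → Path (core c) s r (core home)
      opens c t u path with node c in eq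
      opens c end u path | snd b q = snd (trans (sends-core c) (cong isSnd eq)) (at-node bang eq) (collects u path)
      opens c (b' ∷ t) u path | snd b q with b' Fin.≟ b
      ... | yes refl = snd (trans (sends-core c) (cong isSnd eq)) (trans (at-node (char b') eq) next-right) (opens q t u path)
      ... | no b'≢b  = snd (trans (sends-core c) (cong isSnd eq)) (trans (at-node (char b') eq) (next-wrong b'≢b)) (errs t u path)
      opens c t end path | rcv f = rcv (trans (sends-core c) (cong isSnd eq)) (at-node bang eq) (flushes t path)
      opens c t (b ∷ u) path | rcv f = rcv (trans (sends-core c) (cong isSnd eq)) (at-node (char b) eq) (opens (f b) t u path)

      complete : ∀ {s r} → Phases E s r → Home s r
      complete []             = []
      complete (phase t u ph) = opens home t u (complete ph)

module SendFirstMachine {γ : ℕ} {C : Set} (node : C → Node γ C) (home : C) (ok : IsCore node home) where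

  open Completion.SendFirst node home
  open TotalMachine node home ok core err errBang flush sends next (λ _ → refl) (λ _ _ → refl) public
    using (extends; core⇢; reach-core; reach-err; reach-errBang; reach-onBang; module TotalPhases)
  open Mach machine using (_⇢_; Path; []; snd; rcv)

  return : ∀ p → Star _⇢_ p (core home)
  return (core c) with core⇢ c
  ... | inj₁ step = step ◅ (bang , refl) ◅ ε
  ... | inj₂ step = step ◅ (bang , refl) ◅ ε
  return (err b)  = (bang , refl) ◅ (bang , refl) ◅ ε
  return errBang  = (bang , refl) ◅ ε
  return flush    = (bang , refl) ◅ ε

  connected : ∀ p q → Star _⇢_ p q
  connected p (core c) = return p ◅◅ reach-core c
  connected p (err b)  = return p ◅◅ reach-err b
  connected p errBang  = return p ◅◅ reach-errBang
  connected p flush    = return p ◅◅ reach-onBang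

  open TotalPhases [] public

  Rest : State → Word γ → Word γ → Set
  Rest (core c) s r = CoreRest c s r
  Rest (err _)  s r = Open E s r
  Rest errBang  s r = ∃ λ r' → Tail E r r' × Phases E s r'
  Rest flush    s r = ∃ λ s' → Tail E s s' × Phases E s' r

  rest-errBang : ∀ {s r} → Rest errBang s r → Open E (bang ∷ s) r
  rest-errBang (r' , t , ph) = _ , r' , end , t , ph

  rest-flush : ∀ {s r} → Rest flush s r → Open E s (bang ∷ r)
  rest-flush (s' , t , ph) = s' , _ , t , end , ph

  open Sound Rest (λ r → r) (λ r → r) rest-errBang rest-flush

  sound : ∀ {p s r} → Path p s r (core home) → Rest p s r
  sound [] = inj₁ (refl , refl , refl)
  sound (snd {core c} {l = l} out eq path)       = inj₂ (sndNode c {l} out eq (sound path))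
  sound (snd {err _} {l = char b} out refl path) = sndOpen b (sound path)
  sound (snd {err _} {l = bang} out refl path)   = rest-errBang (sound path)
  sound (snd {flush} {l = char b} out refl path) with sound path
  ... | s' , t , ph = s' , b ∷ t , ph
  sound (snd {flush} {l = bang} out refl path) = _ , end , rest-home (sound path)
  sound (rcv {core c} {l = l} out eq path)     = inj₂ (rcvNode c {l} out eq (sound path))
  sound (rcv {errBang} {l = char b} out refl path) with sound path
  ... | r' , t , ph = r' , b ∷ t , ph
  sound (rcv {errBang} {l = bang} out refl path) = _ , end , rest-home (sound path)

  flushes : ∀ {s s' r} → Tail E s s' → Home s' r → Path flush s r (core home)
  flushes end     path = snd refl refl path
  flushes (b ∷ t) path = snd refl refl (flushes t path)

  collects : ∀ {s r r'} → Tail E r r' → Home s r' → Path errBang s r (core home)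
  collects end     path = rcv refl refl path
  collects (b ∷ t) path = rcv refl refl (collects t path)

  errs : ∀ {b s s' r r'} → Tail E s s' → Tail E r r' → Home s' r' → Path (err b) s r (core home)
  errs end     u path = snd refl refl (collects u path)
  errs (b ∷ t) u path = snd refl refl (errs t u path)

  open Complete errs collects flushes public using (complete)

module RecvFirstMachine {γ : ℕ} {C : Set} (node : C → Node γ C) (home : C) (ok : IsCore node home) where

  open Completion.RecvFirst node home
  open TotalMachine node home ok core err errBang wait sends next (λ _ → refl) (λ _ _ → refl) public
    using (extends; core⇢; reach-core; reach-err; reach-errBang; reach-onBang; module TotalPhases)
  open Mach machine using (_⇢_; Path; []; snd; rcv)

  from-wait : Star _⇢_ wait (core home)
  from-wait = (dollar , refl) ◅ (bang , refl) ◅ (dollar , refl) ◅ ε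

  from-errBang : Star _⇢_ errBang (core home)
  from-errBang = (bang , refl) ◅ (dollar , refl) ◅ (dollar , refl) ◅ ε

  return : ∀ p → Star _⇢_ p (core home)
  return (core c) with core⇢ c
  ... | inj₁ step = step ◅ from-errBang
  ... | inj₂ step = step ◅ from-wait
  return (err b)   = (bang , refl) ◅ from-wait
  return errBang   = from-errBang
  return waitClose = (dollar , refl) ◅ (dollar , refl) ◅ ε
  return wait      = from-wait
  return flush     = (bang , refl) ◅ (dollar , refl) ◅ ε
  return close     = (dollar , refl) ◅ ε

  access : ∀ q → Star _⇢_ (core home) q
  access (core c)  = reach-core c
  access (err b)   = reach-err b
  access errBang   = reach-errBang
  access waitClose = reach-errBang ◅◅ (bang , refl) ◅ ε
  access wait      = reach-onBang
  access flush     = reach-onBang ◅◅ (dollar , refl) ◅ ε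
  access close     = reach-onBang ◅◅ (dollar , refl) ◅ (bang , refl) ◅ ε

  connected : ∀ p q → Star _⇢_ p q
  connected p q = return p ◅◅ access q

  open TotalPhases (dollar ∷ []) public

  Closing : Word γ → (Word γ → Set) → Set
  Closing s A = ∃ λ s' → s ≡ dollar ∷ s' × A s'

  Rest : State → Word γ → Word γ → Set
  Rest (core c)  s r = CoreRest c s r
  Rest (err _)   s r = Open E s r
  Rest errBang   s r = Closing s λ s' → ∃ λ r' → Tail E r r' × Phases E s' r'
  Rest waitClose s r = Closing s λ s' → Closing r λ r' → Phases E s' r'
  Rest wait      s r = Closing r λ r' → ∃ λ s' → Tail E s s' × Phases E s' r'
  Rest flush     s r = ∃ λ s' → Tail E s s' × Phases E s' r
  Rest close     s r = Closing s λ s' → Phases E s' r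

  rest-errBang : ∀ {s r} → Rest errBang s r → Open E (bang ∷ s) r
  rest-errBang (s' , refl , r' , t , ph) = s' , r' , end , t , ph

  rest-wait : ∀ {s r} → Rest wait s r → Open E s (bang ∷ r)
  rest-wait (r' , refl , s' , t , ph) = s' , r' , t , end , ph

  open Sound Rest (λ r → r) (λ r → r) rest-errBang rest-wait

  sound : ∀ {p s r} → Path p s r (core home) → Rest p s r
  sound [] = inj₁ (refl , refl , refl)
  sound (snd {core c} {l = l} out eq path) = inj₂ (sndNode c {l} out eq (sound path))
  sound (snd {flush} {l = char b} out refl path) with sound path
  ... | s' , t , ph = s' , b ∷ t , ph
  sound (snd {flush} {l = bang} out refl path) with sound path
  ... | s' , refl , ph = s' , end , ph
  sound (snd {close} {l = dollar} out refl path) = _ , refl , rest-home (sound path)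
  sound (rcv {core c} {l = l} out eq path) = inj₂ (rcvNode c {l} out eq (sound path))
  sound (rcv {err _} {l = char b} out refl path) = rcvOpen b (sound path)
  sound (rcv {err _} {l = bang} out refl path) = rest-wait (sound path)
  sound (rcv {errBang} {l = char b} out refl path) with sound path
  ... | s' , refl , r' , t , ph = s' , refl , r' , b ∷ t , ph
  sound (rcv {errBang} {l = bang} out refl path) with sound path
  ... | s' , refl , r' , refl , ph = s' , refl , r' , end , ph
  sound (rcv {waitClose} {l = dollar} out refl path) with sound path
  ... | s' , refl , ph = s' , refl , _ , refl , ph
  sound (rcv {wait} {l = dollar} out refl path) = _ , refl , sound path

  flushes : ∀ {s s' r} → Tail E s s' → Home s' r → Path flush s r (core home)
  flushes end     path = snd refl refl (snd refl refl path)
  flushes (b ∷ t) path = snd refl refl (flushes t path)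

  collects : ∀ {s r r'} → Tail E r r' → Home s r' → Path errBang (dollar ∷ s) r (core home)
  collects end     path = rcv refl refl (rcv refl refl (snd refl refl path))
  collects (b ∷ t) path = rcv refl refl (collects t path)

  errs : ∀ {b s s' r r'} → Tail E s s' → Tail E r r' → Home s' r' → Path (err b) s r (core home)
  errs t end     path = rcv refl refl (rcv refl refl (flushes t path))
  errs t (b ∷ u) path = rcv refl refl (errs t u path)

  open Complete errs collects (λ t path → rcv refl refl (flushes t path)) public using (complete)

-- Joint runs of the control and the echo: deadlocks and channel bounds.

module Deterministic {A : Set} {_⇒_ : A → A → Set} (deterministic : ∀ {x y z} → x ⇒ y → x ⇒ z → y ≡ z) where

  comparable : ∀ {x y z} → Star _⇒_ x y → Star _⇒_ x z → Star _⇒_ y z ⊎ Star _⇒_ z y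
  comparable ε        ys       = inj₁ ys
  comparable (x ◅ xs) ε        = inj₂ (x ◅ xs)
  comparable (x ◅ xs) (y ◅ ys) with refl ← deterministic x y = comparable xs ys

  -- By determinism only the finitely many elements on the way to `y` come before it, so a bound
  -- from `y` on extends to all of them.
  bounded : ∀ (size : A → ℕ) {B x y} → Star _⇒_ x y → (∀ z → Star _⇒_ y z → size z ≤ B) →
            ∃ λ B' → ∀ z → Star _⇒_ x z → size z ≤ B'
  bounded size ε        limit = _ , limit
  bounded size {x = x} (s ◅ steps) limit with bounded size steps limit
  ... | B' , limit' = size x ⊔ B' , λ where
    _ ε        → m≤m⊔n _ _
    z (t ◅ ts) → case deterministic s t of λ where refl → ≤-trans (limit' z ts) (m≤n⊔m (size x) B')

invariant : ∀ {A : Set} {_⇒_ : A → A → Set} (I : A → Set) → (∀ {x y} → x ⇒ y → I x → I y) →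
            ∀ {x y} → Star _⇒_ x y → I x → I y
invariant I step ε        i = i
invariant I step (s ◅ ss) i = invariant I step ss (step s i)

module Joint {γ : ℕ} (M₀ M₁ : Mach γ) where

  module M₀ = Mach M₀
  module M₁ = Mach M₁

  record Config : Set where
    constructor ⟨_,_∣_,_⟩
    field
      p₀ : M₀.State
      p₁ : M₁.State
      xα xβ : Word γ
  open Config public

  infix 4 _↦_ _↦*_
  data _↦_ : Config → Config → Set where
    send₀ : ∀ {p q p₁ xα xβ l} → M₀.sends p ≡ true → M₀.next p l ≡ just q →
            ⟨ p , p₁ ∣ xα , xβ ⟩ ↦ ⟨ q , p₁ ∣ xα ∷ʳ l , xβ ⟩
    send₁ : ∀ {p q p₀ xα xβ l} → M₁.sends p ≡ true → M₁.next p l ≡ just q →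
            ⟨ p₀ , p ∣ xα , xβ ⟩ ↦ ⟨ p₀ , q ∣ xα , xβ ∷ʳ l ⟩
    recv₀ : ∀ {p q p₁ xα xβ l} → M₀.sends p ≡ false → M₀.next p l ≡ just q →
            ⟨ p , p₁ ∣ xα , l ∷ xβ ⟩ ↦ ⟨ q , p₁ ∣ xα , xβ ⟩
    recv₁ : ∀ {p q p₀ xα xβ l} → M₁.sends p ≡ false → M₁.next p l ≡ just q →
            ⟨ p₀ , p ∣ l ∷ xα , xβ ⟩ ↦ ⟨ p₀ , q ∣ xα , xβ ⟩

  _↦*_ : Config → Config → Set
  _↦*_ = Star _↦_

  start₀₁ : Config
  start₀₁ = ⟨ M₀.initial , M₁.initial ∣ [] , [] ⟩

  Dead : Config → Set
  Dead ⟨ p , q ∣ xα , xβ ⟩ = M₀.sends p ≡ false × M₁.sends q ≡ false × xα ≡ [] × xβ ≡ []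

  NeverDead : Set
  NeverDead = ∀ c → start₀₁ ↦* c → ¬ Dead c

  Limited : Set
  Limited = ∃ λ B → ∀ c → start₀₁ ↦* c → length (xα c) + length (xβ c) ≤ B

data Echo (γ : ℕ) : Set where
  home idle : Echo γ
  pend      : Fin γ → Echo γ

-- home and idle behave alike, but home is never entered again.
echoNode : ∀ {γ} → Echo γ → Node γ (Echo γ)
echoNode home     = rcv pend
echoNode idle     = rcv pend
echoNode (pend b) = snd b idle

module Analysis {γ : ℕ} {C : Set} (node : C → Node γ C) (home₀ : C) where

  infix 4 _⇛_ _⇛*_
  _⇛_ _⇛*_ : C × List (Fin γ) → C × List (Fin γ) → Set
  _⇛_  = QStep node
  _⇛*_ = Star _⇛_

  Stuck QLimited QUnlimited : Set
  Stuck      = ∃₂ λ c t → node c ≡ rcv t × (home₀ , []) ⇛* (c , [])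
  QLimited   = ∃ λ B → ∀ x → (home₀ , []) ⇛* x → length (proj₂ x) ≤ B
  QUnlimited = ∀ n → ∃ λ x → (home₀ , []) ⇛* x × n ≤ length (proj₂ x)

  chars : List (Fin γ) → Word γ
  chars = List.map char

  chars-∷ʳ : ∀ u b → chars (u ∷ʳ b) ≡ chars u ∷ʳ char b
  chars-∷ʳ u b = map-++ char u (b ∷ [])

  module Embedding {M₀ M₁ : Mach γ} {ι₀ ι₁} (ext₀ : Extends node M₀ ι₀) (ext₁ : Extends echoNode M₁ ι₁)
                   (init₀ : Mach.initial M₀ ≡ ι₀ home₀) (init₁ : Mach.initial M₁ ≡ ι₁ home) where

    open Joint M₀ M₁
    module E₀ = Extends ext₀
    module E₁ = Extends ext₁

    data Idle : Echo γ → Set where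
      home : Idle home
      idle : Idle idle

    idle-rcv : ∀ {e} → Idle e → echoNode e ≡ rcv pend
    idle-rcv home = refl
    idle-rcv idle = refl

    -- The echo answers each letter at once, so between two steps of the queue machine `α` is empty
    -- and `β` is the queue. These schedules transfer a deadlock or unbounded growth to the pair.
    simulates : ∀ {c u c' u' e} → (c , u) ⇛ (c' , u') → Idle e → ∃ λ e' → Idle e' ×
                ⟨ ι₀ c , ι₁ e ∣ [] , chars u ⟩ ↦* ⟨ ι₀ c' , ι₁ e' ∣ [] , chars u' ⟩
    simulates {c} {u} {c'} {e = e} (snd {b = b} eq) ie = idle , idle ,
      uncurry send₀ (E₀.out eq) ◅ recv₁ (E₁.off (idle-rcv ie)) (E₁.inp b (idle-rcv ie)) ◅
      subst (λ x → ⟨ ι₀ c' , ι₁ (pend b) ∣ [] , chars u ⟩ ↦* ⟨ ι₀ c' , ι₁ idle ∣ [] , x ⟩) (sym (chars-∷ʳ u b))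
        (uncurry send₁ (E₁.out {pend b} refl) ◅ ε)
    simulates {e = e} (rcv eq) ie = e , ie , recv₀ (E₀.off eq) (E₀.inp _ eq) ◅ ε

    simulates* : ∀ {x y e} → x ⇛* y → Idle e → ∃ λ e' → Idle e' ×
                 ⟨ ι₀ (proj₁ x) , ι₁ e ∣ [] , chars (proj₂ x) ⟩ ↦* ⟨ ι₀ (proj₁ y) , ι₁ e' ∣ [] , chars (proj₂ y) ⟩
    simulates* ε        ie = _ , ie , ε
    simulates* (s ◅ ss) ie with simulates s ie
    ... | e' , ie' , steps with simulates* ss ie'
    ... | e″ , ie″ , steps' = e″ , ie″ , steps ◅◅ steps'

    reachable : ∀ {x} → (home₀ , []) ⇛* x → ∃ λ e → Idle e × start₀₁ ↦* ⟨ ι₀ (proj₁ x) , ι₁ e ∣ [] , chars (proj₂ x) ⟩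
    reachable steps with simulates* steps home
    ... | e , ie , steps' = e , ie , subst₂ (λ p q → ⟨ p , q ∣ [] , [] ⟩ ↦* _) (sym init₀) (sym init₁) steps'

    stuck⇒dead : Stuck → ¬ NeverDead
    stuck⇒dead (c , t , eq , steps) never with reachable steps
    ... | e , ie , steps' = never _ steps' (E₀.off eq , E₁.off (idle-rcv ie) , refl , refl)

    unlimited⇒unlimited : QUnlimited → ¬ Limited
    unlimited⇒unlimited unlimited (B , limit) with unlimited (suc B)
    ... | (c , u) , steps , long with reachable steps
    ... | e , ie , steps' = <⇒≱ long (subst (_≤ B) (length-map char u) (limit _ steps'))

  pending : Echo γ → Word γ
  pending (pend b) = char b ∷ []
  pending _        = []

  -- The contents of both channels and of the echo, read as one queue.
  record Sync (c : C) (e : Echo γ) (xα xβ : Word γ) : Set where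
    constructor synced
    field
      queue : List (Fin γ)
      same  : chars queue ≡ xβ ++ pending e ++ xα
      steps : (home₀ , []) ⇛* (c , queue)

  is-char : ∀ u xs {l ys} → chars u ≡ xs ++ l ∷ ys → ∃ λ b → l ≡ char b
  is-char (b ∷ u) []       eq = b , sym (proj₁ (∷-injective eq))
  is-char (b ∷ u) (x ∷ xs) eq = is-char u xs (proj₂ (∷-injective eq))
  is-char []      []       ()
  is-char []      (x ∷ xs) ()

  sync-snd₀ : ∀ {c b q e xα xβ} → node c ≡ snd b q → Sync c e xα xβ → Sync q e (xα ∷ʳ char b) xβ
  sync-snd₀ {b = b} {e = e} {xα} {xβ} eq (synced u same steps) = synced (u ∷ʳ b)
    (trans (chars-∷ʳ u b) (trans (cong (_∷ʳ char b) same)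
        (trans (++-assoc xβ (pending e ++ xα) _) (cong (xβ ++_) (++-assoc (pending e) xα _)))))
    (steps ◅◅ snd eq ◅ ε)

  sync-rcv₀ : ∀ {c t l e xα xβ} → node c ≡ rcv t → Sync c e xα (l ∷ xβ) → ∃ λ b → l ≡ char b × Sync (t b) e xα xβ
  sync-rcv₀ eq (synced (b ∷ u) same steps) =
    b , sym (proj₁ (∷-injective same)) , synced u (proj₂ (∷-injective same)) (steps ◅◅ rcv eq ◅ ε)

  sync-snd₁ : ∀ {c b xα xβ} → Sync c (pend b) xα xβ → Sync c idle xα (xβ ∷ʳ char b)
  sync-snd₁ {b = b} {xα} {xβ} (synced u same steps) = synced u (trans same (sym (∷ʳ-++ xβ (char b) xα))) steps

  sync-rcv₁ : ∀ {c e l xα xβ} → echoNode e ≡ rcv pend → Sync c e (l ∷ xα) xβ → ∃ λ b → l ≡ char b × Sync c (pend b) xα xβ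
  sync-rcv₁ {e = home} {xβ = xβ} _ (synced u same steps) with is-char u xβ same
  ... | b , refl = b , refl , synced u same steps
  sync-rcv₁ {e = idle} {xβ = xβ} _ (synced u same steps) with is-char u xβ same
  ... | b , refl = b , refl , synced u same steps

  echo-rcv : ∀ {e : Echo γ} → isSnd (echoNode e) ≡ false → echoNode e ≡ rcv pend × pending e ≡ []
  echo-rcv {home} _ = refl , refl
  echo-rcv {idle} _ = refl , refl

  echo-snd : ∀ {e : Echo γ} → isSnd (echoNode e) ≡ true → ∃ λ b → e ≡ pend b
  echo-snd {pend b} _ = b , refl

  rcv-node : ∀ {c} → isSnd (node c) ≡ false → ∃ λ t → node c ≡ rcv t
  rcv-node {c} eq with node c
  rcv-node {c} () | snd _ _
  ... | rcv t = t , refl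

  sync-length : ∀ {c e xα xβ} → (limit : QLimited) → Sync c e xα xβ → length xβ + (length (pending e) + length xα) ≤ proj₁ limit
  sync-length {c} {e} {xα} {xβ} (B , limit) (synced u same steps) =
    subst (_≤ B) (trans (sym (length-map char u)) (trans (cong length same)
      (trans (length-++ xβ) (cong (length xβ +_) (length-++ (pending e)))))) (limit _ steps)

  segStep : ∀ {γ} → ℕ × List (Fin γ) → Letter γ → ℕ × List (Fin γ)
  segStep (n , t) (char b) = n , t ∷ʳ b
  segStep (n , t) bang     = suc n , []
  segStep (n , t) dollar   = n , t

  -- The number of bangs and the letters after the last one.
  seg : Word γ → ℕ × List (Fin γ)
  seg = foldl segStep (0 , [])

  seg-∷ʳ : ∀ s l → seg (s ∷ʳ l) ≡ segStep (seg s) l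
  seg-∷ʳ s l = foldl-∷ʳ segStep (0 , []) l s

  data Trace {D : Set} (nd : D → Node γ D) (h : D) : D → List (Fin γ) → List (Fin γ) → Set where
    []  : Trace nd h h [] []
    snd : ∀ {d b q s r} → Trace nd h d s r → nd d ≡ snd b q → Trace nd h q (s ∷ʳ b) r
    rcv : ∀ {d t b s r} → Trace nd h d s r → nd d ≡ rcv t → Trace nd h (t b) s (r ∷ʳ b)

  echo-trace : ∀ {e s r} → Trace echoNode home e s r → chars r ≡ chars s ++ pending e
  echo-trace [] = refl
  echo-trace (snd {pend b} {s = s} tr refl) = trans (echo-trace tr) (sym (trans (++-identityʳ _) (chars-∷ʳ s b)))
  echo-trace (rcv {home} {b = b} {r = r} tr refl) =
    trans (chars-∷ʳ r b) (cong (_∷ʳ char b) (trans (echo-trace tr) (++-identityʳ _)))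
  echo-trace (rcv {idle} {b = b} {r = r} tr refl) =
    trans (chars-∷ʳ r b) (cong (_∷ʳ char b) (trans (echo-trace tr) (++-identityʳ _)))

  chars-injective : ∀ u v → chars u ≡ chars v → u ≡ v
  chars-injective []      []      _  = refl
  chars-injective (b ∷ u) (c ∷ v) eq with ∷-injective eq
  ... | refl , eq' = cong (b ∷_) (chars-injective u v eq')

  -- A trace whose tapes agree is a run of the queue machine, unless it reads a letter before it
  -- was written; at the first such moment the queue machine is stuck.
  trace-run : ∀ {c s r} z s' r' → Trace node home₀ c s r → s ++ s' ≡ z → r ++ r' ≡ z →
              Stuck ⊎ ∃ λ u → s ≡ r ++ u × (home₀ , []) ⇛* (c , u)
  trace-run z s' r' [] _ _ = inj₂ ([] , refl , ε)
  trace-run z s' r' (snd {b = b} {s = s} {r = r} tr eq) eqₛ eqᵣ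
    with trace-run z (b ∷ s') r' tr (trans (sym (∷ʳ-++ s b s')) eqₛ) eqᵣ
  ... | inj₁ stuck             = inj₁ stuck
  ... | inj₂ (u , refl , steps) = inj₂ (u ∷ʳ b , ++-assoc r u _ , steps ◅◅ snd eq ◅ ε)
  trace-run z s' r' (rcv {d = d} {t} {b} {s} {r} tr eq) eqₛ eqᵣ
    with trace-run z s' (b ∷ r') tr eqₛ (trans (sym (∷ʳ-++ r b r')) eqᵣ)
  ... | inj₁ stuck                   = inj₁ stuck
  ... | inj₂ ([] , refl , steps)     = inj₁ (d , t , eq , steps)
  ... | inj₂ (b' ∷ u , refl , steps) with ∷-injective (++-cancelˡ r (b' ∷ u ++ s') (b ∷ r')
        (trans (sym (++-assoc r (b' ∷ u) s')) (trans eqₛ (trans (sym eqᵣ) (∷ʳ-++ r b r')))))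
  ... | refl , _ = inj₂ (u , sym (∷ʳ-++ r b u) , steps ◅◅ rcv eq ◅ ε)

module PartialAnalysis {γ : ℕ} {C : Set} (node : C → Node γ C) (home₀ : C) where

  open Analysis node home₀

  module F₀ = Completion.Partial node home₀
  module F₁ = Completion.Partial (echoNode {γ}) home
  open Joint F₀.machine F₁.machine

  Inv : Config → Set
  Inv ⟨ c , e ∣ xα , xβ ⟩ = Sync c e xα xβ

  -- The partial completion sends only the letters of the core, so a run never leaves the
  -- configurations synchronised with the queue machine.
  preserve : ∀ {x y} → x ↦ y → Inv x → Inv y
  preserve (send₀ {p = c} {l = l} out eq) inv with F₀.nodeNext-snd (node c) {l} out eq
  ... | b , nodeEq , refl = sync-snd₀ nodeEq inv
  preserve (recv₀ {p = c} {l = l} out eq) inv with rcv-node {c} out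
  ... | t , nodeEq with sync-rcv₀ nodeEq inv
  ... | b , refl , inv' = subst (λ q → Sync q _ _ _)
    (just-injective (trans (sym (cong (λ n → F₀.nodeNext n (char b)) nodeEq)) eq)) inv'
  preserve (send₁ {p = pend b} {l = char b'} out eq) inv with b' Fin.≟ b
  preserve (send₁ {p = pend b} {l = char b'} out refl) inv | yes refl = sync-snd₁ inv
  preserve (recv₁ {p = e} out eq) inv with echo-rcv {e} out
  ... | nodeEq , _ with sync-rcv₁ nodeEq inv
  ... | b , refl , inv' = subst (λ q → Sync _ q _ _)
    (just-injective (trans (sym (cong (λ n → F₁.nodeNext n (char b)) nodeEq)) eq)) inv'

  sync : ∀ {x} → start₀₁ ↦* x → Inv x
  sync steps = invariant Inv preserve steps (synced [] refl ε)

  neverDead : ¬ Stuck → NeverDead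
  neverDead ¬stuck ⟨ c , e ∣ .[] , .[] ⟩ steps (out₀ , out₁ , refl , refl)
    with sync steps | rcv-node {c} out₀ | echo-rcv {e} out₁
  ... | synced u same run | t , eq | _ , empty rewrite empty with u
  ... | [] = ¬stuck (c , t , eq , run)

  limited : QLimited → Limited
  limited limit = proj₁ limit , λ where
    ⟨ c , e ∣ xα , xβ ⟩ steps → ≤-trans (≤-reflexive (+-comm (length xα) (length xβ)))
      (≤-trans (+-monoʳ-≤ (length xβ) (m≤n+m (length xα) (length (pending e)))) (sync-length {c} {e} limit (sync steps)))

module SendFirstAnalysis {γ : ℕ} {C : Set} (node : C → Node γ C) (home₀ : C) where

  open Analysis node home₀

  module History {D : Set} (nd : D → Node γ D) (h : D) where

    open Completion.SendFirst nd h

    -- Bangs sent are compared with bangs received; on the core the segments since the last `bang`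
    -- form a trace. `errBang` is one ahead with an empty sent segment, `flush` one behind with an
    -- empty received one, so the `bang` that leads home leaves both segments empty and a new trace
    -- begins.
    Hist : State → ℕ × List (Fin γ) → ℕ × List (Fin γ) → Set
    Hist (core d) (n , s) (m , r) = n ≡ m × Trace nd h d s r
    Hist (err _)  (n , s) (m , r) = n ≡ m
    Hist errBang  (n , s) (m , r) = n ≡ suc m × s ≡ []
    Hist flush    (n , s) (m , r) = m ≡ suc n × r ≡ []

    hist-sndNode : ∀ {d} n {l q s r} → nd d ≡ n → isSnd n ≡ true → nodeNext n l ≡ just q → Hist (core d) s r → Hist q (segStep s l) r
    hist-sndNode (snd b c) {char b'} at _ eq hist with b' Fin.≟ b
    hist-sndNode (snd b c) {char b'} at _ refl (n≡m , tr) | yes refl = n≡m , snd tr at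
    hist-sndNode (snd b c) {char b'} at _ refl (n≡m , tr) | no _     = n≡m
    hist-sndNode (snd b c) {bang}    at _ refl (n≡m , tr) = cong suc n≡m , refl

    hist-rcvNode : ∀ {d} n {l q s r} → nd d ≡ n → isSnd n ≡ false → nodeNext n l ≡ just q → Hist (core d) s r → Hist q s (segStep r l)
    hist-rcvNode (rcv t) {char b} at _ refl (n≡m , tr) = n≡m , rcv tr at
    hist-rcvNode (rcv t) {bang}   at _ refl (n≡m , tr) = cong suc (sym n≡m) , refl

    hist-snd : ∀ {p l q s r} → sends p ≡ true → next p l ≡ just q → Hist p s r → Hist q (segStep s l) r
    hist-snd {core d} {l} out eq hist = hist-sndNode (nd d) {l} refl out eq hist
    hist-snd {err _} {char b} out refl hist = hist
    hist-snd {err _} {bang}   out refl hist = cong suc hist , refl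
    hist-snd {flush} {char b} out refl hist = hist
    hist-snd {flush} {bang}   out refl (m≡ , refl) = sym m≡ , []

    hist-rcv : ∀ {p l q s r} → sends p ≡ false → next p l ≡ just q → Hist p s r → Hist q s (segStep r l)
    hist-rcv {core d} {l} out eq hist = hist-rcvNode (nd d) {l} refl out eq hist
    hist-rcv {errBang} {char b} out refl hist = hist
    hist-rcv {errBang} {bang}   out refl (n≡ , refl) = n≡ , []

  module F₀ = Completion.SendFirst node home₀
  module F₁ = Completion.SendFirst (echoNode {γ}) home
  module H₀ = History node home₀
  module H₁ = History (echoNode {γ}) home
  open Joint F₀.machine F₁.machine

  record Inv (x : Config) : Set where
    constructor inv
    field
      sent₀ received₀ sent₁ received₁ : Word γ
      hist₀ : H₀.Hist (p₀ x) (seg sent₀) (seg received₀)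
      hist₁ : H₁.Hist (p₁ x) (seg sent₁) (seg received₁)
      flow₀ : sent₀ ≡ received₁ ++ xα x
      flow₁ : sent₁ ≡ received₀ ++ xβ x

  preserve : ∀ {x y} → x ↦ y → Inv x → Inv y
  preserve (send₀ {q = q} {l = l} out eq) (inv s₀ r₀ s₁ r₁ h₀ h₁ f₀ f₁) = inv (s₀ ∷ʳ l) r₀ s₁ r₁
    (subst (λ s → H₀.Hist q s (seg r₀)) (sym (seg-∷ʳ s₀ l)) (H₀.hist-snd {l = l} out eq h₀)) h₁
    (trans (cong (_∷ʳ l) f₀) (++-assoc r₁ _ _)) f₁
  preserve (send₁ {q = q} {l = l} out eq) (inv s₀ r₀ s₁ r₁ h₀ h₁ f₀ f₁) = inv s₀ r₀ (s₁ ∷ʳ l) r₁ h₀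
    (subst (λ s → H₁.Hist q s (seg r₁)) (sym (seg-∷ʳ s₁ l)) (H₁.hist-snd {l = l} out eq h₁))
    f₀ (trans (cong (_∷ʳ l) f₁) (++-assoc r₀ _ _))
  preserve (recv₀ {q = q} {l = l} out eq) (inv s₀ r₀ s₁ r₁ h₀ h₁ f₀ f₁) = inv s₀ (r₀ ∷ʳ l) s₁ r₁
    (subst (H₀.Hist q (seg s₀)) (sym (seg-∷ʳ r₀ l)) (H₀.hist-rcv {l = l} out eq h₀)) h₁
    f₀ (trans f₁ (sym (∷ʳ-++ r₀ l _)))
  preserve (recv₁ {q = q} {l = l} out eq) (inv s₀ r₀ s₁ r₁ h₀ h₁ f₀ f₁) = inv s₀ r₀ s₁ (r₁ ∷ʳ l) h₀
    (subst (H₁.Hist q (seg s₁)) (sym (seg-∷ʳ r₁ l)) (H₁.hist-rcv {l = l} out eq h₁))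
    (trans f₀ (sym (∷ʳ-++ r₁ l _))) f₁

  -- Counting bangs shows that a deadlock can only happen with both machines on their core.
  dead⇒stuck : ∀ p₀ p₁ {x y} → F₀.sends p₀ ≡ false → F₁.sends p₁ ≡ false → H₀.Hist p₀ x y → H₁.Hist p₁ y x → Stuck
  dead⇒stuck (F₀.core c) (F₁.core e) {n , s} {m , r} out₀ out₁ (_ , tr₀) (_ , tr₁)
    with s≡r
    where
    -- With empty channels each segment was both sent by one machine and received by the other; an
    -- echo that holds no letter has sent back all that it received.
    s≡r : s ≡ r
    s≡r = chars-injective s r (trans (echo-trace tr₁) (trans (cong (chars r ++_) (proj₂ (echo-rcv {e} out₁))) (++-identityʳ _)))
  ... | refl with trace-run s [] [] tr₀ (++-identityʳ s) (++-identityʳ s) | rcv-node {c} out₀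
  ... | inj₁ stuck            | _      = stuck
  ... | inj₂ (u , eq , steps) | t , at with ++-identityʳ-unique s eq
  ... | refl = c , t , at , steps
  dead⇒stuck (F₀.core c) F₁.errBang  _ _ (eq , _) (eq' , _) = contradiction (trans eq eq') (m≢1+n+m _ {0})
  dead⇒stuck F₀.errBang  (F₁.core e) _ _ (eq , _) (eq' , _) = contradiction (trans eq' eq) (m≢1+n+m _ {0})
  dead⇒stuck F₀.errBang  F₁.errBang  _ _ (eq , _) (eq' , _) = contradiction (trans eq (cong suc eq')) (m≢1+n+m _ {1})

  neverDead : ¬ Stuck → NeverDead
  neverDead ¬stuck x steps dead = ¬stuck (dying x dead (invariant Inv preserve steps (inv [] [] [] [] (refl , []) (refl , []) refl refl)))
    where
    dying : ∀ x → Dead x → Inv x → Stuck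
    dying ⟨ p , q ∣ .[] , .[] ⟩ (out₀ , out₁ , refl , refl) (inv s₀ r₀ s₁ r₁ h₀ h₁ f₀ f₁)
      rewrite trans f₀ (++-identityʳ r₁) | trans f₁ (++-identityʳ r₀) = dead⇒stuck p q out₀ out₁ h₀ h₁

module RecvFirstAnalysis {γ : ℕ} {C : Set} (node : C → Node γ C) (home₀ : C)
  (rank : C → ℕ) (R : ℕ) (rank≤R : ∀ c → rank c ≤ R)
  (rank-snd : ∀ {c b q} → node c ≡ snd b q → rank q < rank c) (limit : Analysis.QLimited node home₀) where

  open Analysis node home₀

  module Stalling {D : Set} (nd : D → Node γ D) (h : D) where

    open Completion.RecvFirst nd h

    data Stalled : State → Set where
      err       : ∀ b → Stalled (err b)
      errBang   : Stalled errBang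
      waitClose : Stalled waitClose
      wait      : Stalled wait

    stalled-silent : ∀ {p} → Stalled p → sends p ≢ true
    stalled-silent (err b)   ()
    stalled-silent errBang   ()
    stalled-silent waitClose ()
    stalled-silent wait      ()

    stalled-step : ∀ {p l q} → Stalled p → l ≢ dollar → next p l ≡ just q → Stalled q
    stalled-step {l = char _} (err b)   _ refl = err b
    stalled-step {l = bang}   (err b)   _ refl = wait
    stalled-step {l = char _} errBang   _ refl = errBang
    stalled-step {l = bang}   errBang   _ refl = waitClose
    stalled-step {l = dollar} waitClose p refl = contradiction refl p
    stalled-step {l = dollar} wait      p refl = contradiction refl p

    snd-outcome : ∀ n l {p} → isSnd n ≡ true → nodeNext n l ≡ just p →
                  (∃₂ λ b d → n ≡ snd b d × l ≡ char b × p ≡ core d) ⊎ (Stalled p × l ≢ dollar)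
    snd-outcome (snd b d) (char b') _ eq with b' Fin.≟ b
    snd-outcome (snd b d) (char b') _ refl | yes refl = inj₁ (b , d , refl , refl , refl)
    snd-outcome (snd b d) (char b') _ refl | no _     = inj₂ (err b' , λ ())
    snd-outcome (snd b d) bang      _ refl = inj₂ (errBang , λ ())

    rcv-outcome : ∀ n l {p} → isSnd n ≡ false → nodeNext n l ≡ just p →
                  (∃₂ λ b t → n ≡ rcv t × l ≡ char b × p ≡ core (t b)) ⊎ (Stalled p × l ≡ bang)
    rcv-outcome (rcv t) (char b) _ refl = inj₁ (b , t , refl , refl , refl)
    rcv-outcome (rcv t) bang     _ refl = inj₂ (wait , refl)

  module F₀ = Completion.RecvFirst node home₀
  module F₁ = Completion.RecvFirst (echoNode {γ}) home
  module S₀ = Stalling node home₀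
  module S₁ = Stalling (echoNode {γ}) home
  open Joint F₀.machine F₁.machine

  -- At the first wrong letter the channels hold at most `suc B` letters: the queue and that letter.
  -- Each gets weight at most `suc R`, for itself and for the at most `R` letters that `F₀` may send
  -- after reading it.
  B K : ℕ
  B = proj₁ limit
  K = suc B * suc R

  NoDollar : Word γ → Set
  NoDollar = All (_≢ dollar)

  -- The index bounds the number of letters that `F₀` can send before it next reads.
  data Alive : F₀.State → ℕ → Set where
    core    : ∀ c → Alive (F₀.core c) (rank c)
    stalled : ∀ {p} → S₀.Stalled p → Alive p 0

  -- In `left` the control has stalled and the echo still works; in `right` the echo has stalled,
  -- and the control runs on or has stalled too. As no `dollar` is in the channels, a stalled
  -- machine remains so.
  data Inv : Config → Set where
    sync  : ∀ {c e xα xβ} → Sync c e xα xβ → Inv ⟨ F₀.core c , F₁.core e ∣ xα , xβ ⟩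
    left  : ∀ {p e xα xβ} → S₀.Stalled p → NoDollar xα → NoDollar xβ →
            length xβ + (length (pending e) + length xα) ≤ suc B → Inv ⟨ p , F₁.core e ∣ xα , xβ ⟩
    -- Once the echo has stalled, every letter left in β lets F₀ send at most R more letters.
    right : ∀ {p q n xα xβ} → Alive p n → S₁.Stalled q → NoDollar xα → NoDollar xβ →
            length xα + (length xβ * suc R + n) ≤ K → Inv ⟨ p , q ∣ xα , xβ ⟩

  length-∷ʳ : ∀ {A : Set} (xs : List A) x → length (xs ∷ʳ x) ≡ suc (length xs)
  length-∷ʳ xs x = trans (length-++ xs) (+-comm (length xs) 1)

  noDollar-chars : ∀ u {xs} → chars u ≡ xs → NoDollar xs
  noDollar-chars []      refl = []
  noDollar-chars (b ∷ u) refl = (λ ()) ∷ noDollar-chars u refl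

  sync-noDollar : ∀ {c e xα xβ} → Sync c e xα xβ → NoDollar xα × NoDollar xβ
  sync-noDollar {e = e} {xβ = xβ} (synced u same _) = ++⁻ʳ (pending e) (++⁻ʳ xβ all) , ++⁻ˡ xβ all
    where
    all : NoDollar _
    all = noDollar-chars u same

  scale : ∀ a b n {k} → b + a ≤ k → a + (b * suc R + n) ≤ k * suc R + n
  scale a b n {k} le = begin
    a + (b * suc R + n)         ≡⟨ +-assoc a _ n ⟨
    a + b * suc R + n           ≤⟨ +-monoˡ-≤ n (+-monoˡ-≤ (b * suc R) (m≤m*n a (suc R))) ⟩
    a * suc R + b * suc R + n   ≡⟨ cong (_+ n) (*-distribʳ-+ (suc R) a b) ⟨
    (a + b) * suc R + n         ≤⟨ +-monoˡ-≤ n (*-monoˡ-≤ (suc R) (≤-trans (≤-reflexive (+-comm a b)) le)) ⟩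
    k * suc R + n               ∎
    where open ≤-Reasoning

  -- A send puts one letter into `α` and is paid for by the drop of the rank.
  pay : ∀ {A : Set} (xs : List A) x k {m n} → m < n → length (xs ∷ʳ x) + (k + m) ≤ length xs + (k + n)
  pay xs x k {m} lt = ≤-trans
    (≤-reflexive (trans (cong (_+ (k + m)) (length-∷ʳ xs x)) (trans (sym (+-suc _ _)) (cong (length xs +_) (sym (+-suc k m))))))
    (+-monoʳ-≤ (length xs) (+-monoʳ-≤ k lt))

  -- A letter read from `β` sets `suc R` free, which covers whatever rank is reached.
  use : ∀ a k {m n} → m ≤ R → a + (k * suc R + m) ≤ a + (suc k * suc R + n)
  use a k {m} {n} le = +-monoʳ-≤ a (≤-trans (+-monoʳ-≤ (k * suc R) (m≤n⇒m≤1+n le))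
    (≤-trans (≤-reflexive (+-comm _ (suc R))) (m≤m+n _ n)))

  preserve : ∀ {x y} → x ↦ y → Inv x → Inv y
  preserve (send₀ {l = l} out eq) (sync {c} {e} {xα} {xβ} s) with S₀.snd-outcome (node c) l out eq
  ... | inj₁ (b , d , at , refl , refl) = sync (sync-snd₀ at s)
  ... | inj₂ (st , l≢) = left st (++⁺ (proj₁ (sync-noDollar s)) (l≢ ∷ [])) (proj₂ (sync-noDollar s))
    (≤-trans (≤-reflexive longer) (s≤s (sync-length limit s)))
    where
    longer : length xβ + (length (pending e) + length (xα ∷ʳ l)) ≡ suc (length xβ + (length (pending e) + length xα))
    longer = trans (cong (length xβ +_) (trans (cong (length (pending e) +_) (length-∷ʳ xα l)) (+-suc _ _))) (+-suc _ _)
  preserve (recv₀ {l = l} out eq) (sync {c} s) with S₀.rcv-outcome (node c) l out eq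
  ... | inj₁ (b , t , at , refl , refl) with sync-rcv₀ at s
  ... | .b , refl , s' = sync s'
  -- A synchronised queue contains ordinary letters only, so no `bang` can be read.
  preserve (recv₀ {l = l} out eq) (sync {c} s) | inj₂ (st , refl) with rcv-node {c} out
  ... | t , at with sync-rcv₀ at s
  ... | b , () , s'
  preserve (send₁ {l = l} out eq) (sync {c} {e} {xα} {xβ} s) with S₁.snd-outcome (echoNode e) l out eq | echo-snd {e} out
  ... | inj₁ (b , d , refl , refl , refl) | .b , refl = sync (sync-snd₁ s)
  -- The wrong letter takes the place of the one that the echo was holding, so the total is still at
  -- most `B`; the extra `suc R` in `K` covers the rank of `c`.
  ... | inj₂ (st , l≢) | b , refl = right (core c) st (proj₁ (sync-noDollar s)) (++⁺ (proj₂ (sync-noDollar s)) (l≢ ∷ []))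
    (≤-trans (scale (length xα) _ (rank c) (≤-trans (≤-reflexive moved) (sync-length limit s)))
      (≤-trans (+-monoʳ-≤ (B * suc R) (m≤n⇒m≤1+n (rank≤R c))) (≤-reflexive (+-comm (B * suc R) (suc R)))))
    where
    moved : length (xβ ∷ʳ l) + length xα ≡ length xβ + suc (length xα)
    moved = trans (cong (_+ length xα) (length-∷ʳ xβ l)) (sym (+-suc _ _))
  preserve (recv₁ {l = l} out eq) (sync {c} {e} s) with echo-rcv {e} out
  ... | at , _ with sync-rcv₁ at s | S₁.rcv-outcome (echoNode e) l out eq
  ... | b , refl , s' | inj₂ (_ , ())
  ... | b , refl , s' | inj₁ (.b , t , at' , refl , refl) with refl ← trans (sym at) at' = sync s'
  preserve (send₀ out eq) (left st ndα ndβ le) = contradiction out (S₀.stalled-silent st)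
  preserve (recv₀ {l = l} out eq) (left st ndα (l≢ ∷ ndβ) le) = left (S₀.stalled-step {l = l} st l≢ eq) ndα ndβ (≤-trans (n≤1+n _) le)
  preserve (send₁ {l = l} out eq) (left {p} {e} {xα} {xβ} st ndα ndβ le) with S₁.snd-outcome (echoNode e) l out eq | echo-snd {e} out
  ... | inj₁ (b , d , refl , refl , refl) | .b , refl = left st ndα (++⁺ ndβ ((λ ()) ∷ []))
    (≤-trans (≤-reflexive (trans (cong (_+ length xα) (length-∷ʳ xβ l)) (sym (+-suc _ _)))) le)
  ... | inj₂ (st' , l≢) | b , refl = right (stalled st) st' ndα (++⁺ ndβ (l≢ ∷ []))
    (≤-trans (scale (length xα) _ 0 (≤-trans (≤-reflexive (trans (cong (_+ length xα) (length-∷ʳ xβ l)) (sym (+-suc _ _)))) le))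
      (≤-reflexive (+-identityʳ K)))
  preserve (recv₁ {l = l} out eq) (left {p} {e} {_} {xβ} st (l≢ ∷ ndα) ndβ le)
    with echo-rcv {e} out
  ... | at , empty with S₁.rcv-outcome (echoNode e) l out eq
  ... | inj₁ (b , t , at' , refl , refl) with refl ← trans (sym at) at' =
    left st ndα ndβ (subst (λ x → length xβ + (length x + _) ≤ suc B) empty le)
  ... | inj₂ (st' , refl) = right (stalled st) st' ndα ndβ
    (≤-trans (scale _ (length xβ) 0 (≤-trans (+-monoʳ-≤ (length xβ) (≤-trans (n≤1+n _) (m≤n+m _ (length (pending e))))) le)) (≤-reflexive (+-identityʳ K)))
  preserve (send₀ {l = l} out eq) (right {xα = xα} {xβ} (core c) st ndα ndβ le) with S₀.snd-outcome (node c) l out eq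
  ... | inj₁ (b , d , at , refl , refl) = right (core d) st (++⁺ ndα ((λ ()) ∷ [])) ndβ (≤-trans (pay xα l (length xβ * suc R) (rank-snd at)) le)
  -- A wrong letter, too, is sent at a node of positive rank, which pays for it as the index falls
  -- to 0.
  ... | inj₂ (st₀ , l≢) with node c in at
  ... | snd b d = right (stalled st₀) st (++⁺ ndα (l≢ ∷ [])) ndβ (≤-trans (pay xα l (length xβ * suc R) (≤-<-trans z≤n (rank-snd at))) le)
  preserve (send₀ out eq) (right (stalled st₀) st ndα ndβ le) = contradiction out (S₀.stalled-silent st₀)
  preserve (recv₀ {xα = xα} {l = l} out eq) (right {xβ = _ ∷ xβ} (core c) st ndα (l≢ ∷ ndβ) le) with S₀.rcv-outcome (node c) l out eq
  ... | inj₁ (b , t , at , refl , refl) = right (core (t b)) st ndα ndβ (≤-trans (use (length xα) (length xβ) (rank≤R (t b))) le)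
  ... | inj₂ (st₀ , _) = right (stalled st₀) st ndα ndβ (≤-trans (use (length xα) (length xβ) z≤n) le)
  preserve (recv₀ {xα = xα} {l = l} out eq) (right {xβ = _ ∷ xβ} (stalled st₀) st ndα (l≢ ∷ ndβ) le) =
    right (stalled (S₀.stalled-step {l = l} st₀ l≢ eq)) st ndα ndβ
      (≤-trans (+-monoʳ-≤ (length xα) (+-monoˡ-≤ 0 (m≤n+m (length xβ * suc R) (suc R)))) le)
  preserve (send₁ out eq) (right al st ndα ndβ le) = contradiction out (S₁.stalled-silent st)
  preserve (recv₁ {l = l} out eq) (right al st (l≢ ∷ ndα) ndβ le) =
    right al (S₁.stalled-step {l = l} st l≢ eq) ndα ndβ (≤-trans (n≤1+n _) le)

  bound : ∀ {x} → Inv x → length (xα x) + length (xβ x) ≤ K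
  bound (sync {c} {e} {xα} {xβ} s) = ≤-trans (≤-reflexive (+-comm (length xα) (length xβ)))
    (≤-trans (+-monoʳ-≤ (length xβ) (m≤n+m (length xα) (length (pending e))))
    (≤-trans (sync-length limit s) (≤-trans (n≤1+n B) (m≤m*n (suc B) (suc R)))))
  bound (left {p} {e} {xα} {xβ} _ _ _ le) = ≤-trans (≤-reflexive (+-comm (length xα) (length xβ)))
    (≤-trans (+-monoʳ-≤ (length xβ) (m≤n+m (length xα) (length (pending e)))) (≤-trans le (m≤m*n (suc B) (suc R))))
  bound (right {xα = xα} {xβ} _ _ _ _ le) =
    ≤-trans (+-monoʳ-≤ (length xα) (≤-trans (m≤m*n (length xβ) (suc R)) (m≤m+n _ _))) le

  limited : Limited
  limited = K , λ x steps → bound (invariant Inv preserve steps (sync (synced [] refl ε)))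

-- The echo and the control as cores, and the outcomes of the queue run.

∷ʳ≢[] : ∀ {A : Set} (xs : List A) {x} → xs ∷ʳ x ≢ []
∷ʳ≢[] []       ()
∷ʳ≢[] (_ ∷ xs) ()

-- With at least two letters, each letter is wrong at some send state.
echo-isCore : ∀ {γ} → IsCore (echoNode {2 + γ}) home
echo-isCore = record
  { rank      = λ { (pend _) → 1 ; _ → 0 }
  ; rank-snd  = λ { {pend b} refl → s≤s z≤n }
  ; reach     = λ { home → ε ; idle → rcv zero refl ◅ snd {c = pend zero} refl ◅ ε ; (pend b) → rcv b refl ◅ ε }
  ; fresh-snd = λ { {pend b} refl () }
  ; fresh-rcv = λ { {home} b refl () ; {idle} b refl () }
  ; wrongAt   = λ { zero → pend (suc zero) , suc zero , idle , refl , (λ ()) ; (suc b) → pend zero , zero , idle , refl , (λ ()) }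
  ; writing   = pend zero , zero , idle , refl
  ; reading   = home , pend , refl
  }

module Facts (K : ℕ) (P : Prog) (o : ℕ) (drain : Bool) (w : ℕ) where

  open QueueMachine K
  open Machine K P o drain
  open Chain K P o drain w
  open Analysis node (base home) using (Stuck; QLimited; QUnlimited)

  data Waiting : Core → Set where
    quiet   : Waiting quiet
    await   : ∀ ℓ → Waiting (await ℓ)
    drained : ∀ t → Waiting (drained t)

  rotate-target : ∀ {X : Set} (A : X → Set) a {self exit} → A self → A exit → ∀ b → A (proj₂ (proj₂ (rotate a self exit b)))
  rotate-target A a s e b with b Fin.≟ hash
  ... | yes _ = e
  ... | no _  = s

  search-target : ∀ {X : Set} (A : X → Set) i {self found exit} → A self → A found → A exit → ∀ b →
                  A (proj₂ (proj₂ (search i self found exit b)))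
  search-target A i s f e b with b Fin.≟ hash | b Fin.≟ reg i
  ... | yes _ | _     = e
  ... | no _  | yes _ = f
  ... | no _  | no _  = s

  rule-target : ∀ Q {X : Set} (A : X → Set) {ι exit} → (∀ ℓ → A (ι ℓ)) → A exit → ∀ ℓ b → A (proj₂ (proj₂ (rule Q ι exit ℓ b)))
  rule-target skip       A s e ℓ                = rotate-target A blank (s ℓ) e
  rule-target (inc i)    A s e ℓ                = rotate-target A (reg i) (s ℓ) e
  rule-target (Q ⨟ Q')   A s e (inj₁ ℓ)         = rule-target Q A (λ ℓ → s (inj₁ ℓ)) (s _) ℓ
  rule-target (Q ⨟ Q')   A s e (inj₂ ℓ)         = rule-target Q' A (λ ℓ → s (inj₂ ℓ)) e ℓ
  rule-target (loop i Q) A s e (inj₁ tt)        = search-target A i (s _) (s _) e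
  rule-target (loop i Q) A s e (inj₂ (inj₁ tt)) = rotate-target A blank (s _) (s _)
  rule-target (loop i Q) A s e (inj₂ (inj₂ ℓ))  = rule-target Q A (λ ℓ → s (inj₂ (inj₂ ℓ))) (s _) ℓ

  after-waiting : ∀ d {f : T d → Core} {c} → (∀ t → Waiting (f t)) → Waiting c → Waiting (after d f c)
  after-waiting true  fw cw = fw tt
  after-waiting false fw cw = cw

  target-waiting : ∀ ℓ b → Waiting (proj₂ (proj₂ (action ℓ b)))
  target-waiting (inj₁ ℓ) b = rule-target P Waiting (λ ℓ → await (inj₁ ℓ)) (await test) ℓ b
  target-waiting test     b = search-target Waiting o (await test) (await final) quiet b
  target-waiting final    b = after-waiting drain drained (await final)

  -- The number of sends before the next read. From `home` these are its own letter, one for each of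
  -- the `w` links, and the end marker.
  rank : C → ℕ
  rank (base home)       = 2 + w
  rank (base bottom)     = 1
  rank (base (out₁ _ _)) = 2
  rank (base (out₂ _ _)) = 1
  rank (base (echo _))   = 1
  rank (base _)          = 0
  rank (link k)          = 2 + toℕ k

  rank-bound : ∀ c → rank c ≤ 2 + w
  rank-bound (base home)        = ≤-refl
  rank-bound (base bottom)      = s≤s z≤n
  rank-bound (base quiet)       = z≤n
  rank-bound (base (await _))   = z≤n
  rank-bound (base (out₁ _ _))  = s≤s (s≤s z≤n)
  rank-bound (base (out₂ _ _))  = s≤s z≤n
  rank-bound (base (echo _))    = s≤s z≤n
  rank-bound (base (drained _)) = z≤n
  rank-bound (link k)           = s≤s (s≤s (<⇒≤ (Fin.toℕ<n k)))

  waiting-rank : ∀ {c} → Waiting c → rank (base c) < 1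
  waiting-rank quiet       = s≤s z≤n
  waiting-rank (await _)   = s≤s z≤n
  waiting-rank (drained _) = s≤s z≤n

  top-rank : ∀ {w'} → w' ≡ w → rank (topLink w (base bottom) inj₂) < 2 + w
  top-rank {zero}   refl = s≤s (s≤s z≤n)
  top-rank {suc w'} refl = s≤s (s≤s (s≤s (≤-reflexive (Fin.toℕ-fromℕ w'))))

  rank-snd : ∀ {c b q} → node c ≡ snd b q → rank q < rank c
  rank-snd {base home}       refl = top-rank refl
  rank-snd {base bottom}     refl = s≤s z≤n
  rank-snd {base (out₁ _ _)} refl = s≤s (s≤s z≤n)
  rank-snd {base (out₂ ℓ b)} refl = waiting-rank (target-waiting ℓ b)
  rank-snd {base (echo _)}   refl = s≤s z≤n
  rank-snd {link zero}       refl = s≤s (s≤s z≤n)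
  rank-snd {link (suc k)}    refl = s≤s (s≤s (s≤s (≤-reflexive (Fin.toℕ-inject₁ k))))

  waiting≢home : ∀ {c} → Waiting c → _≢_ {A = C} (base c) (base home)
  waiting≢home quiet ()
  waiting≢home (await _) ()
  waiting≢home (drained _) ()

  top≢home : ∀ w → topLink {Core ⊎ Fin w} w (base bottom) inj₂ ≢ base home
  top≢home zero    ()
  top≢home (suc _) ()

  fresh-snd : ∀ {c b q} → node c ≡ snd b q → q ≢ base home
  fresh-snd {base home}       refl = top≢home w
  fresh-snd {base bottom}     refl = λ ()
  fresh-snd {base (out₁ _ _)} refl = λ ()
  fresh-snd {base (out₂ ℓ b)} refl = waiting≢home (target-waiting ℓ b)
  fresh-snd {base (echo _)}   refl = λ ()
  fresh-snd {link zero}       refl = λ ()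
  fresh-snd {link (suc k)}    refl = λ ()

  fresh-rcv : ∀ {c t} b → node c ≡ rcv t → t b ≢ base home
  fresh-rcv {base quiet}       b refl = λ ()
  fresh-rcv {base (await _)}   b refl = λ ()
  fresh-rcv {base (drained _)} b refl = λ ()

  _⟿_ : C → C → Set
  _⟿_ = Star (CoreEdge node)

  hop : ∀ {ℓ b a c t} → action ℓ b ≡ (a , c , t) → base (await ℓ) ⟿ base t
  hop {ℓ} {b} {t = t} eq = rcv b refl ◅ snd {c = base (out₁ ℓ b)} refl ◅ snd {c = base (out₂ ℓ b)} refl
    ◅ subst (λ x → base (proj₂ (proj₂ (action ℓ b))) ⟿ base x) (cong {A = Γ × Γ × Core} (λ x → proj₂ (proj₂ x)) eq) ε

  -- Reachability in the diagram, where any letter may be read, so halting plays no part: `hash`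
  -- leads out of a block, and the letter of the register leads into the body of a loop.
  labels : ∀ Q (κ : Lab Q → Label) exit → (∀ ℓ b → action (κ ℓ) b ≡ rule Q (await ∘ κ) exit ℓ b) →
           (∀ ℓ → base (await (κ (start Q))) ⟿ base (await (κ ℓ))) × base (await (κ (start Q))) ⟿ base exit
  labels skip       κ exit rules = (λ _ → ε) , hop (rules tt hash)
  labels (inc i)    κ exit rules = (λ _ → ε) , hop (rules tt hash)
  labels (Q ⨟ Q')   κ exit rules with labels Q (κ ∘ inj₁) _ (λ ℓ → rules (inj₁ ℓ)) | labels Q' (κ ∘ inj₂) exit (λ ℓ → rules (inj₂ ℓ))
  ... | all , out | all' , out' = (λ { (inj₁ ℓ) → all ℓ ; (inj₂ ℓ) → out ◅◅ all' ℓ }) , out ◅◅ out'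
  labels (loop i Q) κ exit rules with labels Q (κ ∘ inj₂ ∘ inj₂) _ (λ ℓ → rules (inj₂ (inj₂ ℓ)))
  ... | all , _ = (λ { (inj₁ tt) → ε ; (inj₂ (inj₁ tt)) → enter ; (inj₂ (inj₂ ℓ)) → enter ◅◅ hop (rules (inj₂ (inj₁ tt)) hash) ◅◅ all ℓ })
      , hop (rules (inj₁ tt) hash)
    where
    enter : base (await (κ (inj₁ tt))) ⟿ base (await (κ (inj₂ (inj₁ tt))))
    enter = hop (trans (rules (inj₁ tt) (reg i)) (search-found i _ _ exit))

  reach-links : ∀ {w'} → w' ≡ w → (∀ k → base home ⟿ link k) × base home ⟿ base bottom
  reach-links {zero}   refl = (λ ()) , snd refl ◅ ε
  reach-links {suc w'} refl = all , all zero ◅◅ snd refl ◅ ε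
    where
    all : ∀ k → base home ⟿ link k
    all = >-weakInduction (λ k → base home ⟿ link k) (snd refl ◅ ε) (λ i path → path ◅◅ snd refl ◅ ε)

  reach-label : ∀ ℓ → base home ⟿ base (await ℓ)
  reach-label = λ { (inj₁ ℓ) → begin ◅◅ proj₁ block ℓ ; test → tested ; final → tested ◅◅ hop (search-found o _ _ quiet) }
    where
    block : _
    block = labels P inj₁ (await test) (λ _ _ → refl)
    begin : base home ⟿ base (await (inj₁ (start P)))
    begin = proj₂ (reach-links refl) ◅◅ snd refl ◅ ε
    tested : base home ⟿ base (await test)
    tested = begin ◅◅ proj₂ block

  reach : ∀ c → base home ⟿ c
  reach (base home)        = ε
  reach (base bottom)      = proj₂ (reach-links refl)
  reach (base quiet)       = reach-label test ◅◅ hop {b = hash} refl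
  reach (base (await ℓ))   = reach-label ℓ
  reach (base (out₁ ℓ b))  = reach-label ℓ ◅◅ rcv b refl ◅ ε
  reach (base (out₂ ℓ b))  = reach-label ℓ ◅◅ rcv b refl ◅ snd {c = base (out₁ ℓ b)} refl ◅ ε
  reach (base (echo b))    = reach-label test ◅◅ hop {b = hash} refl ◅◅ rcv b refl ◅ ε
  reach (base (drained t)) = reach-label final ◅◅ hop {b = zero} (cong (λ c → blank , zero , c) (after-drain t))
  reach (link k)           = proj₁ (reach-links refl) k

  isCore : IsCore node (base home)
  isCore = record
    { rank      = rank
    ; rank-snd  = λ {c} → rank-snd {c}
    ; reach     = reach
    ; fresh-snd = λ {c} → fresh-snd {c}
    ; fresh-rcv = λ {c} → fresh-rcv {c}
    ; wrongAt   = λ { zero → base bottom , hash , _ , refl , (λ ()) ; (suc b) → base home , zero , _ , refl , (λ ()) }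
    ; writing   = base home , zero , _ , refl
    ; reading   = base quiet , _ , refl
    }

  -- The length bounds the channels; the nonempty queue in `quiet` rules out a deadlock.
  data Quiet (n : ℕ) : C × List Γ → Set where
    quiet : ∀ {b u} → length (b ∷ u) ≤ n → Quiet n (base quiet , b ∷ u)
    echo  : ∀ {b u} → suc (length u) ≤ n → Quiet n (base (echo b) , u)

  quiet-step : ∀ {n x y} → x ⇛ y → Quiet n x → Quiet n y
  quiet-step (rcv refl) (quiet le) = echo le
  quiet-step {n} (snd refl) (echo {b} {[]}    le) = quiet le
  quiet-step {n} (snd refl) (echo {b} {a ∷ u} le) = quiet (≤-trans (≤-reflexive (cong suc (trans (length-++ u) (+-comm (length u) 1)))) le)

  quiet-length : ∀ {n x} → Quiet n x → length (proj₂ x) ≤ n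
  quiet-length (quiet le) = le
  quiet-length (echo le)  = ≤-trans (n≤1+n _) le

  module _ (settling : Settles) where

    v : List Γ
    v = proj₁ settling

    silence : (base home , []) ⇛* (base quiet , v ∷ʳ hash)
    silence = proj₂ settling

    settled : ∀ u → Quiet (length (u ∷ʳ hash)) (base quiet , u ∷ʳ hash)
    settled []      = quiet ≤-refl
    settled (b ∷ u) = quiet ≤-refl

    quiet⇒limited : QLimited
    quiet⇒limited = Deterministic.bounded QStep-deterministic (length ∘ proj₂) silence
      (λ x steps → quiet-length (invariant (Quiet _) quiet-step steps (settled v)))

    -- There is only one run. A stuck configuration after the quiet one contradicts the invariant
    -- `Quiet`; one before it has no successor, so the quiet one could not be reached.
    quiet⇒notStuck : ¬ Stuck
    quiet⇒notStuck (c , t , at , steps) with Deterministic.comparable QStep-deterministic silence steps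
    ... | inj₁ steps' with invariant (Quiet _) quiet-step steps' (settled v) | at
    ... | echo _ | ()
    quiet⇒notStuck (c , t , at , steps) | inj₂ steps' = backward steps' refl
      where
      backward : ∀ {y} → (c , []) ⇛* y → y ≢ (base quiet , v ∷ʳ hash)
      backward ε            eq = ∷ʳ≢[] v (sym (cong proj₂ eq))
      backward (snd at' ◅ _) eq with () ← trans (sym at) at'

  -- Without `drained` every receive state is entered by writing a letter, so the queue is nonempty
  -- there, whether or not the program halts. This yields the promise of (b).
  grow⇒notStuck : ¬ T drain → ¬ Stuck
  grow⇒notStuck ¬t (c , t , at , steps) = invariant Filled filled-step steps (λ ()) at refl
    where
    Filled : C × List Γ → Set
    Filled (c , u) = ∀ {t} → node c ≡ rcv t → u ≢ []
    filled-step : ∀ {x y} → x ⇛ y → Filled x → Filled y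
    filled-step (snd {u = u} at) filled at' = ∷ʳ≢[] u
    filled-step (rcv {base quiet} refl) filled ()
    filled-step (rcv {base (await ℓ)} refl) filled ()
    filled-step (rcv {base (drained t)} refl) filled = contradiction t ¬t

  grow⇒unlimited : ¬ T drain → Finishes → QUnlimited
  grow⇒unlimited ¬t ([] , steps) n with grows ¬t n blank []
  ... | u , steps' , le = _ , steps ◅◅ steps' , le
  grow⇒unlimited ¬t (b ∷ v , steps) n with grows ¬t n b (v ∷ʳ blank)
  ... | u , steps' , le = _ , steps ◅◅ steps' , le

  drain⇒stuck : T drain → Finishes → Stuck
  drain⇒stuck t (v , steps) = base (drained t) , _ , refl , steps ◅◅ drains t v blank

-- Presenting abstract machines by finite state machines.

module _ {γ : ℕ} where

  view : Fin (γ + 2) → Letter γ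
  view c with splitAt γ c
  ... | inj₁ b          = char b
  ... | inj₂ zero       = bang
  ... | inj₂ (suc zero) = dollar

  enc : Letter γ → Fin (γ + 2)
  enc (char b) = b ↑ˡ 2
  enc bang     = γ ↑ʳ zero
  enc dollar   = γ ↑ʳ suc zero

  view-enc : ∀ l → view (enc l) ≡ l
  view-enc (char b) rewrite Fin.splitAt-↑ˡ γ b 2 = refl
  view-enc bang     rewrite Fin.splitAt-↑ʳ γ 2 zero = refl
  view-enc dollar   rewrite Fin.splitAt-↑ʳ γ 2 (suc zero) = refl

  enc-view : ∀ c → enc (view c) ≡ c
  enc-view c with splitAt γ c in eq
  ... | inj₁ b          = Fin.splitAt⁻¹-↑ˡ eq
  ... | inj₂ zero       = Fin.splitAt⁻¹-↑ʳ eq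
  ... | inj₂ (suc zero) = Fin.splitAt⁻¹-↑ʳ eq

  views : List (Fin (γ + 2)) → Word γ
  views = List.map view

  encs : Word γ → List (Fin (γ + 2))
  encs = List.map enc

  encs-views : ∀ x → encs (views x) ≡ x
  encs-views x = trans (sym (map-∘ x)) (trans (map-cong enc-view x) (map-id x))

view-suc : ∀ {g} c → view {suc g} (suc c) ≢ char zero
view-suc {g} c eq = case trans (sym (enc-view {suc g} (suc c))) (cong enc eq) of λ ()

Edge : ∀ {γ} (M : Mach γ) → Mach.State M → Action (γ + 2) (γ + 2) → Mach.State M → Set
Edge M p (send c) q = Mach.sends M p ≡ true × Mach.next M p (view c) ≡ just q
Edge M p (recv c) q = Mach.sends M p ≡ false × Mach.next M p (view c) ≡ just q

-- An interface instead of one construction, because the transitions of `F₁` are listed generically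
-- while those of `F₀` have to follow the order in which its code is computed.
record Presents {γ : ℕ} (F : FSM (γ + 2) (γ + 2)) (M : Mach γ) : Set where
  open FSM F using (State; init; _—[_]→_)
  field
    to       : Mach.State M → State
    from     : State → Mach.State M
    from-to  : ∀ s → from (to s) ≡ s
    to-from  : ∀ p → to (from p) ≡ p
    init-to  : init ≡ to (Mach.initial M)
    sound    : ∀ {p e q} → p —[ e ]→ q → Edge M (from p) e (from q)
    complete : ∀ {p e q} → Edge M (from p) e (from q) → p —[ e ]→ q

  complete' : ∀ {s e t} → Edge M s e t → to s —[ e ]→ to t
  complete' {s} {e} {t} edge = complete (subst₂ (λ s t → Edge M s e t) (sym (from-to s)) (sym (from-to t)) edge)

module Transfer {γ : ℕ} {F : FSM (γ + 2) (γ + 2)} {M : Mach γ} (presents : Presents F M) where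

  open FSM F hiding (trans)
  open Mach M using (sends; next; _⇢_; Path; []; snd; rcv)
  open Presents presents

  encode : Mach.State M → Letter γ → Action (γ + 2) (γ + 2)
  encode p l with sends p
  ... | true  = send (enc l)
  ... | false = recv (enc l)

  edge : ∀ {p l q} → next p l ≡ just q → Edge M p (encode p l) q
  edge {p} {l} eq with sends p in out
  ... | true  = out , trans (cong (next p) (view-enc l)) eq
  ... | false = out , trans (cong (next p) (view-enc l)) eq

  walk : ∀ {p q} → Star _⇢_ p q → ∃ λ w → to p —[ w ]↠ to q
  walk ε              = [] , []
  walk ((l , eq) ◅ s) with walk s
  ... | w , path = _ , complete' (edge {l = l} eq) ∷ path

  isSRMachine : (∀ p q → Star _⇢_ p q) → IsSRMachine F
  isSRMachine connected = record
    { sendOrReceive     = kind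
    ; stronglyConnected = λ p q → subst₂ (λ p q → ∃ λ w → p —[ w ]↠ q) (to-from p) (to-from q) (walk (connected (from p) (from q)))
    ; deterministic     = λ {p} {e} {q₁} {q₂} t₁ t₂ → trans (sym (to-from q₁)) (trans (cong to (functional e (sound t₁) (sound t₂))) (to-from q₂))
    }
    where
    kind : ∀ p → SendState p ⊎ ReceiveState p
    kind p with sends (from p) in out
    ... | true  = inj₁ λ b q t → case trans (sym out) (proj₁ (sound t)) of λ ()
    ... | false = inj₂ λ b q t → case trans (sym out) (proj₁ (sound t)) of λ ()
    functional : ∀ {p q₁ q₂} e → Edge M p e q₁ → Edge M p e q₂ → q₁ ≡ q₂
    functional (send c) (_ , eq₁) (_ , eq₂) = just-injective (trans (sym eq₁) eq₂)
    functional (recv c) (_ , eq₁) (_ , eq₂) = just-injective (trans (sym eq₁) eq₂)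

  noSendCycle : (rank : Mach.State M → ℕ) → (∀ {p l q} → sends p ≡ true → next p l ≡ just q → rank q < rank p) → ¬ HasSendCycle
  noSendCycle rank decreases (p , []    , w≢[] , _ , _)    = w≢[] refl
  noSendCycle rank decreases (p , e ∷ w , _ , sends , path) = <-irrefl refl (falls path sends)
    where
    stays : ∀ {p w q} → p —[ w ]↠ q → All IsSend w → rank (from q) ≤ rank (from p)
    falls : ∀ {p e w q} → p —[ e ∷ w ]↠ q → All IsSend (e ∷ w) → rank (from q) < rank (from p)
    stays []         []             = ≤-refl
    stays (t ∷ path) (s ∷ sends)    = <⇒≤ (falls (t ∷ path) (s ∷ sends))
    falls (t ∷ path) (send b ∷ sends) = ≤-<-trans (stays path sends) (decreases {l = view b} (proj₁ (sound t)) (proj₂ (sound t)))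

  trace : ∀ {p w q} → p —[ w ]↠ q → Path (from p) (views (sent w)) (views (received w)) (from q)
  trace []                       = []
  trace (_∷_ {e = send b} t path) = snd (proj₁ (sound t)) (proj₂ (sound t)) (trace path)
  trace (_∷_ {e = recv b} t path) = rcv (proj₁ (sound t)) (proj₂ (sound t)) (trace path)

  untrace : ∀ {p s r q} → Path p s r q → ∃ λ w → to p —[ w ]↠ to q × sent w ≡ encs s × received w ≡ encs r
  untrace [] = [] , [] , refl , refl
  untrace {p} (snd {l = l} out eq path) with untrace path
  ... | w , path' , s , r = send (enc l) ∷ w , complete' (out , trans (cong (next p) (view-enc l)) eq) ∷ path' , cong (enc l ∷_) s , r
  untrace {p} (rcv {l = l} out eq path) with untrace path
  ... | w , path' , s , r = recv (enc l) ∷ w , complete' (out , trans (cong (next p) (view-enc l)) eq) ∷ path' , s , cong (enc l ∷_) r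

  loops : ∀ {x y} → (∃ λ w → init —[ w ]↠ init × sent w ≡ x × received w ≡ y) ⇔ Path (Mach.initial M) (views x) (views y) (Mach.initial M)
  loops {x} {y} = mk⇔
    (λ { (w , path , refl , refl) → subst (λ s → Path s _ _ s) (trans (cong from init-to) (from-to _)) (trace path) })
    (λ path → case untrace path of λ { (w , path' , s , r) →
      w , subst (λ p → p —[ w ]↠ p) (sym init-to) path' , trans s (encs-views x) , trans r (encs-views y) })

module TransferPair {γ : ℕ} {F₀ F₁ : FSM (γ + 2) (γ + 2)} {M₀ M₁ : Mach γ} (pr₀ : Presents F₀ M₀) (pr₁ : Presents F₁ M₁)
  (live₀ : ∀ p → Mach.sends M₀ p ≡ true → ∃₂ λ l q → Mach.next M₀ p l ≡ just q)
  (live₁ : ∀ p → Mach.sends M₁ p ≡ true → ∃₂ λ l q → Mach.next M₁ p l ≡ just q) where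

  pairOf : Pair
  pairOf = record { mα = γ + 2 ; mβ = γ + 2 ; F₀ = F₀ ; F₁ = F₁ }

  open Pair pairOf hiding (F₀; F₁; module F₀; module F₁)
  open Joint M₀ M₁ hiding (⟨_,_∣_,_⟩; p₀; p₁; xα; xβ)
  module J = Joint M₀ M₁
  module R₀ = Presents pr₀
  module R₁ = Presents pr₁

  abs : Global → Config
  abs ⟨ p , q ∣ xα , xβ ⟩ = J.⟨ R₀.from p , R₁.from q ∣ views xα , views xβ ⟩

  conc : Config → Global
  conc J.⟨ p , q ∣ xα , xβ ⟩ = ⟨ R₀.to p , R₁.to q ∣ encs xα , encs xβ ⟩

  abs-step : ∀ {s t} → s ⟶ t → abs s ↦ abs t
  abs-step (send₀ {xα = xα} {b = b} t) rewrite map-++ view xα (b ∷ []) = send₀ (proj₁ (R₀.sound t)) (proj₂ (R₀.sound t))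
  abs-step (send₁ {xβ = xβ} {b = b} t) rewrite map-++ view xβ (b ∷ []) = send₁ (proj₁ (R₁.sound t)) (proj₂ (R₁.sound t))
  abs-step (recv₀ t) = recv₀ (proj₁ (R₀.sound t)) (proj₂ (R₀.sound t))
  abs-step (recv₁ t) = recv₁ (proj₁ (R₁.sound t)) (proj₂ (R₁.sound t))

  conc-step : ∀ {s t} → s ↦ t → conc s ⟶ conc t
  conc-step (send₀ {p = p} {xα = xα} {l = l} out eq) rewrite map-++ enc xα (l ∷ []) = send₀ (R₀.complete' (out , trans (cong (Mach.next M₀ p) (view-enc l)) eq))
  conc-step (send₁ {p = p} {xβ = xβ} {l = l} out eq) rewrite map-++ enc xβ (l ∷ []) = send₁ (R₁.complete' (out , trans (cong (Mach.next M₁ p) (view-enc l)) eq))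
  conc-step (recv₀ {p = p} {l = l} out eq) = recv₀ (R₀.complete' (out , trans (cong (Mach.next M₀ p) (view-enc l)) eq))
  conc-step (recv₁ {p = p} {l = l} out eq) = recv₁ (R₁.complete' (out , trans (cong (Mach.next M₁ p) (view-enc l)) eq))

  abs-reachable : ∀ {s} → Reachable s → start₀₁ ↦* abs s
  abs-reachable {s} steps = subst (_↦* abs s) (cong₂ (λ p q → J.⟨ p , q ∣ [] , [] ⟩)
    (trans (cong R₀.from R₀.init-to) (R₀.from-to _)) (trans (cong R₁.from R₁.init-to) (R₁.from-to _))) (gmap abs abs-step steps)

  conc-reachable : ∀ {c} → start₀₁ ↦* c → Reachable (conc c)
  conc-reachable {c} steps = subst (λ s → Star _⟶_ s (conc c)) (cong₂ (λ p q → ⟨ p , q ∣ [] , [] ⟩) (sym R₀.init-to) (sym R₁.init-to))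
    (gmap conc conc-step steps)

  -- A sending state without edges would satisfy `ReceiveState` vacuously; `live` excludes it.
  receiving : ∀ {F M} (pr : Presents {γ} F M) → (∀ p → Mach.sends M p ≡ true → ∃₂ λ l q → Mach.next M p l ≡ just q) →
              ∀ p → FSM.ReceiveState F p → Mach.sends M (Presents.from pr p) ≡ false
  receiving {F} {M} pr live p rec with Mach.sends M (Presents.from pr p) in out
  ... | false = refl
  ... | true with live _ out
  ... | l , q , eq = contradiction
    (subst (λ s → FSM._—[_]→_ F s (send (enc l)) (Presents.to pr q)) (Presents.to-from pr p)
      (Presents.complete' pr (out , trans (cong (Mach.next M _) (view-enc l)) eq))) (rec _ _)

  silent : ∀ {F M} (pr : Presents {γ} F M) → ∀ s → Mach.sends M s ≡ false → FSM.ReceiveState F (Presents.to pr s)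
  silent {F} {M} pr s out b q t = case trans (sym out) (trans (cong (Mach.sends M) (sym (Presents.from-to pr s))) (proj₁ (Presents.sound pr t))) of λ ()

  deadlockFree : NeverDead ⇔ DeadlockFree pairOf
  deadlockFree = mk⇔
    (λ { never s@(⟨ p , q ∣ xα , xβ ⟩) steps dead → never (abs s) (abs-reachable steps)
        ( receiving pr₀ live₀ p (Deadlocked.receive₀ dead) , receiving pr₁ live₁ q (Deadlocked.receive₁ dead)
        , cong views (Deadlocked.emptyα dead) , cong views (Deadlocked.emptyβ dead)) })
    (λ { free c@(J.⟨ p , q ∣ xα , xβ ⟩) steps (out₀ , out₁ , eα , eβ) → free (conc c) (conc-reachable steps)
        (record { receive₀ = silent pr₀ p out₀ ; receive₁ = silent pr₁ q out₁ ; emptyα = cong encs eα ; emptyβ = cong encs eβ }) })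

  boundedChannels : Limited ⇔ BoundedChannels pairOf
  boundedChannels = mk⇔
    (λ { (B , limit) → B , λ { s@(⟨ p , q ∣ xα , xβ ⟩) steps →
        subst (_≤ B) (cong₂ _+_ (length-map view xα) (length-map view xβ)) (limit (abs s) (abs-reachable steps)) } })
    (λ { (B , limit) → B , λ { c@(J.⟨ p , q ∣ xα , xβ ⟩) steps →
        subst (_≤ B) (cong₂ _+_ (length-map enc xα) (length-map enc xβ)) (limit (conc c) (conc-reachable steps)) } })

  affine : (∀ {s r} → Mach.Path M₀ (Mach.initial M₀) s r (Mach.initial M₀) ⇔ Mach.Path M₁ (Mach.initial M₁) r s (Mach.initial M₁)) →
           Affine pairOf
  affine same (x , y) = mk⇔
    (λ z → swap₁ (Equivalence.from (Transfer.loops pr₁) (Equivalence.to same (Equivalence.to (Transfer.loops pr₀) z))))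
    (λ z → Equivalence.from (Transfer.loops pr₀) (Equivalence.from same (Equivalence.to (Transfer.loops pr₁) (swap₁ z))))
    where
    swap₁ : ∀ {A : Set} {B C D : A → Set} → (∃ λ w → B w × C w × D w) → ∃ λ w → B w × D w × C w
    swap₁ (w , b , c , d) = w , b , d , c

-- Descending, because primitive recursion conses the item of the last index in front.
down : ∀ n → List (Fin n)
down n = tabulate Fin.opposite

∈-down : ∀ {n} (k : Fin n) → k ∈ down n
∈-down {n} k = subst (_∈ down n) (Fin.opposite-involutive k) (∈-tabulate⁺ (Fin.opposite k))

map-toℕ-down : ∀ n → List.map toℕ (down n) ≡ downFrom n
map-toℕ-down zero    = refl
map-toℕ-down (suc n) = cong₂ _∷_ (Fin.toℕ-fromℕ n) (trans
  (trans (map-tabulate _ toℕ) (trans (tabulate-cong (λ i → Fin.toℕ-inject₁ (Fin.opposite i))) (sym (map-tabulate Fin.opposite toℕ))))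
  (map-toℕ-down n))

act : ∀ {m} → Bool → Fin m → Action m m
act true  = send
act false = recv

module Listing {n m : ℕ} (sends : Fin n → Bool) (next : Fin n → Fin m → Maybe (Fin n)) where

  edges : Fin n → Fin m → List (Fin n × Action m m × Fin n)
  edges p c = maybe′ (λ q → (p , act (sends p) c , q) ∷ []) [] (next p c)

  listing : List (Fin n × Action m m × Fin n)
  listing = concatMap (λ p → concatMap (edges p) (allFin m)) (allFin n)

  ∈-listing⁺ : ∀ {p c q} → next p c ≡ just q → (p , act (sends p) c , q) ∈ listing
  ∈-listing⁺ {p} {c} {q} eq = ∈-concatMap⁺ (λ p → concatMap (edges p) (allFin m))
    (lose (∈-allFin p) (∈-concatMap⁺ (edges p) (lose (∈-allFin c) (member eq))))
    where
    member : next p c ≡ just q → (p , act (sends p) c , q) ∈ edges p c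
    member eq rewrite eq = here refl

  ∈-listing⁻ : ∀ {p e q} → (p , e , q) ∈ listing → ∃ λ c → e ≡ act (sends p) c × next p c ≡ just q
  ∈-listing⁻ {p} {e} {q} mem with find (∈-concatMap⁻ (λ p → concatMap (edges p) (allFin m)) {xs = allFin n} mem)
  ... | p' , _ , mem' with find (∈-concatMap⁻ (edges p') {xs = allFin m} mem')
  ... | c , _ , mem″ = member mem″
    where
    member : (p , e , q) ∈ edges p' c → ∃ λ c → e ≡ act (sends p) c × next p c ≡ just q
    member mem with next p' c in eq
    member (here refl) | just _ = c , refl , eq

map-just⁻ : ∀ {A B : Set} (f : A → B) x {y} → Maybe.map f x ≡ just y → ∃ λ a → x ≡ just a × f a ≡ y
map-just⁻ f (just a) refl = a , refl , refl

module _ {γ} {M : Mach γ} where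

  edge⁺ : ∀ {p c q} → Mach.next M p (view c) ≡ just q → Edge M p (act (Mach.sends M p) c) q
  edge⁺ {p} eq with Mach.sends M p in out
  ... | true  = out , eq
  ... | false = out , eq

  edge⁻ : ∀ {p q} e → Edge M p e q → ∃ λ c → e ≡ act (Mach.sends M p) c × Mach.next M p (view c) ≡ just q
  edge⁻ (send c) (out , eq) rewrite out = c , refl , eq
  edge⁻ (recv c) (out , eq) rewrite out = c , refl , eq

module _ {γ : ℕ} (M : Mach γ) {n : ℕ} (iso : Mach.State M ↔ Fin n) where

  open Mach M
  open Inverse iso using (to; from; strictlyInverseˡ; strictlyInverseʳ)
  open Listing (λ p → sends (from p)) (λ p c → Maybe.map to (next (from p) (view c)))

  listedFSM : FSM (γ + 2) (γ + 2)
  listedFSM = record { size = n ; init = to initial ; trans = listing }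

  listed-presents : Presents listedFSM M
  listed-presents = record
    { to = to ; from = from ; from-to = strictlyInverseʳ ; to-from = strictlyInverseˡ ; init-to = refl
    ; sound = sound ; complete = complete }
    where
    open FSM listedFSM using (_—[_]→_)
    sound : ∀ {p e q} → p —[ e ]→ q → Edge M (from p) e (from q)
    sound {p} mem with ∈-listing⁻ mem
    ... | c , refl , eq with map-just⁻ to (next (from p) (view c)) eq
    ... | s , eq' , refl = edge⁺ {M = M} (trans eq' (cong just (sym (strictlyInverseʳ s))))
    complete : ∀ {p e q} → Edge M (from p) e (from q) → p —[ e ]→ q
    complete {p} {e} {q} edge with edge⁻ {M = M} e edge
    ... | c , refl , eq = ∈-listing⁺ (trans (cong (Maybe.map to) eq) (cong just (strictlyInverseˡ q)))

-- The code of the pair as a function of the length of the chain.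

onto : List ℕ → ℕ → ℕ
onto xs t = foldr (λ x a → suc (pair x a)) t xs

-- Allows the chain and the template to be coded separately: the code of the template is the tail on
-- which the links are put.
onto-++ : ∀ xs ys t → onto (xs ++ ys) t ≡ onto xs (onto ys t)
onto-++ xs ys t = foldr-++ (λ x a → suc (pair x a)) t xs ys

actionCode : ∀ {o i} → Action o i → ℕ
actionCode (send b) = pair 0 (toℕ b)
actionCode (recv b) = pair 1 (toℕ b)

edgeCode : ∀ {n o i} → Fin n × Action o i × Fin n → ℕ
edgeCode (p , e , q) = pair (toℕ p) (pair (actionCode e) (toℕ q))

codeFSM-pair : ∀ {o i} (F : FSM o i) → let open FSM F renaming (trans to edges) in
               codeFSM F ≡ pair size (pair (toℕ init) (onto (List.map edgeCode edges) 0))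
codeFSM-pair F = ⟪⟫≡pair refl (⟪⟫≡pair refl (list _ (λ (p , e , q) → ⟪⟫≡pair refl (⟪⟫≡pair (action e) refl)) (FSM.trans F)))
  where
  action : ∀ e → codeAction e ≡ actionCode e
  action (send b) = ⟪⟫≡pair refl refl
  action (recv b) = ⟪⟫≡pair refl refl
  list : ∀ f → (∀ t → f t ≡ edgeCode t) → ∀ ts → codeList (List.map f ts) ≡ onto (List.map edgeCode ts) 0
  list f eq []       = refl
  list f eq (t ∷ ts) = cong suc (⟪⟫≡pair (eq t) (list f eq ts))

onto-wrongs : ∀ l p t → onto (List.map (λ (c , s) → codeEdge p c s) (List.map (λ j → suc j , 2 + j) (downFrom l))) t ≡ wrongCode l p t
onto-wrongs zero    p t = refl
onto-wrongs (suc l) p t = cong (λ a → suc (pair (codeEdge p (suc l) (2 + l)) a)) (onto-wrongs l p t)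

linkCodes : ℕ → ℕ → ℕ → List ℕ
linkCodes n l k = codeEdge (suc (n + k)) 0 (n + k) ∷
  List.map (λ (c , s) → codeEdge (suc (n + k)) c s) (List.map (λ j → suc j , 2 + j) (downFrom l))

onto-links : ∀ w n l t → onto (concatMap (linkCodes n l) (downFrom w)) t ≡ chainCode w n l t
onto-links zero    n l t = refl
onto-links (suc w) n l t = trans (onto-++ (linkCodes n l w) _ t)
  (cong (λ a → suc (pair (codeEdge (suc (n + w)) 0 (n + w)) a))
    (trans (onto-wrongs l (suc (n + w)) _) (cong (wrongCode l (suc (n + w))) (onto-links w n l t))))

-- F₀ with an empty chain; the edge from the initial state into the chain is left out of its code.
record Template (g : ℕ) : Set₁ where
  field
    base : Mach (suc g)
    {n}  : ℕ
    iso  : Mach.State base ↔ Fin (suc n)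
  open Mach base using (State; initial; sends; next)
  open Inverse iso using (to; from) public
  field
    initial-0     : to initial ≡ zero
    initial-sends : sends initial ≡ true
    bottom        : State
    bottom-n      : toℕ (to bottom) ≡ n
    wrongs        : List (Fin (suc g + 2) × State)
    {l}           : ℕ
    wrong-numbers : List.map (λ (c , s) → toℕ c , toℕ (to s)) wrongs ≡ List.map (λ j → suc j , 2 + j) (downFrom l)

  baseNext : Fin (suc n) → Fin (suc g + 2) → Maybe (Fin (suc n))
  baseNext zero zero = nothing
  baseNext p    c    = Maybe.map to (next (from p) (view c))

  module Base = Listing (λ p → sends (from p)) baseNext

  baseCode : ℕ
  baseCode = onto (List.map edgeCode Base.listing) 0

-- All edges of template states are independent of `w` except the one of the initial state on
-- `char zero`, which leads to the top of the chain; `next-entry` treats it apart from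
-- `next-initial`.
record Chained {g : ℕ} (𝕋 : Template g) (w : ℕ) (M : Mach (suc g)) : Set where
  open Template 𝕋
  module B = Mach base
  open Mach M
  field
    lift          : B.State → State
    link          : Fin w → State
    split         : State → B.State ⊎ Fin w
    split-lift    : ∀ s → split (lift s) ≡ inj₁ s
    split-link    : ∀ k → split (link k) ≡ inj₂ k
    unsplit       : ∀ s → [ lift , link ]′ (split s) ≡ s
    initial-lift  : initial ≡ lift B.initial
    sends-lift    : ∀ s → sends (lift s) ≡ B.sends s
    sends-link    : ∀ k → sends (link k) ≡ true
    next-entry    : next (lift B.initial) (char zero) ≡ just (topLink w (lift bottom) link)
    next-initial  : ∀ l → l ≢ char zero → next (lift B.initial) l ≡ Maybe.map lift (B.next B.initial l)
    next-lift     : ∀ s l → s ≢ B.initial → next (lift s) l ≡ Maybe.map lift (B.next s l)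
    next-link     : ∀ k → next (link k) (char zero) ≡ just (predLink (lift bottom) link k)
    wrong-sound   : ∀ k {c s} → (c , s) ∈ wrongs → next (link k) (view c) ≡ just (lift s)
    wrong-complete : ∀ k c {p} → next (link k) (view (suc c)) ≡ just p → ∃ λ s → p ≡ lift s × (suc c , s) ∈ wrongs

module Hardwire {g w : ℕ} {𝕋 : Template g} {M : Mach (suc g)} (chained : Chained 𝕋 w M) where

  open Template 𝕋
  open Inverse iso using (strictlyInverseˡ; strictlyInverseʳ)
  open Chained chained
  open Mach M

  number : State → Fin (suc n + w)
  number s = [ (λ b → to b ↑ˡ w) , suc n ↑ʳ_ ]′ (split s)

  state : Fin (suc n + w) → State
  state p = [ lift ∘ from , link ]′ (splitAt (suc n) p)

  number-lift : ∀ s → number (lift s) ≡ to s ↑ˡ w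
  number-lift s = cong [ (λ b → to b ↑ˡ w) , suc n ↑ʳ_ ]′ (split-lift s)

  number-link : ∀ k → number (link k) ≡ suc n ↑ʳ k
  number-link k = cong [ (λ b → to b ↑ˡ w) , suc n ↑ʳ_ ]′ (split-link k)

  state-↑ˡ : ∀ p → state (p ↑ˡ w) ≡ lift (from p)
  state-↑ˡ p = cong [ lift ∘ from , link ]′ (Fin.splitAt-↑ˡ (suc n) p w)

  state-↑ʳ : ∀ k → state (suc n ↑ʳ k) ≡ link k
  state-↑ʳ k = cong [ lift ∘ from , link ]′ (Fin.splitAt-↑ʳ (suc n) w k)

  state-number : ∀ s → state (number s) ≡ s
  state-number s with split s | unsplit s
  ... | inj₁ b | refl = trans (state-↑ˡ (to b)) (cong lift (strictlyInverseʳ b))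
  ... | inj₂ k | refl = state-↑ʳ k

  number-state : ∀ p → number (state p) ≡ p
  number-state p with splitAt (suc n) p in eq
  ... | inj₁ b = trans (number-lift (from b)) (trans (cong (_↑ˡ w) (strictlyInverseˡ b)) (Fin.splitAt⁻¹-↑ˡ eq))
  ... | inj₂ k = trans (number-link k) (Fin.splitAt⁻¹-↑ʳ eq)

  top : State
  top = topLink w (lift bottom) link

  below : Fin w → State
  below = predLink (lift bottom) link

  Transition : Set
  Transition = Fin (suc n + w) × Action (suc g + 2) (suc g + 2) × Fin (suc n + w)

  entry : Transition
  entry = zero , send zero , number top

  wrongEdge : Fin w → Fin (suc g + 2) × B.State → Transition
  wrongEdge k (c , s) = suc n ↑ʳ k , send c , to s ↑ˡ w

  linkEdges : Fin w → List Transition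
  linkEdges k = (suc n ↑ʳ k , send zero , number (below k)) ∷ List.map (wrongEdge k) wrongs

  inject : Fin (suc n) × Action (suc g + 2) (suc g + 2) × Fin (suc n) → Transition
  inject (p , e , q) = p ↑ˡ w , e , q ↑ˡ w

  fsm : FSM (suc g + 2) (suc g + 2)
  fsm = record
    { size  = suc n + w
    ; init  = zero
    -- The order prescribed by `hardwiredCode`: the part that does not depend on `w` comes last, as
    -- the tail `t`.
    ; trans = entry ∷ concatMap linkEdges (down w) ++ List.map inject Base.listing
    }

  open FSM fsm using (_—[_]→_)

  from-0 : from zero ≡ B.initial
  from-0 = trans (cong from (sym initial-0)) (strictlyInverseʳ B.initial)

  edge-lift : ∀ {s c t} → next (lift s) (view c) ≡ just t → Edge M (lift s) (act (B.sends s) c) t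
  edge-lift {s} {c} eq = subst (λ d → Edge M (lift s) (act d c) _) (sends-lift s) (edge⁺ {M = M} eq)

  from-suc : ∀ p → from (suc p) ≢ B.initial
  from-suc p eq = case trans (sym (strictlyInverseˡ (suc p))) (trans (cong to eq) initial-0) of λ ()

  baseNext-suc : ∀ p c → baseNext (suc p) c ≡ Maybe.map to (B.next (from (suc p)) (view c))
  baseNext-suc p zero    = refl
  baseNext-suc p (suc c) = refl

  sound-base : ∀ p c {q} → baseNext p c ≡ just q → next (lift (from p)) (view c) ≡ just (lift (from q))
  sound-base zero (suc c) {q} eq with map-just⁻ to (B.next (from zero) (view (suc c))) eq
  ... | s , eq' , refl = trans (cong (λ s → next (lift s) (view (suc c))) from-0)
    (trans (next-initial (view (suc c)) (view-suc c)) (cong (Maybe.map lift)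
      (trans (cong (λ s → B.next s (view (suc c))) (sym from-0)) (trans eq' (cong just (sym (strictlyInverseʳ s)))))))
  sound-base (suc p) c {q} eq with map-just⁻ to (B.next (from (suc p)) (view c)) (trans (sym (baseNext-suc p c)) eq)
  ... | s , eq' , refl = trans (next-lift _ (view c) (from-suc p)) (cong (Maybe.map lift) (trans eq' (cong just (sym (strictlyInverseʳ s)))))

  sound : ∀ {p e q} → p —[ e ]→ q → Edge M (state p) e (state q)
  sound (here refl) = trans (cong (sends ∘ lift) from-0) (trans (sends-lift _) initial-sends)
    , trans (cong (λ s → next (lift s) (char zero)) from-0) (trans next-entry (cong just (sym (state-number top))))
  sound (there mem) with ∈-++⁻ (concatMap linkEdges (down w)) mem
  ... | inj₁ mem' with find (∈-concatMap⁻ linkEdges {xs = down w} mem')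
  ... | k , _ , here refl = trans (cong sends (state-↑ʳ k)) (sends-link k)
    , trans (cong (λ s → next s (char zero)) (state-↑ʳ k)) (trans (next-link k) (cong just (sym (state-number (below k)))))
  ... | k , _ , there mem″ with ∈-map⁻ (wrongEdge k) mem″
  ... | (c , s) , wrong , refl = trans (cong sends (state-↑ʳ k)) (sends-link k)
    , trans (cong (λ s → next s (view c)) (state-↑ʳ k)) (trans (wrong-sound k wrong)
        (cong just (sym (trans (state-↑ˡ (to s)) (cong lift (strictlyInverseʳ s))))))
  sound (there mem) | inj₂ mem' with ∈-map⁻ inject mem'
  ... | (p , e , q) , mem″ , refl with Base.∈-listing⁻ mem″
  ... | c , refl , eq = subst₂ (λ s t → Edge M s (act (B.sends (from p)) c) t) (sym (state-↑ˡ p)) (sym (state-↑ˡ q))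
    (edge-lift {c = c} (sound-base p c eq))

  complete-link : ∀ k c {t} → next (link k) (view c) ≡ just t → (suc n ↑ʳ k , send c , number t) ∈ linkEdges k
  complete-link k zero eq with refl ← trans (sym (next-link k)) eq = here refl
  complete-link k (suc c) eq with wrong-complete k c eq
  ... | s , refl , wrong = there (subst (λ q → (suc n ↑ʳ k , send (suc c) , q) ∈ List.map (wrongEdge k) wrongs) (sym (number-lift s))
    (∈-map⁺ (wrongEdge k) wrong))

  complete-listed : ∀ p c {t} → Maybe.map lift (B.next (from p) (view c)) ≡ just t →
                    baseNext p c ≡ Maybe.map to (B.next (from p) (view c)) →
                    (p ↑ˡ w , act (B.sends (from p)) c , number t) ∈ FSM.trans fsm
  complete-listed p c eq listed with map-just⁻ lift (B.next (from p) (view c)) eq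
  ... | s , eq' , refl = there (∈-++⁺ʳ (concatMap linkEdges (down w))
    (subst (λ q → (p ↑ˡ w , _ , q) ∈ List.map inject Base.listing) (sym (number-lift s))
      (∈-map⁺ inject (Base.∈-listing⁺ {p} {c} (trans listed (cong (Maybe.map to) eq'))))))

  complete-base : ∀ p c {t} → next (lift (from p)) (view c) ≡ just t →
                  (p ↑ˡ w , act (B.sends (from p)) c , number t) ∈ FSM.trans fsm
  complete-base zero zero {t} eq = subst₂ (λ d q → (zero , act d zero , q) ∈ FSM.trans fsm)
    (sym (trans (cong B.sends from-0) initial-sends))
    (cong number (just-injective (trans (sym next-entry) (trans (cong (λ s → next (lift s) (char zero)) (sym from-0)) eq))))
    (here refl)
  complete-base zero (suc c) eq = complete-listed zero (suc c)
    (trans (cong (λ s → Maybe.map lift (B.next s (view (suc c)))) from-0)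
      (trans (sym (next-initial _ (view-suc c))) (trans (cong (λ s → next (lift s) (view (suc c))) (sym from-0)) eq))) refl
  complete-base (suc p) c eq = complete-listed (suc p) c (trans (sym (next-lift _ (view c) (from-suc p))) eq) (baseNext-suc p c)

  complete : ∀ {p e q} → Edge M (state p) e (state q) → p —[ e ]→ q
  complete {p} {e} {q} edge with edge⁻ {M = M} e edge
  ... | c , refl , eq = subst (λ q → (p , act (sends (state p)) c , q) ∈ FSM.trans fsm) (number-state q) (cases (splitAt (suc n) p) refl)
    where
    cases : ∀ x → splitAt (suc n) p ≡ x → (p , act (sends (state p)) c , number (state q)) ∈ FSM.trans fsm
    cases (inj₁ b) at with refl ← Fin.splitAt⁻¹-↑ˡ {suc n} {w} {p} {b} at =
      subst (λ d → (b ↑ˡ w , act d c , number (state q)) ∈ FSM.trans fsm)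
        (trans (sym (sends-lift (from b))) (cong sends (sym (state-↑ˡ b))))
        (complete-base b c (trans (cong (λ s → next s (view c)) (sym (state-↑ˡ b))) eq))
    cases (inj₂ k) at with refl ← Fin.splitAt⁻¹-↑ʳ {suc n} {w} {p} {k} at =
      subst (λ d → (suc n ↑ʳ k , act d c , number (state q)) ∈ FSM.trans fsm)
        (trans (sym (sends-link k)) (cong sends (sym (state-↑ʳ k))))
        (there (∈-++⁺ˡ (∈-concatMap⁺ linkEdges (lose (∈-down k)
          (complete-link k c (trans (cong (λ s → next s (view c)) (sym (state-↑ʳ k))) eq))))))

  presents : Presents fsm M
  presents = record
    { to = number ; from = state ; from-to = state-number ; to-from = number-state
    ; init-to = sym (trans (cong number initial-lift) (trans (number-lift _) (cong (_↑ˡ w) initial-0)))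
    ; sound = sound ; complete = complete }

  toℕ-lift : ∀ s → toℕ (number (lift s)) ≡ toℕ (to s)
  toℕ-lift s = trans (cong toℕ (number-lift s)) (Fin.toℕ-↑ˡ (to s) w)

  toℕ-link : ∀ k → toℕ (number (link k)) ≡ suc (n + toℕ k)
  toℕ-link k = trans (cong toℕ (number-link k)) (Fin.toℕ-↑ʳ (suc n) k)

  toℕ-bottom : toℕ (number (lift bottom)) ≡ n + 0
  toℕ-bottom = trans (toℕ-lift bottom) (trans bottom-n (sym (+-identityʳ n)))

  toℕ-below : ∀ k → toℕ (number (below k)) ≡ n + toℕ k
  toℕ-below k = go k link toℕ-link
    where
    go : ∀ {w'} (k : Fin w') (link : Fin w' → State) → (∀ k → toℕ (number (link k)) ≡ suc (n + toℕ k)) →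
         toℕ (number (predLink (lift bottom) link k)) ≡ n + toℕ k
    go zero    link eq = toℕ-bottom
    go (suc k) link eq = trans (eq (Fin.inject₁ k)) (trans (cong (λ j → suc (n + j)) (Fin.toℕ-inject₁ k)) (sym (+-suc n (toℕ k))))

  toℕ-top : toℕ (number top) ≡ n + w
  toℕ-top = go w link toℕ-link
    where
    go : ∀ w' (link : Fin w' → State) → (∀ k → toℕ (number (link k)) ≡ suc (n + toℕ k)) →
         toℕ (number (topLink w' (lift bottom) link)) ≡ n + w'
    go zero     link eq = toℕ-bottom
    go (suc w') link eq = trans (eq (Fin.fromℕ w')) (trans (cong (λ j → suc (n + j)) (Fin.toℕ-fromℕ w')) (sym (+-suc n w')))

  code-link : ∀ k → List.map edgeCode (linkEdges k) ≡ linkCodes n l (toℕ k)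
  code-link k = cong₂ _∷_ (cong₂ (λ p q → codeEdge p 0 q) (Fin.toℕ-↑ʳ (suc n) k) (toℕ-below k))
    (trans (sym (map-∘ wrongs)) (trans (map-cong edge wrongs) (trans (map-∘ wrongs) (cong (List.map _) wrong-numbers))))
    where
    edge : ∀ x → edgeCode (wrongEdge k x) ≡ codeEdge (suc (n + toℕ k)) (toℕ (proj₁ x)) (toℕ (to (proj₂ x)))
    edge (c , s) = cong₂ (λ p q → codeEdge p (toℕ c) q) (Fin.toℕ-↑ʳ (suc n) k) (Fin.toℕ-↑ˡ (to s) w)

  code-links : List.map edgeCode (concatMap linkEdges (down w)) ≡ concatMap (linkCodes n l) (downFrom w)
  code-links = trans (map-concatMap edgeCode linkEdges (down w)) (trans (concatMap-cong code-link (down w))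
    (trans (sym (concatMap-map (linkCodes n l) toℕ (down w))) (cong (concatMap (linkCodes n l)) (map-toℕ-down w))))

  code-base : List.map edgeCode (List.map inject Base.listing) ≡ List.map edgeCode Base.listing
  code-base = trans (sym (map-∘ Base.listing)) (map-cong same Base.listing)
    where
    same : ∀ x → edgeCode (inject x) ≡ edgeCode x
    same (p , e , q) = cong₂ (λ i j → pair i (pair (actionCode e) j)) (Fin.toℕ-↑ˡ p w) (Fin.toℕ-↑ˡ q w)

  code-trans : onto (List.map edgeCode (FSM.trans fsm)) 0 ≡ suc (pair (codeEdge 0 0 (n + w)) (chainCode w n l baseCode))
  code-trans = cong suc (cong₂ pair (cong (codeEdge 0 0) toℕ-top) (trans
    (cong (λ xs → onto xs 0) (trans (map-++ edgeCode (concatMap linkEdges (down w)) _) (cong₂ _++_ code-links code-base)))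
    (trans (onto-++ (concatMap (linkCodes n l) (downFrom w)) _ 0) (onto-links w n l baseCode))))

  codePair-hardwired : ∀ F₁ → codePair (record { mα = suc g + 2 ; mβ = suc g + 2 ; F₀ = fsm ; F₁ = F₁ }) ≡
                       hardwiredCode w (suc g + 2) (codeFSM F₁) n l baseCode
  codePair-hardwired F₁ = ⟪⟫≡pair refl (⟪⟫≡pair refl (⟪⟫≡pair
    (trans (codeFSM-pair fsm) (cong (λ t → pair (suc n + w) (pair 0 t)) code-trans)) refl))

-- Numbering the states and assembling the templates.

infixr 3 _⊎ᶠ_
infixr 4 _×ᶠ_

_⊎ᶠ_ : ∀ {A B : Set} {a b} → A ↔ Fin a → B ↔ Fin b → (A ⊎ B) ↔ Fin (a + b)
f ⊎ᶠ g = ↔-trans (f ⊎-↔ g) (↔-sym Fin.+↔⊎)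

_×ᶠ_ : ∀ {A B : Set} {a b} → A ↔ Fin a → B ↔ Fin b → (A × B) ↔ Fin (a * b)
f ×ᶠ g = ↔-trans (f ×-↔ g) (↔-sym Fin.*↔×)

⊤ᶠ : ⊤ ↔ Fin 1
⊤ᶠ = ↔-sym Fin.1↔⊤

Tᶠ : ∀ d → ∃ λ n → T d ↔ Fin n
Tᶠ true  = 1 , ⊤ᶠ
Tᶠ false = 0 , ↔-sym Fin.0↔⊥

Labᶠ : ∀ P → ∃ λ n → Lab P ↔ Fin n
Labᶠ skip       = 1 , ⊤ᶠ
Labᶠ (inc i)    = 1 , ⊤ᶠ
Labᶠ (P ⨟ Q)    = _ , (proj₂ (Labᶠ P) ⊎ᶠ proj₂ (Labᶠ Q))
Labᶠ (loop i P) = _ , (⊤ᶠ ⊎ᶠ ⊤ᶠ ⊎ᶠ proj₂ (Labᶠ P))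

module _ {γ : ℕ} {C : Set} {node : C → Node γ C} {home : C} where

  open Completion node home

  sendFirst↔ : SendFirst.State ↔ (C ⊎ (Fin γ ⊎ ⊤) ⊎ ⊤)
  sendFirst↔ = mk↔ₛ′
    (λ { (core c) → inj₁ c ; (err b) → inj₂ (inj₁ (inj₁ b)) ; errBang → inj₂ (inj₁ (inj₂ tt)) ; flush → inj₂ (inj₂ tt) })
    (λ { (inj₁ c) → core c ; (inj₂ (inj₁ (inj₁ b))) → err b ; (inj₂ (inj₁ (inj₂ tt))) → errBang ; (inj₂ (inj₂ tt)) → flush })
    (λ { (inj₁ c) → refl ; (inj₂ (inj₁ (inj₁ b))) → refl ; (inj₂ (inj₁ (inj₂ tt))) → refl ; (inj₂ (inj₂ tt)) → refl })
    (λ { (core c) → refl ; (err b) → refl ; errBang → refl ; flush → refl })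
    where open SendFirst

  recvFirst↔ : RecvFirst.State ↔ (C ⊎ (Fin γ ⊎ ⊤) ⊎ Fin 4)
  recvFirst↔ = mk↔ₛ′
    (λ { (core c) → inj₁ c ; (err b) → inj₂ (inj₁ (inj₁ b)) ; errBang → inj₂ (inj₁ (inj₂ tt))
       ; waitClose → inj₂ (inj₂ v0) ; wait → inj₂ (inj₂ v1) ; flush → inj₂ (inj₂ v2) ; close → inj₂ (inj₂ v3) })
    (λ { (inj₁ c) → core c ; (inj₂ (inj₁ (inj₁ b))) → err b ; (inj₂ (inj₁ (inj₂ tt))) → errBang
       ; (inj₂ (inj₂ v0)) → waitClose ; (inj₂ (inj₂ v1)) → wait ; (inj₂ (inj₂ v2)) → flush ; (inj₂ (inj₂ v3)) → close })
    (λ { (inj₁ c) → refl ; (inj₂ (inj₁ (inj₁ b))) → refl ; (inj₂ (inj₁ (inj₂ tt))) → refl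
       ; (inj₂ (inj₂ v0)) → refl ; (inj₂ (inj₂ v1)) → refl ; (inj₂ (inj₂ v2)) → refl ; (inj₂ (inj₂ v3)) → refl })
    (λ { (core c) → refl ; (err b) → refl ; errBang → refl ; waitClose → refl ; wait → refl ; flush → refl ; close → refl })
    where open RecvFirst

echo↔ : ∀ {γ} → Echo γ ↔ Fin (1 + (1 + γ))
echo↔ = ↔-trans (mk↔ₛ′
  (λ { home → inj₁ tt ; idle → inj₂ (inj₁ tt) ; (pend b) → inj₂ (inj₂ b) })
  (λ { (inj₁ tt) → home ; (inj₂ (inj₁ tt)) → idle ; (inj₂ (inj₂ b)) → pend b })
  (λ { (inj₁ tt) → refl ; (inj₂ (inj₁ tt)) → refl ; (inj₂ (inj₂ b)) → refl })
  (λ { home → refl ; idle → refl ; (pend b) → refl })) (⊤ᶠ ⊎ᶠ ⊤ᶠ ⊎ᶠ ↔-refl)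

module Assembly (K : ℕ) (P : Prog) (o : ℕ) (drain : Bool) where

  open QueueMachine K
  open Machine K P o drain

  g : ℕ
  g = 3 + K

  -- All core states except `home` and `bottom`, the two whose numbers the code of the chain
  -- mentions.
  Inner : Set
  Inner = ⊤ ⊎ Label ⊎ (Label × Γ) ⊎ (Label × Γ) ⊎ Γ ⊎ T drain

  innerᶠ : ∃ λ n → Inner ↔ Fin n
  innerᶠ = _ , (⊤ᶠ ⊎ᶠ labelᶠ ⊎ᶠ labelᶠ ×ᶠ ↔-refl ⊎ᶠ labelᶠ ×ᶠ ↔-refl ⊎ᶠ ↔-refl ⊎ᶠ proj₂ (Tᶠ drain))
    where
    labelᶠ : Label ↔ Fin _
    labelᶠ = proj₂ (Labᶠ P) ⊎ᶠ ↔-sym Fin.2↔Bool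

  classify : Core → ⊤ ⊎ Inner ⊎ ⊤
  classify home        = inj₁ tt
  classify quiet       = inj₂ (inj₁ (inj₁ tt))
  classify (await ℓ)   = inj₂ (inj₁ (inj₂ (inj₁ ℓ)))
  classify (out₁ ℓ b)  = inj₂ (inj₁ (inj₂ (inj₂ (inj₁ (ℓ , b)))))
  classify (out₂ ℓ b)  = inj₂ (inj₁ (inj₂ (inj₂ (inj₂ (inj₁ (ℓ , b))))))
  classify (echo b)    = inj₂ (inj₁ (inj₂ (inj₂ (inj₂ (inj₂ (inj₁ b))))))
  classify (drained t) = inj₂ (inj₁ (inj₂ (inj₂ (inj₂ (inj₂ (inj₂ t))))))
  classify bottom      = inj₂ (inj₂ tt)

  classified : ∀ x → ∃ λ c → classify c ≡ x
  classified (inj₁ tt) = home , refl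
  classified (inj₂ (inj₁ (inj₁ tt))) = quiet , refl
  classified (inj₂ (inj₁ (inj₂ (inj₁ ℓ)))) = await ℓ , refl
  classified (inj₂ (inj₁ (inj₂ (inj₂ (inj₁ (ℓ , b)))))) = out₁ ℓ b , refl
  classified (inj₂ (inj₁ (inj₂ (inj₂ (inj₂ (inj₁ (ℓ , b))))))) = out₂ ℓ b , refl
  classified (inj₂ (inj₁ (inj₂ (inj₂ (inj₂ (inj₂ (inj₁ b))))))) = echo b , refl
  classified (inj₂ (inj₁ (inj₂ (inj₂ (inj₂ (inj₂ (inj₂ t))))))) = drained t , refl
  classified (inj₂ (inj₂ tt)) = bottom , refl

  classified-classify : ∀ c → proj₁ (classified (classify c)) ≡ c
  classified-classify home        = refl
  classified-classify quiet       = refl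
  classified-classify (await ℓ)   = refl
  classified-classify (out₁ ℓ b)  = refl
  classified-classify (out₂ ℓ b)  = refl
  classified-classify (echo b)    = refl
  classified-classify (drained t) = refl
  classified-classify bottom      = refl

  core↔ : Core ↔ (⊤ ⊎ Inner ⊎ ⊤)
  core↔ = mk↔ₛ′ classify (proj₁ ∘ classified) (proj₂ ∘ classified) classified-classify

  -- Err comes right after home: the states reached by wrong letters get the numbers
  -- that the hardwired chain refers to, and bottom gets the last one.
  layout : ∀ {Err Aux S : Set} {e a} → Err ↔ Fin e → Aux ↔ Fin a → S ↔ ((⊤ ⊎ Inner ⊎ ⊤) ⊎ Err ⊎ Aux) → S ↔ Fin (suc (e + ((a + proj₁ innerᶠ) + 1)))
  layout {Err} {Aux} errᶠ auxᶠ iso = ↔-trans iso (↔-trans reorder (⊤ᶠ ⊎ᶠ errᶠ ⊎ᶠ (auxᶠ ⊎ᶠ proj₂ innerᶠ) ⊎ᶠ ⊤ᶠ))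
    where
    reorder : ((⊤ ⊎ Inner ⊎ ⊤) ⊎ Err ⊎ Aux) ↔ (⊤ ⊎ Err ⊎ (Aux ⊎ Inner) ⊎ ⊤)
    reorder = mk↔ₛ′
      (λ { (inj₁ (inj₁ tt)) → inj₁ tt ; (inj₁ (inj₂ (inj₁ i))) → inj₂ (inj₂ (inj₁ (inj₂ i))) ; (inj₁ (inj₂ (inj₂ tt))) → inj₂ (inj₂ (inj₂ tt))
         ; (inj₂ (inj₁ e)) → inj₂ (inj₁ e) ; (inj₂ (inj₂ a)) → inj₂ (inj₂ (inj₁ (inj₁ a))) })
      (λ { (inj₁ tt) → inj₁ (inj₁ tt) ; (inj₂ (inj₁ e)) → inj₂ (inj₁ e) ; (inj₂ (inj₂ (inj₁ (inj₁ a)))) → inj₂ (inj₂ a)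
         ; (inj₂ (inj₂ (inj₁ (inj₂ i)))) → inj₁ (inj₂ (inj₁ i)) ; (inj₂ (inj₂ (inj₂ tt))) → inj₁ (inj₂ (inj₂ tt)) })
      (λ { (inj₁ tt) → refl ; (inj₂ (inj₁ e)) → refl ; (inj₂ (inj₂ (inj₁ (inj₁ a)))) → refl
         ; (inj₂ (inj₂ (inj₁ (inj₂ i)))) → refl ; (inj₂ (inj₂ (inj₂ tt))) → refl })
      (λ { (inj₁ (inj₁ tt)) → refl ; (inj₁ (inj₂ (inj₁ i))) → refl ; (inj₁ (inj₂ (inj₂ tt))) → refl
         ; (inj₂ (inj₁ e)) → refl ; (inj₂ (inj₂ a)) → refl })

  layout-bottom : ∀ e r → toℕ (1 ↑ʳ (e ↑ʳ (r ↑ʳ zero {0}))) ≡ e + (r + 1)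
  layout-bottom e r = trans (cong suc (trans (Fin.toℕ-↑ʳ e _) (cong (e +_) (Fin.toℕ-↑ʳ r _))))
    (trans (sym (+-suc e (r + 0))) (cong (e +_) (sym (+-suc r 0))))

  errᶠ : (Γ ⊎ ⊤) ↔ Fin (γ + 1)
  errᶠ = ↔-refl ⊎ᶠ ⊤ᶠ

  module _ (w : ℕ) where

    open Chain K P o drain w using (node)

    sends-base : ∀ c → isSnd (node (inj₁ c)) ≡ isSnd (coreNode c)
    sends-base home        = refl
    sends-base bottom      = refl
    sends-base quiet       = refl
    sends-base (await ℓ)   = refl
    sends-base (out₁ ℓ b)  = refl
    sends-base (out₂ ℓ b)  = refl
    sends-base (echo b)    = refl
    sends-base (drained t) = refl

  each : ∀ {A : Letter γ → Set} {B : Set} → (∀ b → A (char b)) → A bang → A dollar → ∀ l → B → A l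
  each c b d (char x) _ = c x
  each c b d bang     _ = b
  each c b d dollar   _ = d

  module PartialTemplate where

    module B = Completion.Partial coreNode home

    pad : ∀ {A : Set} → A ↔ (A ⊎ ⊥ ⊎ ⊥)
    pad = mk↔ₛ′ inj₁ (λ { (inj₁ x) → x ; (inj₂ (inj₁ ())) ; (inj₂ (inj₂ ())) })
      (λ { (inj₁ x) → refl ; (inj₂ (inj₁ ())) ; (inj₂ (inj₂ ())) }) (λ _ → refl)

    template : Template g
    template = record
      { base = B.machine
      ; iso  = layout (↔-sym Fin.0↔⊥) (↔-sym Fin.0↔⊥) (↔-trans core↔ pad)
      ; initial-0 = refl ; initial-sends = refl
      ; bottom = bottom ; bottom-n = layout-bottom 0 _
      -- A send state of the partial completion accepts no wrong letter, which makes `l` equal to 0.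
      ; wrongs = [] ; wrong-numbers = refl {x = []}
      }

    module _ (w : ℕ) where

      open Chain K P o drain w using (node; node-base)
      module M = Completion.Partial node (inj₁ home)

      next-mapNode : ∀ n l → M.nodeNext (mapNode inj₁ n) l ≡ Maybe.map inj₁ (B.nodeNext n l)
      next-mapNode (snd b q) (char b') with b' Fin.≟ b
      ... | yes _ = refl
      ... | no _  = refl
      next-mapNode (snd b q) bang     = refl
      next-mapNode (snd b q) dollar   = refl
      next-mapNode (rcv t)   (char b) = refl
      next-mapNode (rcv t)   bang     = refl
      next-mapNode (rcv t)   dollar   = refl

      chained : Chained template w M.machine
      chained = record
        { lift = inj₁ ; link = inj₂ ; split = λ s → s
        ; split-lift = λ _ → refl ; split-link = λ _ → refl ; unsplit = λ { (inj₁ _) → refl ; (inj₂ _) → refl }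
        ; initial-lift = refl ; sends-lift = sends-base w ; sends-link = λ _ → refl
        ; next-entry = refl
        ; next-initial = λ { (char zero) p → contradiction refl p ; (char (suc b)) p → refl ; bang p → refl ; dollar p → refl }
        ; next-lift = λ s l s≢ → trans (cong (λ n → M.nodeNext n l) (node-base s≢)) (next-mapNode (coreNode s) l)
        ; next-link = λ _ → refl
        ; wrong-sound = λ k ()
        ; wrong-complete = complete
        }
        where
        complete : ∀ k c {p} → M.nodeNext (node (inj₂ k)) (view (suc c)) ≡ just p → ∃ λ s → p ≡ inj₁ s × (suc c , s) ∈ []
        complete k c eq with view {γ} (suc c) in at
        complete k c eq | char zero    = contradiction at (view-suc c)
        complete k c () | char (suc b)
        complete k c () | bang
        complete k c () | dollar

  wrongLetters : ∀ {S : Set} → (Γ → S) → S → List (Fin (γ + 2) × S)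
  wrongLetters err errBang = (enc {γ} bang , errBang) ∷ List.map (λ b → enc {γ} (char (suc b)) , err (suc b)) (down g)

  module WrongLetters {S S' D : Set} (err : Γ → S) (errBang : S) {core' : D → S'} {err' : Γ → S'} {errBang' onBang' : S'} (lift : S → S')
    (err-lift : ∀ b → err' b ≡ lift (err b)) (errBang-lift : errBang' ≡ lift errBang) {q : D} where

    open Total core' err' errBang' onBang'

    sound : ∀ {c s} → (c , s) ∈ wrongLetters err errBang → nodeNext (snd zero q) (view c) ≡ just (lift s)
    sound (here refl) = trans (cong (nodeNext (snd zero q)) (view-enc bang)) (cong just errBang-lift)
    sound (there mem) with ∈-map⁻ (λ b → enc {γ} (char (suc b)) , err (suc b)) {xs = down g} mem
    ... | b , _ , refl = trans (cong (nodeNext (snd zero q)) (view-enc (char (suc b)))) (cong just (err-lift (suc b)))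

    complete : ∀ c {p} → nodeNext (snd zero q) (view (suc c)) ≡ just p → ∃ λ s → p ≡ lift s × (suc c , s) ∈ wrongLetters err errBang
    complete c eq with view {γ} (suc c) in at
    complete c eq   | char zero    = contradiction at (view-suc c)
    complete c refl | char (suc b) = err (suc b) , err-lift (suc b) ,
      subst (λ c → (c , err (suc b)) ∈ wrongLetters err errBang) (trans (cong enc (sym at)) (enc-view {γ} (suc c)))
        (there (∈-map⁺ (λ b → enc {γ} (char (suc b)) , err (suc b)) (∈-down b)))
    complete c refl | bang = errBang , errBang-lift , here (cong (_, errBang) (trans (sym (enc-view {γ} (suc c))) (cong enc at)))

  -- As `bang` is letter `γ` and `errBang` state `suc γ`, it continues the rule that a wrong letter
  -- leads to the state numbered one higher, which is the rule built into `wrongCode`.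
  wrongLetters-numbers : ∀ {S : Set} (err : Γ → S) (errBang : S) (number : S → ℕ) →
    (∀ b → number (err b) ≡ suc (toℕ b)) → number errBang ≡ suc γ →
    List.map (λ (c , s) → toℕ c , number s) (wrongLetters err errBang) ≡ List.map (λ j → suc j , 2 + j) (downFrom (suc g))
  wrongLetters-numbers err errBang number eq eqBang = cong₂ _∷_
    (cong₂ _,_ (trans (Fin.toℕ-↑ʳ γ (zero {1})) (+-identityʳ γ)) eqBang)
    (trans (sym (map-∘ (down g))) (trans (map-cong (λ b → cong₂ _,_ (Fin.toℕ-↑ˡ (suc b) 2) (eq (suc b))) (down g))
      (trans (map-∘ (down g)) (cong (List.map (λ j → suc j , 2 + j)) (map-toℕ-down g)))))

  number-err : ∀ r (b : Γ) → toℕ (1 ↑ʳ ((b ↑ˡ 1) ↑ˡ r)) ≡ suc (toℕ b)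
  number-err r b = cong suc (trans (Fin.toℕ-↑ˡ (b ↑ˡ 1) r) (Fin.toℕ-↑ˡ b 1))

  number-errBang : ∀ r → toℕ (1 ↑ʳ ((γ ↑ʳ zero {0}) ↑ˡ r)) ≡ suc γ
  number-errBang r = cong suc (trans (Fin.toℕ-↑ˡ (γ ↑ʳ zero {0}) r) (trans (Fin.toℕ-↑ʳ γ zero) (+-identityʳ γ)))

  module SendFirstTemplate where

    module B = Completion.SendFirst coreNode home

    template : Template g
    template = record
      { base = B.machine
      ; iso  = layout errᶠ ⊤ᶠ (↔-trans sendFirst↔ (core↔ ⊎-↔ ↔-refl))
      ; initial-0 = refl ; initial-sends = refl
      ; bottom = B.core bottom ; bottom-n = layout-bottom (γ + 1) _
      ; wrongs = wrongLetters B.err B.errBang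
      ; wrong-numbers = wrongLetters-numbers B.err B.errBang _ (number-err _) (number-errBang _)
      }

    module _ (w : ℕ) where

      open Chain K P o drain w using (node; node-base)
      module M = Completion.SendFirst node (inj₁ home)

      lift : B.State → M.State
      lift (B.core c) = M.core (inj₁ c)
      lift (B.err b)  = M.err b
      lift B.errBang  = M.errBang
      lift B.flush    = M.flush

      split : M.State → B.State ⊎ Fin w
      split (M.core (inj₁ c)) = inj₁ (B.core c)
      split (M.core (inj₂ k)) = inj₂ k
      split (M.err b)         = inj₁ (B.err b)
      split M.errBang         = inj₁ B.errBang
      split M.flush           = inj₁ B.flush

      next-lift : ∀ s l → s ≢ B.core home → M.next (lift s) l ≡ Maybe.map lift (B.next s l)
      next-lift (B.core c) l s≢ = trans (cong (λ n → M.nodeNext n l) (node-base (s≢ ∘ cong B.core)))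
        (nodeNext-lift inj₁ lift (λ _ → refl) (λ _ → refl) refl refl (coreNode c) l)
      next-lift (B.err b) = each (λ _ → refl) refl refl
      next-lift B.errBang = each (λ _ → refl) refl refl
      next-lift B.flush = each (λ _ → refl) refl refl

      chained : Chained template w M.machine
      chained = record
        { lift = lift ; link = λ k → M.core (inj₂ k) ; split = split
        ; split-lift = λ { (B.core c) → refl ; (B.err b) → refl ; B.errBang → refl ; B.flush → refl }
        ; split-link = λ _ → refl
        ; unsplit = λ { (M.core (inj₁ c)) → refl ; (M.core (inj₂ k)) → refl ; (M.err b) → refl ; M.errBang → refl ; M.flush → refl }
        ; initial-lift = refl
        ; sends-lift = λ { (B.core c) → sends-base w c ; (B.err b) → refl ; B.errBang → refl ; B.flush → refl }
        ; sends-link = λ _ → refl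
        ; next-entry = cong just (topLink-natural M.core w)
        ; next-initial = λ { (char zero) p → contradiction refl p ; (char (suc b)) p → refl ; bang p → refl ; dollar p → refl }
        ; next-lift = next-lift
        ; next-link = λ k → cong just (predLink-natural M.core k)
        ; wrong-sound = λ _ → sound
        ; wrong-complete = λ _ → complete
        }
        where open WrongLetters B.err B.errBang lift (λ _ → refl) refl

  module RecvFirstTemplate where

    module B = Completion.RecvFirst coreNode home

    template : Template g
    template = record
      { base = B.machine
      ; iso  = layout errᶠ ↔-refl (↔-trans recvFirst↔ (core↔ ⊎-↔ ↔-refl))
      ; initial-0 = refl ; initial-sends = refl
      ; bottom = B.core bottom ; bottom-n = layout-bottom (γ + 1) _
      ; wrongs = wrongLetters B.err B.errBang
      ; wrong-numbers = wrongLetters-numbers B.err B.errBang _ (number-err _) (number-errBang _)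
      }

    module _ (w : ℕ) where

      open Chain K P o drain w using (node; node-base)
      module M = Completion.RecvFirst node (inj₁ home)

      lift : B.State → M.State
      lift (B.core c) = M.core (inj₁ c)
      lift (B.err b)  = M.err b
      lift B.errBang  = M.errBang
      lift B.waitClose = M.waitClose
      lift B.wait     = M.wait
      lift B.flush    = M.flush
      lift B.close    = M.close

      split : M.State → B.State ⊎ Fin w
      split (M.core (inj₁ c)) = inj₁ (B.core c)
      split (M.core (inj₂ k)) = inj₂ k
      split (M.err b)         = inj₁ (B.err b)
      split M.errBang         = inj₁ B.errBang
      split M.waitClose       = inj₁ B.waitClose
      split M.wait            = inj₁ B.wait
      split M.flush           = inj₁ B.flush
      split M.close           = inj₁ B.close

      next-lift : ∀ s l → s ≢ B.core home → M.next (lift s) l ≡ Maybe.map lift (B.next s l)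
      next-lift (B.core c) l s≢ = trans (cong (λ n → M.nodeNext n l) (node-base (s≢ ∘ cong B.core)))
        (nodeNext-lift inj₁ lift (λ _ → refl) (λ _ → refl) refl refl (coreNode c) l)
      next-lift (B.err b) = each (λ _ → refl) refl refl
      next-lift B.errBang = each (λ _ → refl) refl refl
      next-lift B.waitClose = each (λ _ → refl) refl refl
      next-lift B.wait = each (λ _ → refl) refl refl
      next-lift B.flush = each (λ _ → refl) refl refl
      next-lift B.close = each (λ _ → refl) refl refl

      chained : Chained template w M.machine
      chained = record
        { lift = lift ; link = λ k → M.core (inj₂ k) ; split = split
        ; split-lift = λ { (B.core c) → refl ; (B.err b) → refl ; B.errBang → refl ; B.waitClose → refl ; B.wait → refl ; B.flush → refl ; B.close → refl }
        ; split-link = λ _ → refl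
        ; unsplit = λ { (M.core (inj₁ c)) → refl ; (M.core (inj₂ k)) → refl ; (M.err b) → refl ; M.errBang → refl ; M.waitClose → refl ; M.wait → refl ; M.flush → refl ; M.close → refl }
        ; initial-lift = refl
        ; sends-lift = λ { (B.core c) → sends-base w c ; (B.err b) → refl ; B.errBang → refl ; B.waitClose → refl ; B.wait → refl ; B.flush → refl ; B.close → refl }
        ; sends-link = λ _ → refl
        ; next-entry = cong just (topLink-natural M.core w)
        ; next-initial = λ { (char zero) p → contradiction refl p ; (char (suc b)) p → refl ; bang p → refl ; dollar p → refl }
        ; next-lift = next-lift
        ; next-link = λ k → cong just (predLink-natural M.core k)
        ; wrong-sound = λ _ → sound
        ; wrong-complete = λ _ → complete
        }
        where open WrongLetters B.err B.errBang lift (λ _ → refl) refl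

-- The diagonal argument and the four constructions.

module Reduction (f : Rec 1) where

  program : Prog
  -- Register 0 is the input and register 1 the output; scratch starts at 2.
  program = compile (comp f (shiftedDiagonal ∷ [])) (0 ∷ []) 1 2

  K : ℕ
  K = maxRegister program

  runs : ∀ w {v} → f [ diagonal w ∷ [] ]⇓ v → ∃ λ σ → Run program ((λ _ → 0) [ 0 ≔ suc w ]) σ × σ 1 ≡ v
  runs w eval with compile-correct (comp (shiftedDiagonal-correct w ∷ []) eval) (0 ∷ []) 1 2 ((λ _ → 0) [ 0 ≔ suc w ])
    (λ { zero → refl }) (λ { zero → s≤s z≤n }) (s≤s (s≤s z≤n)) (λ { zero () }) refl (λ { (suc j) p → refl })
  ... | σ , run , set , _ = σ , run , set

-- The length of the chain codes everything else, so the pair gets its own code as input.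
module Diagonal {g : ℕ} (𝕋 : Template g) (F₁ : FSM (suc g + 2) (suc g + 2)) where

  open Template 𝕋

  opaque
    w : ℕ
    w = pair (suc g + 2) (pair (codeFSM F₁) (pair n (pair l baseCode)))

    -- The fixed point: decoding `w` and recomputing the code gives back the code of the machine
    -- whose chain has length `w`.
    diagonal-w : diagonal w ≡ hardwiredCode w (suc g + 2) (codeFSM F₁) n l baseCode
    diagonal-w = diagonal-pairs (suc g + 2) (codeFSM F₁) n l baseCode

  module _ {M : Mach (suc g)} (chained : Chained 𝕋 w M) where

    open Hardwire chained using (fsm; presents) public

    codePair-diagonal : ∀ P → P ≡ record { mα = suc g + 2 ; mβ = suc g + 2 ; F₀ = fsm ; F₁ = F₁ } → codePair P ≡ diagonal w
    codePair-diagonal _ refl = trans (Hardwire.codePair-hardwired chained F₁) (sym diagonal-w)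

-- Stated for an arbitrary counter program. Only `settled` and `finished` refer to its run; the
-- promise holds for every program, as it must, because `f` answers only for pairs that satisfy `Q`.
record Diagonalises (drain : Bool) (Q R : Pred Pair 0ℓ) (K : ℕ) (program : Prog) (o : ℕ) : Set where
  field
    P         : Pair
    w         : ℕ
    self-code : codePair P ≡ diagonal w
    promise   : Q P
    settled   : Chain.Settles K program o drain w → R P
    finished  : Chain.Finishes K program o drain w → ¬ R P

module PartialPair (K : ℕ) (program : Prog) (o : ℕ) (drain : Bool) where

  open QueueMachine K using (γ)
  open Assembly K program o drain using (module PartialTemplate)
  open PartialTemplate using (template; chained)

  M₁ : Mach γ
  M₁ = Completion.Partial.machine echoNode home

  open Diagonal template (listedFSM M₁ echo↔) using (w; presents; codePair-diagonal)
  open Facts K program o drain w using (isCore; quiet⇒limited; quiet⇒notStuck; grow⇒notStuck; grow⇒unlimited; drain⇒stuck)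
  open Machine K program o drain using (home)
  open Chain K program o drain w using (node)

  module C₀ = Completion node (inj₁ home)
  module C₁ = Completion (echoNode {γ}) home
  module E = Analysis.Embedding node (inj₁ home) C₀.Partial.extends C₁.Partial.extends refl refl
  module T₀ = Transfer (presents (chained w))
  module T₁ = Transfer (listed-presents M₁ echo↔)
  open TransferPair (presents (chained w)) (listed-presents M₁ echo↔) C₀.Partial.live C₁.Partial.live

  isSRPair : SRPair pairOf
  isSRPair = T₀.isSRMachine (PartialConnected.connected node (inj₁ home) isCore) , T₁.isSRMachine (PartialConnected.connected echoNode home echo-isCore)

  noSendCycles : NoSendCycles pairOf
  noSendCycles = T₀.noSendCycle _ (λ {p} {l} → PartialConnected.rank-next node (inj₁ home) isCore {p} {l})
               , T₁.noSendCycle _ (λ {p} {l} → PartialConnected.rank-next echoNode home echo-isCore {p} {l})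

  deadlock : T drain → Diagonalises drain (SRPair ∩ NoSendCycles) DeadlockFree K program o
  deadlock t = record
    { P = pairOf ; w = w ; self-code = codePair-diagonal (chained w) pairOf refl
    ; promise  = isSRPair , noSendCycles
    ; settled  = λ run → Equivalence.to deadlockFree (PartialAnalysis.neverDead node (inj₁ home) (quiet⇒notStuck run))
    ; finished = λ run free → E.stuck⇒dead (drain⇒stuck t run) (Equivalence.from deadlockFree free)
    }

  bounded : ¬ T drain → Diagonalises drain (SRPair ∩ NoSendCycles ∩ DeadlockFree) BoundedChannels K program o
  bounded ¬t = record
    { P = pairOf ; w = w ; self-code = codePair-diagonal (chained w) pairOf refl
    ; promise  = isSRPair , noSendCycles , Equivalence.to deadlockFree (PartialAnalysis.neverDead node (inj₁ home) (grow⇒notStuck ¬t))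
    ; settled  = λ run → Equivalence.to boundedChannels (PartialAnalysis.limited node (inj₁ home) (quiet⇒limited run))
    ; finished = λ run limited → E.unlimited⇒unlimited (grow⇒unlimited ¬t run) (Equivalence.from boundedChannels limited)
    }

module SendFirstPair (K : ℕ) (program : Prog) (o : ℕ) where

  open QueueMachine K using (γ)
  open Assembly K program o true using (module SendFirstTemplate)
  open SendFirstTemplate using (template; chained)

  M₁ : Mach γ
  M₁ = Completion.SendFirst.machine echoNode home

  M₁↔ : Mach.State M₁ ↔ Fin _
  M₁↔ = ↔-trans sendFirst↔ (echo↔ ⊎ᶠ (↔-refl ⊎ᶠ ⊤ᶠ) ⊎ᶠ ⊤ᶠ)

  open Diagonal template (listedFSM M₁ M₁↔) using (w; presents; codePair-diagonal)
  open Facts K program o true w using (isCore; quiet⇒notStuck; drain⇒stuck)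
  open Machine K program o true using (home)
  open Chain K program o true w using (node)

  module N₀ = SendFirstMachine node (inj₁ home) isCore
  module N₁ = SendFirstMachine (echoNode {γ}) home echo-isCore
  module E = Analysis.Embedding node (inj₁ home) N₀.extends N₁.extends refl refl
  module T₀ = Transfer (presents (chained w))
  module T₁ = Transfer (listed-presents M₁ M₁↔)
  open TransferPair (presents (chained w)) (listed-presents M₁ M₁↔) (Completion.SendFirst.live node (inj₁ home)) (Completion.SendFirst.live echoNode home)

  isSRPair : SRPair pairOf
  isSRPair = T₀.isSRMachine N₀.connected , T₁.isSRMachine N₁.connected

  -- Soundness of one machine and completeness of the other meet in `Phases`, flipped because what
  -- one machine sends the other receives.
  isAffine : Affine pairOf
  isAffine = affine (mk⇔
    (λ path → N₁.complete (flip-phases (N₀.rest-home (N₀.sound path))))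
    (λ path → N₀.complete (flip-phases (N₁.rest-home (N₁.sound path)))))

  deadlock : Diagonalises true (SRPair ∩ Affine) DeadlockFree K program o
  deadlock = record
    { P = pairOf ; w = w ; self-code = codePair-diagonal (chained w) pairOf refl
    ; promise  = isSRPair , isAffine
    ; settled  = λ run → Equivalence.to deadlockFree (SendFirstAnalysis.neverDead node (inj₁ home) (quiet⇒notStuck run))
    ; finished = λ run free → E.stuck⇒dead (drain⇒stuck tt run) (Equivalence.from deadlockFree free)
    }

module RecvFirstPair (K : ℕ) (program : Prog) (o : ℕ) where

  open QueueMachine K using (γ)
  open Assembly K program o false using (module RecvFirstTemplate)
  open RecvFirstTemplate using (template; chained)

  M₁ : Mach γ
  M₁ = Completion.RecvFirst.machine echoNode home

  M₁↔ : Mach.State M₁ ↔ Fin _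
  M₁↔ = ↔-trans recvFirst↔ (echo↔ ⊎ᶠ (↔-refl ⊎ᶠ ⊤ᶠ) ⊎ᶠ ↔-refl)

  open Diagonal template (listedFSM M₁ M₁↔) using (w; presents; codePair-diagonal)
  open Facts K program o false w using (isCore; rank-bound; quiet⇒limited; grow⇒unlimited)
  open Machine K program o false using (home)
  open Chain K program o false w using (node)

  module N₀ = RecvFirstMachine node (inj₁ home) isCore
  module N₁ = RecvFirstMachine (echoNode {γ}) home echo-isCore
  module E = Analysis.Embedding node (inj₁ home) N₀.extends N₁.extends refl refl
  module T₀ = Transfer (presents (chained w))
  module T₁ = Transfer (listed-presents M₁ M₁↔)
  open TransferPair (presents (chained w)) (listed-presents M₁ M₁↔) (Completion.RecvFirst.live node (inj₁ home)) (Completion.RecvFirst.live echoNode home)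

  isSRPair : SRPair pairOf
  isSRPair = T₀.isSRMachine N₀.connected , T₁.isSRMachine N₁.connected

  isAffine : Affine pairOf
  isAffine = affine (mk⇔
    (λ path → N₁.complete (flip-phases (N₀.rest-home (N₀.sound path))))
    (λ path → N₀.complete (flip-phases (N₁.rest-home (N₁.sound path)))))

  bounded : Diagonalises false (SRPair ∩ Affine) BoundedChannels K program o
  bounded = record
    { P = pairOf ; w = w ; self-code = codePair-diagonal (chained w) pairOf refl
    ; promise  = isSRPair , isAffine
    ; settled  = λ run → Equivalence.to boundedChannels
        (RecvFirstAnalysis.limited node (inj₁ home) (IsCore.rank isCore) (2 + w) rank-bound (λ {c} → IsCore.rank-snd isCore {c}) (quiet⇒limited run))
    ; finished = λ run limited → E.unlimited⇒unlimited (grow⇒unlimited (λ ()) run) (Equivalence.from boundedChannels limited)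
    }

-- Besides its answer, the decision procedure supplies a derivation that `f` returns it on the code
-- of `P`. That derivation becomes the run of the counter program which leads the pair to `quiet` or
-- to `final`, against the answer.
undecidable : ∀ {drain Q R} → (∀ K program o → Diagonalises drain Q R K program o) → Undecidable Q R
undecidable {drain} diagonalises (f , decides) = case decides P promise of λ where
    (false , eval , ofⁿ ¬r) → ¬r (settled (let σ , run , set = runs w (at-w eval) in settles (n≤1+n K) (s≤s z≤n) run set))
    (true  , eval , ofʸ r)  → finished (let σ , run , set = runs w (at-w eval) in finishes (n≤1+n K) (s≤s z≤n) run set) r
  where
  open Reduction f
  open Diagonalises (diagonalises K program 1)
  open Chain K program 1 drain w using (settles; finishes)
  at-w : ∀ {v} → f [ codePair P ∷ [] ]⇓ v → f [ diagonal w ∷ [] ]⇓ v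
  at-w = subst (λ c → f [ c ∷ [] ]⇓ _) self-code

theorem7p1 : Undecidable (SRPair ∩ NoSendCycles) DeadlockFree
    × Undecidable (SRPair ∩ NoSendCycles ∩ DeadlockFree) BoundedChannels
    × Undecidable (SRPair ∩ Affine) DeadlockFree
    × Undecidable (SRPair ∩ Affine) BoundedChannels
theorem7p1 = undecidable (λ K program o → PartialPair.deadlock K program o true tt)
           , undecidable (λ K program o → PartialPair.bounded K program o false (λ ()))
           , undecidable SendFirstPair.deadlock
           , undecidable RecvFirstPair.bounded
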